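{- Let $n$ be odd and let $G$ be a connected well-covered unicyclic graph of order $n$. Then $G\preceq M_n$.
   Context: All graphs are finite, simple and undirected. A graph is well-covered if all of its maximal independent sets have the same size. A connected unicyclic graph is a connected graph containing exactly one cycle. The independence polynomial of a graph $G$ is $I(G,x)=\sum_{k\ge 0} i_kx^k$, where $i_k$ is the number of independent sets of size $k$ in $G$. It is known that the root of $I(G,x)$ of smallest modulus is real and lies in $[-1,0)$; it is denoted $\xi(G)$ (equivalently, the largest real root of $I(G,x)$). For graphs $G,H$, write $H\preceq G$ if and only if $I(H,x)\ge I(G,x)$ for all $x\in[\xi(G),0]$. For $m\ge 3$, $U_m$ is the graph on $m$ vertices obtained from a triangle by attaching $m-3$ pendant vertices (leaves) to one fixed vertex of the triangle. For odd $n\ge 3$, $M_n$ is the graph of order $n$ obtained from $U_{(n+3)/2}$ by subdividing each of its pendant edges once; that is, $M_n$ consists of a triangle with a distinguished vertex $c$ together with $\frac{n-3}{2}$ disjoint copies of $K_2$, with exactly one vertex of each copy joined by an edge to $c$. -}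

module Defs where

open import Level using (0ℓ)
open import Data.Nat as ℕ using (ℕ; zero; suc)
import Data.Nat.Properties as ℕ
open import Data.Nat.DivMod using (_mod_)
open import Data.Nat.Divisibility using (_∣_)
open import Data.Integer using (+_)
open import Data.Rational as ℚ using (ℚ; 0ℚ; 1ℚ; ½)
import Data.Rational.Properties as ℚ
open import Data.Rational.Solver using (module +-*-Solver)
open import Data.Fin as Fin using (Fin; toℕ; splitAt; remQuot)
open import Data.Fin.Patterns using (0F)
open import Data.Fin.Properties as Fin using (all?)
open import Data.Fin.Subset using (Subset; inside; outside; _∈_; _⊆_; ∣_∣)
open import Data.Fin.Subset.Properties using (_∈?_)
open import Data.List.Base using (List; []; _∷_; _++_; map; foldr; filter; length; upTo)
open import Data.Vec.Base using ([]; _∷_)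
open import Data.Product using (∃; ∃-syntax; Σ-syntax; _×_; _,_; proj₁; proj₂)
open import Data.Sum using (_⊎_; inj₁; inj₂)
open import Function using (_∘_; _⇔_; Injective)
open import Relation.Binary using (Rel; Decidable; Symmetric; Irreflexive)
open import Relation.Binary.Construct.Closure.ReflexiveTransitive using (Star)
open import Relation.Binary.PropositionalEquality using (_≡_; _≢_; refl; sym; trans; cong; cong₂; subst)
open import Relation.Nullary using (Dec; ¬_; ¬?; _×-dec_; _→-dec_)

-- Real numbers: Cauchy sequences of rationals, with equality and order
-- defined on the sequences.

IsCauchy : (ℕ → ℚ) → Set
IsCauchy a = ∀ ε → 0ℚ ℚ.< ε →
  ∃[ N ] (∀ m n → N ℕ.≤ m → N ℕ.≤ n → ℚ.∣ a m ℚ.- a n ∣ ℚ.< ε)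

record ℝ : Set where
  constructor mkℝ
  field
    seq    : ℕ → ℚ
    cauchy : IsCauchy seq

open ℝ public

infix 4 _≈ᴿ_ _≤ᴿ_

_≈ᴿ_ : Rel ℝ 0ℓ
x ≈ᴿ y = ∀ ε → 0ℚ ℚ.< ε →
  ∃[ N ] (∀ n → N ℕ.≤ n → ℚ.∣ seq x n ℚ.- seq y n ∣ ℚ.< ε)

_≤ᴿ_ : Rel ℝ 0ℓ
x ≤ᴿ y = ∀ ε → 0ℚ ℚ.< ε →
  ∃[ N ] (∀ n → N ℕ.≤ n → seq x n ℚ.< seq y n ℚ.+ ε)

constᴿ : ℚ → ℝ
constᴿ q = mkℝ (λ _ → q) λ ε 0<ε →
  0 , λ _ _ _ _ → subst (λ d → ℚ.∣ d ∣ ℚ.< ε) (sym (ℚ.+-inverseʳ q)) 0<ε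

fromℕᴿ : ℕ → ℝ
fromℕᴿ k = constᴿ (+ k ℚ./ 1)

0ᴿ 1ᴿ : ℝ
0ᴿ = fromℕᴿ 0
1ᴿ = fromℕᴿ 1

private
  ⊔-split : ∀ {k} N₁ N₂ → N₁ ℕ.⊔ N₂ ℕ.≤ k → N₁ ℕ.≤ k × N₂ ℕ.≤ k
  ⊔-split N₁ N₂ le = ℕ.≤-trans (ℕ.m≤m⊔n N₁ N₂) le , ℕ.≤-trans (ℕ.m≤n⊔m N₁ N₂) le

  +-diff : ∀ a b c d → (a ℚ.+ b) ℚ.- (c ℚ.+ d) ≡ (a ℚ.- c) ℚ.+ (b ℚ.- d)
  +-diff = solve 4 (λ a b c d → (a :+ b) :- (c :+ d) := (a :- c) :+ (b :- d)) refl
    where open +-*-Solver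

  *-diff : ∀ a b c d → a ℚ.* b ℚ.- c ℚ.* d ≡ a ℚ.* (b ℚ.- d) ℚ.+ (a ℚ.- c) ℚ.* d
  *-diff = solve 4 (λ a b c d → a :* b :- c :* d := a :* (b :- d) :+ (a :- c) :* d) refl
    where open +-*-Solver

  -+-cancel : ∀ a c → a ≡ (a ℚ.- c) ℚ.+ c
  -+-cancel = solve 2 (λ a c → a := (a :- c) :+ c) refl
    where open +-*-Solver

  halves : ∀ ε → ½ ℚ.* ε ℚ.+ ½ ℚ.* ε ≡ ε
  halves ε = trans (sym (ℚ.*-distribʳ-+ ε ½ ½)) (ℚ.*-identityˡ ε)

  0<* : ∀ {p q} → 0ℚ ℚ.< p → 0ℚ ℚ.< q → 0ℚ ℚ.< p ℚ.* q
  0<* {p} {q} 0<p 0<q =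
    ℚ.positive⁻¹ _ {{ℚ.pos*pos⇒pos p {{ℚ.positive 0<p}} q {{ℚ.positive 0<q}}}}

  bounded : ∀ {a} → IsCauchy a →
    ∃[ K ] 0ℚ ℚ.< K × ∃[ N ] (∀ n → N ℕ.≤ n → ℚ.∣ a n ∣ ℚ.≤ K)
  bounded {a} ca with ca 1ℚ (ℚ.positive⁻¹ 1ℚ)
  ... | N , close = 1ℚ ℚ.+ ℚ.∣ a N ∣
                  , ℚ.+-mono-<-≤ (ℚ.positive⁻¹ 1ℚ) (ℚ.0≤∣p∣ (a N))
                  , N , bound
    where
    open ℚ.≤-Reasoning
    bound : ∀ n → N ℕ.≤ n → ℚ.∣ a n ∣ ℚ.≤ 1ℚ ℚ.+ ℚ.∣ a N ∣
    bound n N≤n = begin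
      ℚ.∣ a n ∣                          ≡⟨ cong ℚ.∣_∣ (-+-cancel (a n) (a N)) ⟩
      ℚ.∣ (a n ℚ.- a N) ℚ.+ a N ∣        ≤⟨ ℚ.∣p+q∣≤∣p∣+∣q∣ (a n ℚ.- a N) (a N) ⟩
      ℚ.∣ a n ℚ.- a N ∣ ℚ.+ ℚ.∣ a N ∣    ≤⟨ ℚ.+-monoˡ-≤ ℚ.∣ a N ∣ (ℚ.<⇒≤ (close n N N≤n ℕ.≤-refl)) ⟩
      1ℚ ℚ.+ ℚ.∣ a N ∣                   ∎

  +-cauchy : ∀ {a b} → IsCauchy a → IsCauchy b → IsCauchy (λ n → a n ℚ.+ b n)
  +-cauchy {a} {b} ca cb ε 0<ε
    with ca (½ ℚ.* ε) (0<* (ℚ.positive⁻¹ ½) 0<ε) | cb (½ ℚ.* ε) (0<* (ℚ.positive⁻¹ ½) 0<ε)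
  ... | N₁ , close₁ | N₂ , close₂ = N₁ ℕ.⊔ N₂ , λ m n Nm Nn →
    let m₁ , m₂ = ⊔-split N₁ N₂ Nm
        n₁ , n₂ = ⊔-split N₁ N₂ Nn
    in begin-strict
      ℚ.∣ (a m ℚ.+ b m) ℚ.- (a n ℚ.+ b n) ∣      ≡⟨ cong ℚ.∣_∣ (+-diff (a m) (b m) (a n) (b n)) ⟩
      ℚ.∣ (a m ℚ.- a n) ℚ.+ (b m ℚ.- b n) ∣      ≤⟨ ℚ.∣p+q∣≤∣p∣+∣q∣ (a m ℚ.- a n) (b m ℚ.- b n) ⟩
      ℚ.∣ a m ℚ.- a n ∣ ℚ.+ ℚ.∣ b m ℚ.- b n ∣    <⟨ ℚ.+-mono-< (close₁ m n m₁ n₁) (close₂ m n m₂ n₂) ⟩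
      ½ ℚ.* ε ℚ.+ ½ ℚ.* ε                        ≡⟨ halves ε ⟩
      ε                                          ∎
    where open ℚ.≤-Reasoning

  *-bound : ∀ {a b c d K L δ} → 0ℚ ℚ.< K → 0ℚ ℚ.< L →
    ℚ.∣ a ∣ ℚ.≤ K → ℚ.∣ d ∣ ℚ.≤ L →
    ℚ.∣ a ℚ.- c ∣ ℚ.< δ → ℚ.∣ b ℚ.- d ∣ ℚ.< δ →
    ℚ.∣ a ℚ.* b ℚ.- c ℚ.* d ∣ ℚ.< (K ℚ.+ L) ℚ.* δ
  *-bound {a} {b} {c} {d} {K} {L} {δ} 0<K 0<L ∣a∣≤K ∣d∣≤L ac<δ bd<δ = begin-strict
    ℚ.∣ a ℚ.* b ℚ.- c ℚ.* d ∣
      ≡⟨ cong ℚ.∣_∣ (*-diff a b c d) ⟩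
    ℚ.∣ a ℚ.* (b ℚ.- d) ℚ.+ (a ℚ.- c) ℚ.* d ∣
      ≤⟨ ℚ.∣p+q∣≤∣p∣+∣q∣ (a ℚ.* (b ℚ.- d)) ((a ℚ.- c) ℚ.* d) ⟩
    ℚ.∣ a ℚ.* (b ℚ.- d) ∣ ℚ.+ ℚ.∣ (a ℚ.- c) ℚ.* d ∣
      ≡⟨ cong₂ ℚ._+_ (ℚ.∣p*q∣≡∣p∣*∣q∣ a (b ℚ.- d)) (ℚ.∣p*q∣≡∣p∣*∣q∣ (a ℚ.- c) d) ⟩
    ℚ.∣ a ∣ ℚ.* ℚ.∣ b ℚ.- d ∣ ℚ.+ ℚ.∣ a ℚ.- c ∣ ℚ.* ℚ.∣ d ∣
      ≤⟨ ℚ.+-mono-≤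
           (ℚ.*-monoʳ-≤-nonNeg ℚ.∣ b ℚ.- d ∣ {{ℚ.nonNegative (ℚ.0≤∣p∣ (b ℚ.- d))}} ∣a∣≤K)
           (ℚ.*-monoˡ-≤-nonNeg ℚ.∣ a ℚ.- c ∣ {{ℚ.nonNegative (ℚ.0≤∣p∣ (a ℚ.- c))}} ∣d∣≤L) ⟩
    K ℚ.* ℚ.∣ b ℚ.- d ∣ ℚ.+ ℚ.∣ a ℚ.- c ∣ ℚ.* L
      <⟨ ℚ.+-mono-< (ℚ.*-monoʳ-<-pos K {{ℚ.positive 0<K}} bd<δ)
                    (ℚ.*-monoˡ-<-pos L {{ℚ.positive 0<L}} ac<δ) ⟩
    K ℚ.* δ ℚ.+ δ ℚ.* L
      ≡⟨ cong (K ℚ.* δ ℚ.+_) (ℚ.*-comm δ L) ⟩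
    K ℚ.* δ ℚ.+ L ℚ.* δ
      ≡⟨ sym (ℚ.*-distribʳ-+ δ K L) ⟩
    (K ℚ.+ L) ℚ.* δ ∎
    where open ℚ.≤-Reasoning

  divide : ∀ K ε → 0ℚ ℚ.< K → 0ℚ ℚ.< ε → ∃[ δ ] (0ℚ ℚ.< δ × K ℚ.* δ ≡ ε)
  divide K ε 0<K 0<ε = K⁻¹ ℚ.* ε , 0<* (ℚ.positive⁻¹ K⁻¹ {{ℚ.1/pos⇒pos K {{K-pos}}}}) 0<ε , eq
    where
    K-pos : ℚ.Positive K
    K-pos = ℚ.positive 0<K
    instance
      K-nonZero : ℚ.NonZero K
      K-nonZero = ℚ.pos⇒nonZero K {{K-pos}}
    K⁻¹ : ℚ
    K⁻¹ = ℚ.1/ K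
    eq : K ℚ.* (K⁻¹ ℚ.* ε) ≡ ε
    eq = trans (sym (ℚ.*-assoc K K⁻¹ ε))
               (trans (cong (ℚ._* ε) (ℚ.*-inverseʳ K)) (ℚ.*-identityˡ ε))

  -- Irrefutable patterns throughout: abstracting with `with` makes Agda
  -- normalise rational products, which is prohibitively slow.
  *-cauchy : ∀ {a b} → IsCauchy a → IsCauchy b → IsCauchy (λ n → a n ℚ.* b n)
  *-cauchy {a} {b} ca cb ε 0<ε =
    let K , 0<K , N₁ , ≤K = bounded {a} ca
        L , 0<L , N₂ , ≤L = bounded {b} cb
        δ , 0<δ , Kδ≡ε = divide (K ℚ.+ L) ε (ℚ.+-mono-< 0<K 0<L) 0<ε
        N₃ , close₃ = ca δ 0<δ
        N₄ , close₄ = cb δ 0<δ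
    in (N₁ ℕ.⊔ N₂) ℕ.⊔ (N₃ ℕ.⊔ N₄) , λ m n Nm Nn →
      let m₁₂ , m₃₄ = ⊔-split (N₁ ℕ.⊔ N₂) (N₃ ℕ.⊔ N₄) Nm
          n₁₂ , n₃₄ = ⊔-split (N₁ ℕ.⊔ N₂) (N₃ ℕ.⊔ N₄) Nn
          m₃ , m₄ = ⊔-split N₃ N₄ m₃₄
          n₃ , n₄ = ⊔-split N₃ N₄ n₃₄
      in subst (ℚ.∣ a m ℚ.* b m ℚ.- a n ℚ.* b n ∣ ℚ.<_) Kδ≡ε
           (*-bound {a m} {b m} {a n} {b n} {K} {L} {δ} 0<K 0<L
             (≤K m (proj₁ (⊔-split N₁ N₂ m₁₂))) (≤L n (proj₂ (⊔-split N₁ N₂ n₁₂)))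
             (close₃ m n m₃ n₃) (close₄ m n m₄ n₄))

infixl 6 _+ᴿ_
infixl 7 _*ᴿ_
infixr 8 _^ᴿ_

_+ᴿ_ : ℝ → ℝ → ℝ
mkℝ a ca +ᴿ mkℝ b cb = mkℝ (λ n → a n ℚ.+ b n) (+-cauchy {a} {b} ca cb)

_*ᴿ_ : ℝ → ℝ → ℝ
mkℝ a ca *ᴿ mkℝ b cb = mkℝ (λ n → a n ℚ.* b n) (*-cauchy {a} {b} ca cb)

_^ᴿ_ : ℝ → ℕ → ℝ
x ^ᴿ zero  = 1ᴿ
x ^ᴿ suc k = x *ᴿ x ^ᴿ k

record Graph (n : ℕ) : Set₁ where
  infix 4 _~_ _~?_
  field
    _~_     : Rel (Fin n) 0ℓ
    _~?_    : Decidable _~_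
    ~-sym   : Symmetric _~_
    ~-irrefl : Irreflexive _≡_ _~_

module _ {n : ℕ} (G : Graph n) where
  open Graph G

  Connected : Set
  Connected = ∀ u v → Star _~_ u v

  Independent : Subset n → Set
  Independent S = ∀ u v → u ∈ S → v ∈ S → ¬ (u ~ v)

  independent? : ∀ S → Dec (Independent S)
  independent? S = all? λ u → all? λ v →
    (u ∈? S) →-dec (v ∈? S) →-dec ¬? (u ~? v)

  MaximalIndependent : Subset n → Set
  MaximalIndependent S =
    Independent S × (∀ T → Independent T → S ⊆ T → T ≡ S)

  WellCovered : Set
  WellCovered = ∀ S T → MaximalIndependent S → MaximalIndependent T → ∣ S ∣ ≡ ∣ T ∣

next : ∀ {m} → Fin (suc m) → Fin (suc m)
next {m} i = suc (toℕ i) mod suc m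

-- A cycle of length 3 + len, presented by a starting vertex and a direction.
record Cycle {n : ℕ} (G : Graph n) : Set where
  open Graph G
  field
    len       : ℕ
    vertex    : Fin (3 ℕ.+ len) → Fin n
    injective : Injective _≡_ _≡_ vertex
    adjacent  : ∀ i → vertex i ~ vertex (next i)

module _ {n : ℕ} {G : Graph n} where

  _∋ᵉ_ : Cycle G → Fin n × Fin n → Set
  C ∋ᵉ (u , v) = ∃[ i ] ((u ≡ vertex i × v ≡ vertex (next i)) ⊎ (v ≡ vertex i × u ≡ vertex (next i)))
    where open Cycle C

  -- Two presentations give the same cycle, as a subgraph, when they have the
  -- same edges; this disregards the starting vertex and the direction.
  SameCycle : Cycle G → Cycle G → Set
  SameCycle C D = ∀ e → C ∋ᵉ e ⇔ D ∋ᵉ e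

Unicyclic : ∀ {n} → Graph n → Set
Unicyclic G = Σ[ C ∈ Cycle G ] (∀ D → SameCycle C D)

subsets : ∀ n → List (Subset n)
subsets zero    = [] ∷ []
subsets (suc n) = map (outside ∷_) (subsets n) ++ map (inside ∷_) (subsets n)

indepCount : ∀ {n} → Graph n → ℕ → ℕ
indepCount {n} G k =
  length (filter (λ S → independent? G S ×-dec (∣ S ∣ ℕ.≟ k)) (subsets n))

-- The value I(G, x); the sum stops at k = n since larger sets do not exist.
I : ∀ {n} → Graph n → ℝ → ℝ
I {n} G x =
  foldr _+ᴿ_ 0ᴿ (map (λ k → fromℕᴿ (indepCount G k) *ᴿ x ^ᴿ k) (upTo (suc n)))

-- ξ = ξ(G)
IsLargestRoot : ∀ {n} → Graph n → ℝ → Set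
IsLargestRoot G ξ = I G ξ ≈ᴿ 0ᴿ × (∀ y → I G y ≈ᴿ 0ᴿ → y ≤ᴿ ξ)

infix 4 _⪯_

_⪯_ : ∀ {m n} → Graph m → Graph n → Set
H ⪯ G = ∀ ξ → IsLargestRoot G ξ → ∀ x → ξ ≤ᴿ x → x ≤ᴿ 0ᴿ → I G x ≤ᴿ I H x

-- Triangle vertices, followed by k copies of K₂; 0F is the distinguished
-- vertex of the triangle, and (j , 0F) the vertex of copy j joined to it.
MVertex : ℕ → Set
MVertex k = Fin 3 ⊎ (Fin k × Fin 2)

MAdj : ∀ {k} → Rel (MVertex k) 0ℓ
MAdj (inj₁ a)       (inj₁ b)       = a ≢ b
MAdj (inj₁ a)       (inj₂ (_ , s)) = a ≡ 0F × s ≡ 0F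
MAdj (inj₂ (_ , s)) (inj₁ a)       = a ≡ 0F × s ≡ 0F
MAdj (inj₂ (i , s)) (inj₂ (j , t)) = i ≡ j × s ≢ t

private
  MAdj? : ∀ {k} → Decidable (MAdj {k})
  MAdj? (inj₁ a)       (inj₁ b)       = ¬? (a Fin.≟ b)
  MAdj? (inj₁ a)       (inj₂ (_ , s)) = (a Fin.≟ 0F) ×-dec (s Fin.≟ 0F)
  MAdj? (inj₂ (_ , s)) (inj₁ a)       = (a Fin.≟ 0F) ×-dec (s Fin.≟ 0F)
  MAdj? (inj₂ (i , s)) (inj₂ (j , t)) = (i Fin.≟ j) ×-dec ¬? (s Fin.≟ t)

  MAdj-sym : ∀ {k} → Symmetric (MAdj {k})
  MAdj-sym {_} {inj₁ _} {inj₁ _} a≢b         = a≢b ∘ sym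
  MAdj-sym {_} {inj₁ _} {inj₂ _} e           = e
  MAdj-sym {_} {inj₂ _} {inj₁ _} e           = e
  MAdj-sym {_} {inj₂ _} {inj₂ _} (i≡j , s≢t) = sym i≡j , s≢t ∘ sym

  MAdj-irrefl : ∀ {k} (u : MVertex k) → ¬ MAdj u u
  MAdj-irrefl (inj₁ _) a≢a       = a≢a refl
  MAdj-irrefl (inj₂ _) (_ , s≢s) = s≢s refl

Mview : ∀ k → Fin (3 ℕ.+ k ℕ.* 2) → MVertex k
Mview k v with splitAt 3 v
... | inj₁ a = inj₁ a
... | inj₂ w = inj₂ (remQuot 2 w)

triangleWithK₂s : ∀ k → Graph (3 ℕ.+ k ℕ.* 2)
triangleWithK₂s k = record
  { _~_      = λ u v → MAdj (Mview k u) (Mview k v)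
  ; _~?_     = λ u v → MAdj? (Mview k u) (Mview k v)
  ; ~-sym    = λ {u} {v} → MAdj-sym {k} {Mview k u} {Mview k v}
  ; ~-irrefl = λ { {u} refl → MAdj-irrefl (Mview k u) }
  }

-- For odd n ≥ 3 the index below is n; other values of n are junk.
M : ∀ n → Graph (3 ℕ.+ ℕ.⌊ n ℕ.∸ 3 /2⌋ ℕ.* 2)
M n = triangleWithK₂s ℕ.⌊ n ℕ.∸ 3 /2⌋

Odd : ℕ → Set
Odd n = ¬ (2 ∣ n)

{-# OPTIONS --safe #-}

-- Write t = −x, u = 1 − t and v = 1 − 2t, so that I(Mₙ, x) = v^(k+1) − t u^k for n = 2k + 3.
-- Well-coveredness forbids two leaves at one vertex, so deleting leaves with their supports peels G down
-- to its cycle; since n is odd the cycle is odd, and G grows from it by attaching pendant paths w s l.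
-- Such a step gives I(G) = u I(G′) − t I(G′ − w), so the bound follows by induction once
-- I(G′ − w) ≤ v^m for the graph G′ of order 2m + 1.  Removing one vertex of the cycle leaves a forest
-- with a perfect matching, all of whose induced subgraphs satisfy simultaneous upper and lower bounds;
-- these give both this estimate and the positivity it relies on.
module Submission where

open import Defs
open import Data.Bool.Base using (Bool; true; false; _∧_; _∨_; not; if_then_else_)
import Data.Bool.Properties as 𝔹
open import Data.Empty using (⊥; ⊥-elim)
open import Data.Fin as Fin using (Fin; zero; suc; toℕ; _↑ˡ_; _↑ʳ_; combine; splitAt)
open import Data.Fin.Patterns using (0F; 1F; 2F)
import Data.Fin.Properties as Fin
open import Data.Fin.Subset using (Subset; ∣_∣) renaming (_∈_ to _∈ˢ_)
import Data.Fin.Subset.Properties as Subset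
import Data.Integer as ℤ
import Data.Integer.Properties as ℤ
open import Data.List.Base using (List; []; _∷_; _++_; map; foldr; filter; length; upTo; applyUpTo; tabulate; allFin)
open import Data.List.Membership.Propositional using (_∈_)
open import Data.List.Membership.Propositional.Properties using (∈-allFin)
open import Data.List.Relation.Unary.All as All using (_∷_)
open import Data.List.Relation.Unary.AllPairs using (_∷_)
open import Data.List.Relation.Unary.Any as Any using (here; there)
open import Data.List.Relation.Unary.Unique.Propositional using (Unique)
open import Data.List.Relation.Unary.Unique.Propositional.Properties using (allFin⁺)
open import Data.Nat as ℕ using (ℕ; zero; suc)
open import Data.Nat.Divisibility using (divides)
open import Data.Nat.DivMod using (_mod_; _%_; m<n⇒m%n≡m; n%n≡0)
import Data.Nat.Properties as ℕ
open import Data.Product using (∃-syntax; _×_; _,_; proj₁; proj₂)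
open import Data.Rational as ℚ using (ℚ; 0ℚ; 1ℚ; ½; _+_; _*_; _-_; -_; _≤_; _<_)
import Data.Rational.Properties as ℚ
open import Data.Rational.Solver using (module +-*-Solver)
open import Data.Rational.Unnormalised as ℚᵘ using (mkℚᵘ)
import Data.Rational.Unnormalised.Properties as ℚᵘ
open import Data.Sum using (_⊎_; inj₁; inj₂)
open import Data.Vec.Base as Vec using ([]; _∷_; here; there; lookup)
open import Data.Vec.Properties using ([]=⇒lookup; lookup⇒[]=; lookup∘tabulate)
open import Function using (_∘_; id; module Equivalence)
open import Relation.Binary using (tri<; tri≈; tri>)
open import Relation.Binary.Construct.Closure.ReflexiveTransitive as Star using (Star; ε; _◅_; _◅◅_)
open import Relation.Binary.PropositionalEquality using (_≡_; _≢_; refl; sym; trans; cong; cong₂; subst; subst₂; module ≡-Reasoning)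
open import Relation.Nullary using (Dec; yes; no; ¬_; does; _×-dec_)
open import Relation.Nullary.Decidable using (toSum; dec-true)

-- Ordered-field lemmas

-- The hypothesis `ξ ≤ x ≤ 0` carries no sign information by itself. The polynomial of Mₙ is
-- non-negative at 0 and non-positive at `- ½`, so bisection finds a root in `[- ½ , 0]`; since `ξ`
-- is the largest root, it is at least that one. Hence only `0 ≤ t ≤ ½` matters, and there
-- non-negativity of I(Mₙ) reads `t u^k ≤ v^(k+1)`, a condition inherited by smaller `t`. Multiplied
-- by `u`, it is exactly what keeps the lower bounds for forests with k + 1 pairs non-negative. This
-- positivity is the crux. Values at negative arguments are not monotone under deleting vertices: a
-- term may be dropped from a recurrence only when the polynomial in it is known to be non-negative.
-- So the upper bounds for forests need the lower ones and conversely, and neither induction runs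
-- alone. All inequalities are shown at rational points. The terms of the Cauchy sequences satisfy
-- `ξ ≤ x ≤ 0` only up to an error, which Lipschitz estimates absorb.

≤-by : ∀ {a b} d → 0ℚ ≤ d → b ≡ a + d → a ≤ b
≤-by {a} {b} d 0≤d b≡ = subst (a ≤_) (sym b≡)
  (subst (_≤ a + d) (ℚ.+-identityʳ a) (ℚ.+-monoʳ-≤ a 0≤d))

0≤-- : ∀ {a b} → a ≤ b → 0ℚ ≤ b - a
0≤-- {a} {b} a≤b = subst (_≤ b - a) (ℚ.+-inverseʳ a) (ℚ.+-monoˡ-≤ (- a) a≤b)

0≤+ : ∀ {a b} → 0ℚ ≤ a → 0ℚ ≤ b → 0ℚ ≤ a + b
0≤+ {a} {b} 0≤a 0≤b = ℚ.≤-trans 0≤a (≤-by b 0≤b refl)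

*-monoˡ : ∀ {c a b} → 0ℚ ≤ c → a ≤ b → c * a ≤ c * b
*-monoˡ {c} 0≤c = ℚ.*-monoˡ-≤-nonNeg c {{ℚ.nonNegative 0≤c}}

0≤* : ∀ {a b} → 0ℚ ≤ a → 0ℚ ≤ b → 0ℚ ≤ a * b
0≤* {a} {b} 0≤a 0≤b = subst (_≤ a * b) (ℚ.*-zeroʳ a) (*-monoˡ 0≤a 0≤b)

*-mono : ∀ {a b c d} → 0ℚ ≤ a → 0ℚ ≤ d → a ≤ b → c ≤ d → a * c ≤ b * d
*-mono {a} {b} {c} {d} 0≤a 0≤d a≤b c≤d =
  ℚ.≤-trans (*-monoˡ 0≤a c≤d) (ℚ.*-monoʳ-≤-nonNeg d {{ℚ.nonNegative 0≤d}} a≤b)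

*-cancelˡ : ∀ {c a b} → 0ℚ < c → c * a ≤ c * b → a ≤ b
*-cancelˡ {c} 0<c = ℚ.*-cancelˡ-≤-pos c {{ℚ.positive 0<c}}

infixr 8 _^_
_^_ : ℚ → ℕ → ℚ
q ^ zero  = 1ℚ
q ^ suc k = q * q ^ k

0≤1 : 0ℚ ≤ 1ℚ
0≤1 = ℚ.nonNegative⁻¹ 1ℚ

0≤^ : ∀ {q} k → 0ℚ ≤ q → 0ℚ ≤ q ^ k
0≤^ zero    0≤q = 0≤1
0≤^ (suc k) 0≤q = 0≤* 0≤q (0≤^ k 0≤q)

0<* : ∀ {a b} → 0ℚ < a → 0ℚ < b → 0ℚ < a * b
0<* {a} {b} 0<a 0<b =
  ℚ.positive⁻¹ _ {{ℚ.pos*pos⇒pos a {{ℚ.positive 0<a}} b {{ℚ.positive 0<b}}}}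

0<^ : ∀ {q} k → 0ℚ < q → 0ℚ < q ^ k
0<^ zero    0<q = ℚ.positive⁻¹ 1ℚ
0<^ (suc k) 0<q = 0<* 0<q (0<^ k 0<q)

^-mono : ∀ {p q} k → 0ℚ ≤ p → p ≤ q → p ^ k ≤ q ^ k
^-mono zero    0≤p p≤q = ℚ.≤-refl
^-mono (suc k) 0≤p p≤q = *-mono 0≤p (0≤^ k (ℚ.≤-trans 0≤p p≤q)) p≤q (^-mono k 0≤p p≤q)

^-distrib-* : ∀ p q k → (p * q) ^ k ≡ p ^ k * q ^ k
^-distrib-* p q zero    = refl
^-distrib-* p q (suc k) = trans (cong (p * q *_) (^-distrib-* p q k))
  (solve 4 (λ p q a b → (p :* q) :* (a :* b) := (p :* a) :* (q :* b)) refl p q (p ^ k) (q ^ k))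
  where open +-*-Solver

-- Independence polynomials of induced subgraphs

VSet : ℕ → Set
VSet n = Fin n → Bool

infix 4 _≐_ _⊑_
_≐_ _⊑_ : ∀ {n} → VSet n → VSet n → Set
A ≐ B = ∀ w → A w ≡ B w
A ⊑ B = ∀ w → A w ≡ true → B w ≡ true

bool-ext : ∀ {a b : Bool} → (a ≡ true → b ≡ true) → (b ≡ true → a ≡ true) → a ≡ b
bool-ext {true}  {b}     f g = sym (f refl)
bool-ext {false} {true}  f g = g refl
bool-ext {false} {false} f g = refl

≐-by : ∀ {n} {A B : VSet n} → A ⊑ B → B ⊑ A → A ≐ B
≐-by A⊑B B⊑A w = bool-ext (A⊑B w) (B⊑A w)

true≢false : ∀ {a : Bool} → a ≡ true → ¬ (a ≡ false)
true≢false refl ()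

true⊎false : (a : Bool) → a ≡ true ⊎ a ≡ false
true⊎false true  = inj₁ refl
true⊎false false = inj₂ refl

≢true⇒false : ∀ {a : Bool} → ¬ (a ≡ true) → a ≡ false
≢true⇒false {true}  ¬p = ⊥-elim (¬p refl)
≢true⇒false {false} ¬p = refl

∧-true : ∀ {a b : Bool} → a ∧ b ≡ true → a ≡ true × b ≡ true
∧-true {true} {true} _ = refl , refl

module _ {P : Set} where
  ∧-not⁻ : ∀ {a} (d : Dec P) → a ∧ not (does d) ≡ true → a ≡ true × ¬ P
  ∧-not⁻ {true} (no ¬p) _ = refl , ¬p

  ∧-not⁺ : ∀ {a} (d : Dec P) → a ≡ true → ¬ P → a ∧ not (does d) ≡ true
  ∧-not⁺ (yes p) refl ¬p = ⊥-elim (¬p p)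
  ∧-not⁺ (no  _) refl ¬p = refl

  ∨-dec⁻ : ∀ {a} (d : Dec P) → a ∨ does d ≡ true → a ≡ true ⊎ P
  ∨-dec⁻ {true}  d       _ = inj₁ refl
  ∨-dec⁻ {false} (yes p) _ = inj₂ p

  ∨-dec⁺ʳ : ∀ {a} (d : Dec P) → P → a ∨ does d ≡ true
  ∨-dec⁺ʳ {true}  d       p = refl
  ∨-dec⁺ʳ {false} (yes _) p = refl
  ∨-dec⁺ʳ {false} (no ¬p) p = ⊥-elim (¬p p)

∨-dec⁺ˡ : ∀ {a b} → a ≡ true → a ∨ b ≡ true
∨-dec⁺ˡ refl = refl

∅ full : ∀ {n} → VSet n
∅    _ = false
full _ = true

infixl 6 _⊕_ _⊝_
abstract
  -- Sealed, so that membership is handled only through the introduction and elimination rules below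
  -- and goals do not unfold into Boolean expressions.
  _⊕_ _⊝_ : ∀ {n} → VSet n → Fin n → VSet n
  (A ⊕ v) w = A w ∨ does (v Fin.≟ w)
  (A ⊝ v) w = A w ∧ not (does (v Fin.≟ w))

  ⊝⁻ : ∀ {n} {A : VSet n} {v w} → (A ⊝ v) w ≡ true → A w ≡ true × v ≢ w
  ⊝⁻ {v = v} {w} = ∧-not⁻ (v Fin.≟ w)

  ⊝⁺ : ∀ {n} {A : VSet n} {v w} → A w ≡ true → v ≢ w → (A ⊝ v) w ≡ true
  ⊝⁺ {v = v} {w} = ∧-not⁺ (v Fin.≟ w)

  ⊕⁻ : ∀ {n} {A : VSet n} {v w} → (A ⊕ v) w ≡ true → A w ≡ true ⊎ v ≡ w
  ⊕⁻ {v = v} {w} = ∨-dec⁻ (v Fin.≟ w)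

  ⊕⁺ˡ : ∀ {n} {A : VSet n} {v w} → A w ≡ true → (A ⊕ v) w ≡ true
  ⊕⁺ˡ = ∨-dec⁺ˡ

  ⊕⁺ʳ : ∀ {n} {A : VSet n} {v w} → v ≡ w → (A ⊕ v) w ≡ true
  ⊕⁺ʳ {v = v} {w} = ∨-dec⁺ʳ (v Fin.≟ w)

⊝-self : ∀ {n} (A : VSet n) v → (A ⊝ v) v ≡ false
⊝-self A v = ≢true⇒false λ e → proj₂ (⊝⁻ e) refl

⊝-⊑ : ∀ {n} (A : VSet n) v → A ⊝ v ⊑ A
⊝-⊑ A v w e = proj₁ (⊝⁻ e)

⊕-⊝ : ∀ {n} {A : VSet n} {v} → A v ≡ false → (A ⊕ v) ⊝ v ≐ A
⊕-⊝ {A = A} {v} Av = ≐-by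
  (λ w e → case w (⊕⁻ (proj₁ (⊝⁻ e))) (proj₂ (⊝⁻ e)))
  (λ w e → ⊝⁺ (⊕⁺ˡ e) λ { refl → true≢false e Av })
  where
  case : ∀ w → A w ≡ true ⊎ v ≡ w → v ≢ w → A w ≡ true
  case w (inj₁ e) _ = e
  case w (inj₂ e) n = ⊥-elim (n e)

module Polynomial {n : ℕ} (G : Graph n) (t : ℚ) where
  open Graph G
  open +-*-Solver using (solve; _:+_; _:*_; _:-_; _:=_; con)

  infixl 6 _⊝N_
  abstract
    _⊝N_ : VSet n → Fin n → VSet n
    (A ⊝N v) w = A w ∧ not (does (v ~? w))

    ⊝N⁻ : ∀ {A v w} → (A ⊝N v) w ≡ true → A w ≡ true × ¬ v ~ w
    ⊝N⁻ {v = v} {w} = ∧-not⁻ (v ~? w)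

    ⊝N⁺ : ∀ {A v w} → A w ≡ true → ¬ v ~ w → (A ⊝N v) w ≡ true
    ⊝N⁺ {v = v} {w} = ∧-not⁺ (v ~? w)

  ⊝N-cong-at : ∀ {A B v w} → A w ≡ B w → (A ⊝N v) w ≡ (B ⊝N v) w
  ⊝N-cong-at eq = bool-ext
    (λ e → let Aw , v≁w = ⊝N⁻ e in ⊝N⁺ (trans (sym eq) Aw) v≁w)
    (λ e → let Bw , v≁w = ⊝N⁻ e in ⊝N⁺ (trans eq Bw) v≁w)

  -- Q vs A is I(G[A ∩ vs], − t).
  Q : List (Fin n) → VSet n → ℚ
  Q []       A = 1ℚ
  Q (v ∷ vs) A = if A v then Q vs A - t * Q vs (A ⊝N v) else Q vs A

  P : VSet n → ℚ
  P = Q (allFin n)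

  Q-true : ∀ v vs {A} → A v ≡ true → Q (v ∷ vs) A ≡ Q vs A - t * Q vs (A ⊝N v)
  Q-true v vs e rewrite e = refl

  Q-false : ∀ v vs {A} → A v ≡ false → Q (v ∷ vs) A ≡ Q vs A
  Q-false v vs e rewrite e = refl

  Q-cong : ∀ vs {A B} → (∀ w → w ∈ vs → A w ≡ B w) → Q vs A ≡ Q vs B
  Q-cong []       eq = refl
  Q-cong (v ∷ vs) {A} {B} eq with A v in a | B v in b
  ... | true  | true  = cong₂ (λ p q → p - t * q) (Q-cong vs λ w w∈ → eq w (there w∈))
                          (Q-cong vs λ w w∈ → ⊝N-cong-at (eq w (there w∈)))
  ... | false | false = Q-cong vs λ w w∈ → eq w (there w∈)
  ... | true  | false = ⊥-elim (true≢false a (trans (eq v (here refl)) b))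
  ... | false | true  = ⊥-elim (true≢false b (trans (sym (eq v (here refl))) a))

  P-cong : ∀ {A B} → A ≐ B → P A ≡ P B
  P-cong eq = Q-cong (allFin n) λ w _ → eq w

  Q-empty : ∀ vs {A} → (∀ w → A w ≡ false) → Q vs A ≡ 1ℚ
  Q-empty []       eq = refl
  Q-empty (v ∷ vs) eq = trans (Q-false v vs (eq v)) (Q-empty vs eq)

  private
    ring₁ : ∀ a b c → (a - t * b) - t * c ≡ (a - t * c) - t * b
    ring₁ = solve 4 (λ t a b c → (a :- t :* b) :- t :* c := (a :- t :* c) :- t :* b) refl t

    ring₂ : ∀ a b c d → (a - t * b) - t * (c - t * d) ≡ (a - t * c) - t * (b - t * d)
    ring₂ = solve 5 (λ t a b c d → (a :- t :* b) :- t :* (c :- t :* d) :=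
                                   (a :- t :* c) :- t :* (b :- t :* d)) refl t

  -- `Q` branches on the vertices in list order, so the point is that `u` can be moved to the front.
  -- If `u ~ v`, the branch taking `v` has already lost `u` and only the other branch is split; if
  -- not, the deletions at `u` and at `v` commute.
  Q-delete : ∀ vs {u A} → Unique vs → u ∈ vs → A u ≡ true →
    Q vs A ≡ Q vs (A ⊝ u) - t * Q vs (A ⊝N u ⊝ u)
  Q-delete (u ∷ vs) {_} {A} (u∉vs ∷ _) (here refl) Au = begin
    Q (u ∷ vs) A                                       ≡⟨ Q-true u vs Au ⟩
    Q vs A - t * Q vs (A ⊝N u)                         ≡⟨ cong₂ (λ p q → p - t * q) (drop A) (drop (A ⊝N u)) ⟩
    Q vs (A ⊝ u) - t * Q vs (A ⊝N u ⊝ u)               ≡⟨ cong₂ (λ p q → p - t * q) (skip A) (skip (A ⊝N u)) ⟩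
    Q (u ∷ vs) (A ⊝ u) - t * Q (u ∷ vs) (A ⊝N u ⊝ u)   ∎
    where
    open ≡-Reasoning
    drop : ∀ B → Q vs B ≡ Q vs (B ⊝ u)
    drop B = Q-cong vs λ w w∈ → bool-ext
      (λ e → ⊝⁺ e (All.lookup u∉vs w∈)) (⊝-⊑ B u w)
    skip : ∀ B → Q vs (B ⊝ u) ≡ Q (u ∷ vs) (B ⊝ u)
    skip B = sym (Q-false u vs (⊝-self B u))
  Q-delete (v ∷ vs) {u} {A} (v∉vs ∷ uniq) (there u∈) Au with true⊎false (A v)
  ... | inj₂ Av = begin
    Q (v ∷ vs) A                                       ≡⟨ Q-false v vs Av ⟩
    Q vs A                                             ≡⟨ Q-delete vs uniq u∈ Au ⟩
    Q vs (A ⊝ u) - t * Q vs (A ⊝N u ⊝ u)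
      ≡⟨ cong₂ (λ p q → p - t * q)
           (sym (Q-false v vs (≢true⇒false λ e → true≢false (⊝-⊑ A u v e) Av)))
           (sym (Q-false v vs (≢true⇒false λ e →
             true≢false (proj₁ (⊝N⁻ (⊝-⊑ (A ⊝N u) u v e))) Av))) ⟩
    Q (v ∷ vs) (A ⊝ u) - t * Q (v ∷ vs) (A ⊝N u ⊝ u)   ∎
    where open ≡-Reasoning
  ... | inj₁ Av with toSum (u ~? v)
  ...   | inj₁ u~v = begin
    Q (v ∷ vs) A
      ≡⟨ Q-true v vs Av ⟩
    Q vs A - t * Q vs (A ⊝N v)
      ≡⟨ cong₂ (λ p q → p - t * q) (Q-delete vs uniq u∈ Au) (Q-cong vs λ w _ → eq w) ⟩
    (Q vs (A ⊝ u) - t * Q vs (A ⊝N u ⊝ u)) - t * Q vs (A ⊝ u ⊝N v)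
      ≡⟨ ring₁ (Q vs (A ⊝ u)) (Q vs (A ⊝N u ⊝ u)) (Q vs (A ⊝ u ⊝N v)) ⟩
    (Q vs (A ⊝ u) - t * Q vs (A ⊝ u ⊝N v)) - t * Q vs (A ⊝N u ⊝ u)
      ≡⟨ cong₂ (λ p q → p - t * q)
           (sym (Q-true v vs (⊝⁺ Av u≢v)))
           (sym (Q-false v vs (≢true⇒false λ e →
             proj₂ (⊝N⁻ (⊝-⊑ (A ⊝N u) u v e)) u~v))) ⟩
    Q (v ∷ vs) (A ⊝ u) - t * Q (v ∷ vs) (A ⊝N u ⊝ u) ∎
    where
    open ≡-Reasoning
    u≢v : u ≢ v
    u≢v refl = All.lookup v∉vs u∈ refl
    eq : A ⊝N v ≐ A ⊝ u ⊝N v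
    eq = ≐-by
      (λ w e → let Aw , v≁w = ⊝N⁻ e in
        ⊝N⁺ (⊝⁺ Aw λ { refl → v≁w (~-sym u~v) }) v≁w)
      (λ w e → let Aw , v≁w = ⊝N⁻ e in ⊝N⁺ (⊝-⊑ A u w Aw) v≁w)
  ...   | inj₂ u≁v = begin
    Q (v ∷ vs) A
      ≡⟨ Q-true v vs Av ⟩
    Q vs A - t * Q vs (A ⊝N v)
      ≡⟨ cong₂ (λ p q → p - t * q) (Q-delete vs uniq u∈ Au)
           (Q-delete vs uniq u∈ (⊝N⁺ Au (u≁v ∘ ~-sym))) ⟩
    (Q vs (A ⊝ u) - t * Q vs (A ⊝N u ⊝ u)) - t * (Q vs (A ⊝N v ⊝ u) - t * Q vs (A ⊝N v ⊝N u ⊝ u))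
      ≡⟨ ring₂ (Q vs (A ⊝ u)) (Q vs (A ⊝N u ⊝ u)) (Q vs (A ⊝N v ⊝ u)) (Q vs (A ⊝N v ⊝N u ⊝ u)) ⟩
    (Q vs (A ⊝ u) - t * Q vs (A ⊝N v ⊝ u)) - t * (Q vs (A ⊝N u ⊝ u) - t * Q vs (A ⊝N v ⊝N u ⊝ u))
      ≡⟨ cong₂ (λ p q → (Q vs (A ⊝ u) - t * p) - t * (Q vs (A ⊝N u ⊝ u) - t * q))
           (Q-cong vs λ w _ → swap w) (Q-cong vs λ w _ → swap′ w) ⟩
    (Q vs (A ⊝ u) - t * Q vs (A ⊝ u ⊝N v)) - t * (Q vs (A ⊝N u ⊝ u) - t * Q vs (A ⊝N u ⊝ u ⊝N v))
      ≡⟨ cong₂ (λ p q → p - t * q)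
           (sym (Q-true v vs (⊝⁺ Av u≢v)))
           (sym (Q-true v vs (⊝⁺ (⊝N⁺ Av u≁v) u≢v))) ⟩
    Q (v ∷ vs) (A ⊝ u) - t * Q (v ∷ vs) (A ⊝N u ⊝ u) ∎
    where
    open ≡-Reasoning
    u≢v : u ≢ v
    u≢v refl = All.lookup v∉vs u∈ refl
    swap : A ⊝N v ⊝ u ≐ A ⊝ u ⊝N v
    swap = ≐-by
      (λ w e → let e₁ , u≢w = ⊝⁻ e ; Aw , v≁w = ⊝N⁻ e₁ in ⊝N⁺ (⊝⁺ Aw u≢w) v≁w)
      (λ w e → let e₁ , v≁w = ⊝N⁻ e ; Aw , u≢w = ⊝⁻ e₁ in ⊝⁺ (⊝N⁺ Aw v≁w) u≢w)
    swap′ : A ⊝N v ⊝N u ⊝ u ≐ A ⊝N u ⊝ u ⊝N v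
    swap′ = ≐-by
      (λ w e → let e₁ , u≢w = ⊝⁻ e ; e₂ , u≁w = ⊝N⁻ e₁ ; Aw , v≁w = ⊝N⁻ e₂ in
        ⊝N⁺ (⊝⁺ (⊝N⁺ Aw u≁w) u≢w) v≁w)
      (λ w e → let e₁ , v≁w = ⊝N⁻ e ; e₂ , u≢w = ⊝⁻ e₁ ; Aw , u≁w = ⊝N⁻ e₂ in
        ⊝⁺ (⊝N⁺ (⊝N⁺ Aw v≁w) u≁w) u≢w)

  P-delete : ∀ {A} u → A u ≡ true → P A ≡ P (A ⊝ u) - t * P (A ⊝N u ⊝ u)
  P-delete u = Q-delete (allFin n) (allFin⁺ n) (∈-allFin u)

  -- The values at `- t` of the independence polynomials of K₁ and K₂.
  u v : ℚ
  u = 1ℚ - t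
  v = u - t

  P-isolated : ∀ {A} x → A x ≡ true → (∀ w → A w ≡ true → ¬ x ~ w) → P A ≡ u * P (A ⊝ x)
  P-isolated {A} x Ax iso = begin
    P A                                    ≡⟨ P-delete x Ax ⟩
    P (A ⊝ x) - t * P (A ⊝N x ⊝ x)         ≡⟨ cong (λ p → P (A ⊝ x) - t * p) (P-cong eq) ⟩
    P (A ⊝ x) - t * P (A ⊝ x)              ≡⟨ solve 2 (λ t p → p :- t :* p := (con 1ℚ :- t) :* p) refl t (P (A ⊝ x)) ⟩
    u * P (A ⊝ x)                          ∎
    where
    open ≡-Reasoning
    eq : A ⊝N x ⊝ x ≐ A ⊝ x
    eq = ≐-by (λ w e → let e₁ , x≢w = ⊝⁻ e in ⊝⁺ (proj₁ (⊝N⁻ e₁)) x≢w)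
              (λ w e → let Aw , x≢w = ⊝⁻ e in ⊝⁺ (⊝N⁺ Aw (iso w Aw)) x≢w)

  -- Deleting `s` isolates `l`, whence the factor `u`; the other term removes the closed
  -- neighbourhood of `s`, which contains `l`.
  P-pendant : ∀ {A s l} → A s ≡ true → A l ≡ true → s ~ l → (∀ w → A w ≡ true → l ~ w → w ≡ s) →
    P A ≡ u * P (A ⊝ s ⊝ l) - t * P (A ⊝ s ⊝ l ⊝N s)
  P-pendant {A} {s} {l} As Al s~l leaf = trans (P-delete s As) (cong₂ (λ p q → p - t * q)
    (P-isolated l (⊝⁺ Al λ { refl → ~-irrefl refl s~l }) λ w e l~w →
      let Aw , s≢w = ⊝⁻ e in s≢w (sym (leaf w Aw l~w)))
    (P-cong (≐-by
      (λ w e → let e₁ , s≢w = ⊝⁻ e ; Aw , s≁w = ⊝N⁻ e₁ in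
        ⊝N⁺ (⊝⁺ (⊝⁺ Aw s≢w) λ { refl → s≁w s~l }) s≁w)
      (λ w e → let e₁ , s≁w = ⊝N⁻ e ; e₂ , _ = ⊝⁻ e₁ ; Aw , s≢w = ⊝⁻ e₂ in
        ⊝⁺ (⊝N⁺ Aw s≁w) s≢w))))

  P-K₂ : ∀ {A a b} → A a ≡ true → A b ≡ true → a ~ b →
    (∀ w → A w ≡ true → a ~ w → w ≡ b) → (∀ w → A w ≡ true → b ~ w → w ≡ a) →
    P A ≡ v * P (A ⊝ a ⊝ b)
  P-K₂ {A} {a} {b} Aa Ab a~b only-b only-a = begin
    P A                                          ≡⟨ P-pendant Aa Ab a~b only-a ⟩
    u * P (A ⊝ a ⊝ b) - t * P (A ⊝ a ⊝ b ⊝N a)   ≡⟨ cong (λ p → u * P (A ⊝ a ⊝ b) - t * p) (P-cong eq) ⟩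
    u * P (A ⊝ a ⊝ b) - t * P (A ⊝ a ⊝ b)        ≡⟨ solve 3 (λ t u p → u :* p :- t :* p := (u :- t) :* p) refl t u (P (A ⊝ a ⊝ b)) ⟩
    v * P (A ⊝ a ⊝ b)                            ∎
    where
    open ≡-Reasoning
    eq : A ⊝ a ⊝ b ⊝N a ≐ A ⊝ a ⊝ b
    eq = ≐-by (λ w e → proj₁ (⊝N⁻ e)) λ w e → ⊝N⁺ e λ a~w →
      let e₁ , b≢w = ⊝⁻ e ; Aw , _ = ⊝⁻ e₁ in b≢w (sym (only-b w Aw a~w))

⊝-other : ∀ {n} {A : VSet n} {v w} → v ≢ w → (A ⊝ v) w ≡ A w
⊝-other v≢w = bool-ext (λ e → proj₁ (⊝⁻ e)) (λ e → ⊝⁺ e v≢w)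

⊝-absent : ∀ {n} {A : VSet n} {v} → A v ≡ false → A ⊝ v ≐ A
⊝-absent {A = A} {v} Av = ≐-by (⊝-⊑ A v) λ w e → ⊝⁺ e λ { refl → true≢false e Av }

⊑-trans : ∀ {n} {A B C : VSet n} → A ⊑ B → B ⊑ C → A ⊑ C
⊑-trans A⊑B B⊑C w = B⊑C w ∘ A⊑B w

-- Estimates for `0 ≤ t < ½`

module Bounds {n : ℕ} (G : Graph n) (t : ℚ) (0≤t : 0ℚ ≤ t) (0<v : 0ℚ < 1ℚ - t - t) where
  open Graph G
  open Polynomial G t public
  open +-*-Solver using (solve; _:+_; _:*_; _:-_; _:=_; con)

  0≤v : 0ℚ ≤ v
  0≤v = ℚ.<⇒≤ 0<v

  v≤u : v ≤ u
  v≤u = ≤-by t 0≤t (solve 1 (λ t → con 1ℚ :- t := (con 1ℚ :- t :- t) :+ t) refl t)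

  0<u : 0ℚ < u
  0<u = ℚ.<-≤-trans 0<v v≤u

  0≤u : 0ℚ ≤ u
  0≤u = ℚ.<⇒≤ 0<u

  v≤u² : v ≤ u * u
  v≤u² = ≤-by (t * t) (0≤* 0≤t 0≤t) (solve 1 (λ t →
    (con 1ℚ :- t) :* (con 1ℚ :- t) := (con 1ℚ :- t :- t) :+ t :* t) refl t)

  -- Guarantees that the lower bounds for forests with m pairs are non-negative.
  Admissible : ℕ → Set
  Admissible m = t * u ^ m ≤ u * v ^ m

  -- Admissibility says `(v / u)^m ≥ t / u`, and `v / u ≤ 1`, so it weakens as `m` decreases.
  admissible-pred : ∀ m → Admissible (suc m) → Admissible m
  admissible-pred m adm = *-cancelˡ 0<u (begin
    u * (t * u ^ m)  ≡⟨ solve 3 (λ t u a → u :* (t :* a) := t :* (u :* a)) refl t u (u ^ m) ⟩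
    t * u ^ suc m    ≤⟨ adm ⟩
    u * (v * v ^ m)  ≤⟨ *-monoˡ 0≤u (ℚ.*-monoʳ-≤-nonNeg (v ^ m) {{ℚ.nonNegative (0≤^ m 0≤v)}} v≤u) ⟩
    u * (u * v ^ m)  ∎)
    where open ℚ.≤-Reasoning

  -- The vertices of `C` outside `D` are deleted one at a time. Each deletion raises the value by
  -- `t` times the value on a smaller subset of `C`, which is non-negative by hypothesis.
  P-antitone : ∀ {C D} → (∀ B → B ⊑ C → 0ℚ ≤ P B) → D ⊑ C → P C ≤ P D
  P-antitone {C} {D} pos D⊑C = go (allFin n) pos D⊑C λ w _ _ → ∈-allFin w
    where
    go : ∀ xs {C} → (∀ B → B ⊑ C → 0ℚ ≤ P B) → D ⊑ C →
      (∀ w → C w ≡ true → D w ≡ false → w ∈ xs) → P C ≤ P D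
    go [] {C} pos D⊑C rest = ℚ.≤-reflexive (P-cong (≐-by C⊑D D⊑C))
      where
      C⊑D : C ⊑ D
      C⊑D w Cw with true⊎false (D w)
      ... | inj₁ Dw = Dw
      ... | inj₂ Dw with () ← rest w Cw Dw
    go (x ∷ xs) {C} pos D⊑C rest with true⊎false (D x) | true⊎false (C x)
    ... | inj₁ Dx | _       = go xs pos D⊑C λ w Cw Dw → Any.tail (λ { refl → true≢false Dx Dw }) (rest w Cw Dw)
    ... | inj₂ Dx | inj₂ Cx = go xs pos D⊑C λ w Cw Dw → Any.tail (λ { refl → true≢false Cw Cx }) (rest w Cw Dw)
    ... | inj₂ Dx | inj₁ Cx = ℚ.≤-trans
      (≤-by (t * P (C ⊝N x ⊝ x)) (0≤* 0≤t (pos _ λ w e → proj₁ (⊝N⁻ (⊝-⊑ _ x w e))))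
        (trans (solve 2 (λ p q → p := (p :- q) :+ q) refl (P (C ⊝ x)) (t * P (C ⊝N x ⊝ x)))
          (cong (_+ t * P (C ⊝N x ⊝ x)) (sym (P-delete x Cx)))))
      (go xs (λ B B⊑ → pos B (⊑-trans B⊑ (⊝-⊑ C x)))
        (λ w Dw → ⊝⁺ (D⊑C w Dw) λ { refl → true≢false Dw Dx })
        λ w e Dw → let Cw , x≢w = ⊝⁻ e in Any.tail (λ w≡x → x≢w (sym w≡x)) (rest w Cw Dw))

-- Forests with a perfect matching

Pairs : ℕ → Set
Pairs n = List (Fin n × Fin n)

support : ∀ {n} → Pairs n → VSet n
support []            = ∅
support ((s , l) ∷ F) = support F ⊕ s ⊕ l

module _ {n : ℕ} (G : Graph n) where
  open Graph G

  -- Each new `l` is a leaf on arrival, and each new `s` has at most one earlier neighbour. An `s`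
  -- without earlier neighbours starts a new component: this happens when the hub of the cycle is
  -- deleted and the paths attached there come loose.
  data PairForest : Pairs n → Set where
    []   : PairForest []
    cons : ∀ {F s l} → PairForest F →
      support F s ≡ false → support F l ≡ false → s ~ l →
      (∀ w → support F w ≡ true → ¬ l ~ w) →
      (∀ w w′ → support F w ≡ true → support F w′ ≡ true → s ~ w → s ~ w′ → w ≡ w′) →
      PairForest ((s , l) ∷ F)

module ForestBounds {n : ℕ} (G : Graph n) (t : ℚ) (0≤t : 0ℚ ≤ t) (0<v : 0ℚ < 1ℚ - t - t) where
  open Graph G
  open Bounds G t 0≤t 0<v public
  open +-*-Solver using (solve; _:+_; _:*_; _:-_; _:=_; con)

  -- `x-weight` is the polynomial of what is left of a single pair: K₂, K₁ or nothing. So `X` is the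
  -- value for the graph in which only the edges inside pairs remain. `Y` is the correction that the
  -- lower bound needs. Its weight is `u` for a full pair, because that step multiplies the earlier
  -- lower bound by `u`, and 1 when only `s` is left, where the earlier bound is kept as it is. With
  -- only `l` left the factor is again `u`, rounded up to 1.
  x-weight y-weight : Bool → Bool → ℚ
  x-weight true  true  = v
  x-weight true  false = u
  x-weight false true  = u
  x-weight false false = 1ℚ
  y-weight true  true  = u
  y-weight true  false = 1ℚ
  y-weight false b     = 1ℚ

  -- Chosen so that P B ≤ X F B and u X F B ≤ v P B + t Y F B.
  X Y : Pairs n → VSet n → ℚ
  X []            B = 1ℚ
  X ((s , l) ∷ F) B = x-weight (B s) (B l) * X F B
  Y []            B = 1ℚ
  Y ((s , l) ∷ F) B = y-weight (B s) (B l) * Y F B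

  0≤x-weight : ∀ a b → 0ℚ ≤ x-weight a b
  0≤x-weight true  true  = 0≤v
  0≤x-weight true  false = 0≤u
  0≤x-weight false true  = 0≤u
  0≤x-weight false false = 0≤1

  0≤y-weight : ∀ a b → 0ℚ ≤ y-weight a b
  0≤y-weight true  true  = 0≤u
  0≤y-weight true  false = 0≤1
  0≤y-weight false b     = 0≤1

  0≤X : ∀ F B → 0ℚ ≤ X F B
  0≤X []            B = 0≤1
  0≤X ((s , l) ∷ F) B = 0≤* (0≤x-weight (B s) (B l)) (0≤X F B)

  0≤Y : ∀ F B → 0ℚ ≤ Y F B
  0≤Y []            B = 0≤1
  0≤Y ((s , l) ∷ F) B = 0≤* (0≤y-weight (B s) (B l)) (0≤Y F B)

  private
    tail⊑ : ∀ {F : Pairs n} {s l} {B B′ : VSet n} →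
      (∀ w → support ((s , l) ∷ F) w ≡ true → B w ≡ B′ w) → ∀ w → support F w ≡ true → B w ≡ B′ w
    tail⊑ eq w e = eq w (⊕⁺ˡ (⊕⁺ˡ e))

  X-cong : ∀ F {B B′} → (∀ w → support F w ≡ true → B w ≡ B′ w) → X F B ≡ X F B′
  X-cong []            eq = refl
  X-cong ((s , l) ∷ F) {B′ = B′} eq rewrite eq s (⊕⁺ˡ (⊕⁺ʳ refl)) | eq l (⊕⁺ʳ refl) =
    cong (x-weight (B′ s) (B′ l) *_) (X-cong F (tail⊑ {F} eq))

  Y-cong : ∀ F {B B′} → (∀ w → support F w ≡ true → B w ≡ B′ w) → Y F B ≡ Y F B′
  Y-cong []            eq = refl
  Y-cong ((s , l) ∷ F) {B′ = B′} eq rewrite eq s (⊕⁺ˡ (⊕⁺ʳ refl)) | eq l (⊕⁺ʳ refl) =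
    cong (y-weight (B′ s) (B′ l) *_) (Y-cong F (tail⊑ {F} eq))

  X-support : ∀ F {B} → support F ⊑ B → X F B ≡ v ^ length F
  X-support []            F⊑B = refl
  X-support ((s , l) ∷ F) F⊑B rewrite F⊑B s (⊕⁺ˡ (⊕⁺ʳ refl)) | F⊑B l (⊕⁺ʳ refl) =
    cong (v *_) (X-support F λ w e → F⊑B w (⊕⁺ˡ (⊕⁺ˡ e)))

  private
    mul₃ : ∀ a b c d {p q} → 0ℚ ≤ p → 0ℚ ≤ b * c → a * d ≤ b * c → p ≤ q → a * (d * p) ≤ b * (c * q)
    mul₃ a b c d {p} {q} 0≤p 0≤bc ad≤bc p≤q = begin
      a * (d * p) ≡⟨ ℚ.*-assoc a d p ⟨
      a * d * p   ≤⟨ ℚ.*-monoʳ-≤-nonNeg p {{ℚ.nonNegative 0≤p}} ad≤bc ⟩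
      b * c * p   ≤⟨ *-monoˡ 0≤bc p≤q ⟩
      b * c * q   ≡⟨ ℚ.*-assoc b c q ⟩
      b * (c * q) ∎
      where open ℚ.≤-Reasoning

    weight-dropˡ : ∀ a b → v * x-weight false b ≤ u * x-weight a b
    weight-dropˡ true  true  = ℚ.≤-reflexive (ℚ.*-comm v u)
    weight-dropˡ true  false = subst (_≤ u * u) (sym (ℚ.*-identityʳ v)) v≤u²
    weight-dropˡ false b     = ℚ.*-monoʳ-≤-nonNeg (x-weight false b)
      {{ℚ.nonNegative (0≤x-weight false b)}} v≤u

    x-weight-comm : ∀ a b → x-weight a b ≡ x-weight b a
    x-weight-comm true  true  = refl
    x-weight-comm true  false = refl
    x-weight-comm false true  = refl
    x-weight-comm false false = refl

    weight-dropʳ : ∀ a b → v * x-weight a false ≤ u * x-weight a b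
    weight-dropʳ a b rewrite x-weight-comm a false | x-weight-comm a b = weight-dropˡ b a

    0≤u*weight : ∀ a b → 0ℚ ≤ u * x-weight a b
    0≤u*weight a b = 0≤* 0≤u (0≤x-weight a b)

    scale : ∀ a b c {p q} → 0ℚ ≤ c → 0ℚ ≤ a → a * p ≤ b * q → a * (c * p) ≤ b * (c * q)
    scale a b c {p} {q} 0≤c 0≤a ap≤bq = begin
      a * (c * p) ≡⟨ solve 3 (λ a c p → a :* (c :* p) := c :* (a :* p)) refl a c p ⟩
      c * (a * p) ≤⟨ *-monoˡ 0≤c ap≤bq ⟩
      c * (b * q) ≡⟨ solve 3 (λ b c q → c :* (b :* q) := b :* (c :* q)) refl b c q ⟩
      b * (c * q) ∎
      where open ℚ.≤-Reasoning

  -- Pairs are disjoint, so deleting `w` alters at most one factor of the product, and by a ratio of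
  -- at most `u / v`.
  X-remove : ∀ {F} → PairForest G F → ∀ B w → v * X F (B ⊝ w) ≤ u * X F B
  X-remove [] B w = *-mono 0≤v 0≤1 v≤u ℚ.≤-refl
  X-remove {(s , l) ∷ F} (cons pf Fs Fl s~l _ _) B w with w Fin.≟ s | w Fin.≟ l
  ... | yes refl | _
    rewrite ⊝-self B s | ⊝-other {A = B} {s} {l} (λ { refl → ~-irrefl refl s~l }) =
      mul₃ v u (x-weight (B s) (B l)) (x-weight false (B l))
        (0≤X F _) (0≤u*weight (B s) (B l)) (weight-dropˡ (B s) (B l)) (ℚ.≤-reflexive
        (X-cong F λ x e → ⊝-other {A = B} λ { refl → true≢false e Fs }))
  ... | no w≢s | yes refl
    rewrite ⊝-self B l | ⊝-other {A = B} {l} {s} w≢s =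
      mul₃ v u (x-weight (B s) (B l)) (x-weight (B s) false)
        (0≤X F _) (0≤u*weight (B s) (B l)) (weight-dropʳ (B s) (B l)) (ℚ.≤-reflexive
        (X-cong F λ x e → ⊝-other {A = B} λ { refl → true≢false e Fl }))
  ... | no w≢s | no w≢l
    rewrite ⊝-other {A = B} {w} {s} w≢s | ⊝-other {A = B} {w} {l} w≢l =
      scale v u (x-weight (B s) (B l)) (0≤x-weight (B s) (B l)) 0≤v (X-remove pf B w)

  Y≤X : ∀ F B → v ^ length F * Y F B ≤ u ^ length F * X F B
  Y≤X []            B = ℚ.≤-refl
  Y≤X ((s , l) ∷ F) B = begin
    v * v ^ m * (y-weight (B s) (B l) * Y F B)
      ≡⟨ swap v (v ^ m) (y-weight (B s) (B l)) (Y F B) ⟩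
    v * y-weight (B s) (B l) * (v ^ m * Y F B)
      ≤⟨ *-mono (0≤* 0≤v (0≤y-weight (B s) (B l))) (0≤* (0≤^ m 0≤u) (0≤X F B))
           (weights (B s) (B l)) (Y≤X F B) ⟩
    u * x-weight (B s) (B l) * (u ^ m * X F B)
      ≡⟨ swap u (u ^ m) (x-weight (B s) (B l)) (X F B) ⟨
    u * u ^ m * (x-weight (B s) (B l) * X F B) ∎
    where
    open ℚ.≤-Reasoning
    m = length F
    swap : ∀ a b c d → a * b * (c * d) ≡ a * c * (b * d)
    swap = solve 4 (λ a b c d → a :* b :* (c :* d) := a :* c :* (b :* d)) refl
    weights : ∀ a b → v * y-weight a b ≤ u * x-weight a b
    weights true  true  = ℚ.≤-reflexive (ℚ.*-comm v u)
    weights true  false = subst (_≤ u * u) (sym (ℚ.*-identityʳ v)) v≤u²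
    weights false true  = subst (_≤ u * u) (sym (ℚ.*-identityʳ v)) v≤u²
    weights false false = ℚ.*-monoʳ-≤-nonNeg 1ℚ v≤u

  -- Comparing `Y` with `X` pair by pair loses `u / v` for every pair; admissibility pays for the
  -- total loss `(u / v)^m`.
  tY≤uX : ∀ F B → Admissible (length F) → t * Y F B ≤ u * X F B
  tY≤uX F B adm = *-cancelˡ (0<^ m 0<u) (begin
    u ^ m * (t * Y F B)   ≡⟨ solve 3 (λ a t y → a :* (t :* y) := (t :* a) :* y) refl (u ^ m) t (Y F B) ⟩
    t * u ^ m * Y F B     ≤⟨ ℚ.*-monoʳ-≤-nonNeg (Y F B) {{ℚ.nonNegative (0≤Y F B)}} adm ⟩
    u * v ^ m * Y F B     ≡⟨ ℚ.*-assoc u (v ^ m) (Y F B) ⟩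
    u * (v ^ m * Y F B)   ≤⟨ *-monoˡ 0≤u (Y≤X F B) ⟩
    u * (u ^ m * X F B)   ≡⟨ solve 3 (λ u a x → u :* (a :* x) := a :* (u :* x)) refl u (u ^ m) (X F B) ⟩
    u ^ m * (u * X F B)   ∎)
    where
    open ℚ.≤-Reasoning
    m = length F

  record Bounded (F : Pairs n) (B : VSet n) : Set where
    field
      lower : u * X F B ≤ v * P B + t * Y F B
      upper : P B ≤ X F B

    nonNeg : Admissible (length F) → 0ℚ ≤ P B
    nonNeg adm = *-cancelˡ 0<v (subst (_≤ v * P B) (sym (ℚ.*-zeroʳ v)) 0≤vP)
      where
      0≤vP : 0ℚ ≤ v * P B
      0≤vP = subst (0ℚ ≤_)
        (solve 3 (λ a b c → (a :+ b :- c) :+ (c :- b) := a) refl (v * P B) (t * Y F B) (u * X F B))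
        (0≤+ (0≤-- lower) (0≤-- (tY≤uX F B adm)))

  open Bounded

  private
    -- Deleting a pair (s, l): X′, Y′, p, c stand for X F B′, Y F B′, P B′ and P (B′ ⊝N s).
    module Step {X′ Y′ p c : ℚ} (0≤Y′ : 0ℚ ≤ Y′) (low : u * X′ ≤ v * p + t * Y′) (up : p ≤ X′)
                (p≤c : p ≤ c) (vc≤uX : v * c ≤ u * X′) where
      -- The suffixes tell which of `s` and `l` lie in `B`. Each proof writes the difference of the
      -- two sides as a combination, with non-negative coefficients, of the slacks in the hypotheses
      -- and of `Y′`.
      low-l : u * (u * X′) ≤ v * (u * p) + t * (1ℚ * Y′)
      low-l = ≤-by (u * (v * p + t * Y′ - u * X′) + t * (t * Y′))
        (0≤+ (0≤* 0≤u (0≤-- low)) (0≤* 0≤t (0≤* 0≤t 0≤Y′)))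
        (solve 4 (λ t x y p → let u = con 1ℚ :- t; v = u :- t in
          v :* (u :* p) :+ t :* (con 1ℚ :* y) :=
          u :* (u :* x) :+ (u :* (v :* p :+ t :* y :- u :* x) :+ t :* (t :* y))) refl t X′ Y′ p)

      low-s : u * (u * X′) ≤ v * (p - t * c) + t * (1ℚ * Y′)
      low-s = ≤-by ((v * p + t * Y′ - u * X′) + t * (u * X′ - v * c))
        (0≤+ (0≤-- low) (0≤* 0≤t (0≤-- vc≤uX)))
        (solve 5 (λ t x y p c → let u = con 1ℚ :- t; v = u :- t in
          v :* (p :- t :* c) :+ t :* (con 1ℚ :* y) :=
          u :* (u :* x) :+ ((v :* p :+ t :* y :- u :* x) :+ t :* (u :* x :- v :* c))) refl t X′ Y′ p c)

      low-sl : u * (v * X′) ≤ v * (u * p - t * c) + t * (u * Y′)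
      low-sl = ≤-by (u * (v * p + t * Y′ - u * X′) + t * (u * X′ - v * c))
        (0≤+ (0≤* 0≤u (0≤-- low)) (0≤* 0≤t (0≤-- vc≤uX)))
        (solve 5 (λ t x y p c → let u = con 1ℚ :- t; v = u :- t in
          v :* (u :* p :- t :* c) :+ t :* (u :* y) :=
          u :* (v :* x) :+ (u :* (v :* p :+ t :* y :- u :* x) :+ t :* (u :* x :- v :* c))) refl t X′ Y′ p c)

      up-s : p - t * c ≤ u * X′
      up-s = ≤-by (u * (X′ - p) + t * (c - p))
        (0≤+ (0≤* 0≤u (0≤-- up)) (0≤* 0≤t (0≤-- p≤c)))
        (solve 4 (λ t x p c → let u = con 1ℚ :- t in
          u :* x := (p :- t :* c) :+ (u :* (x :- p) :+ t :* (c :- p))) refl t X′ p c)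

      up-sl : u * p - t * c ≤ v * X′
      up-sl = ≤-by (v * (X′ - p) + t * (c - p))
        (0≤+ (0≤* 0≤v (0≤-- up)) (0≤* 0≤t (0≤-- p≤c)))
        (solve 4 (λ t x p c → let u = con 1ℚ :- t; v = u :- t in
          v :* x := (u :* p :- t :* c) :+ (v :* (x :- p) :+ t :* (c :- p))) refl t X′ p c)

  private
    empty-bounded : ∀ B → B ⊑ ∅ → Bounded [] B
    empty-bounded B B⊑∅ = record
      { lower = ℚ.≤-reflexive (trans (solve 1 (λ t → let u = con 1ℚ :- t in
          u :* con 1ℚ := (u :- t) :* con 1ℚ :+ t :* con 1ℚ) refl t)
          (cong (λ p → v * p + t * 1ℚ) (sym P≡1)))
      ; upper = ℚ.≤-reflexive P≡1 }
      where
      P≡1 : P B ≡ 1ℚ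
      P≡1 = Q-empty (allFin n) λ w → ≢true⇒false λ e → true≢false (B⊑∅ w e) refl

    extend-bounded : ∀ {F s l} → PairForest G ((s , l) ∷ F) → Admissible (length F) →
      (∀ B → B ⊑ support F → Bounded F B) →
      ∀ B → B ⊑ support ((s , l) ∷ F) → Bounded ((s , l) ∷ F) B
    extend-bounded {F} {s} {l} (cons pf Fs Fl s~l l-leaf s-one) adm ih B B⊑ = result
      where
      B′ C : VSet n
      B′ = B ⊝ s ⊝ l
      C  = B′ ⊝N s

      B′⊑F : B′ ⊑ support F
      B′⊑F w e with ⊝⁻ e
      ... | e₁ , l≢w with ⊝⁻ e₁
      ... | Bw , s≢w with ⊕⁻ (B⊑ w Bw)
      ... | inj₂ l≡w = ⊥-elim (l≢w l≡w)
      ... | inj₁ e₂ with ⊕⁻ e₂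
      ... | inj₂ s≡w = ⊥-elim (s≢w s≡w)
      ... | inj₁ Fw = Fw

      ih-B′ : Bounded F B′
      ih-B′ = ih B′ B′⊑F

      X≡ : X F B ≡ X F B′
      X≡ = X-cong F λ w Fw → sym (trans (⊝-other λ { refl → true≢false Fw Fl })
                                        (⊝-other λ { refl → true≢false Fw Fs }))

      Y≡ : Y F B ≡ Y F B′
      Y≡ = Y-cong F λ w Fw → sym (trans (⊝-other λ { refl → true≢false Fw Fl })
                                        (⊝-other λ { refl → true≢false Fw Fs }))

      -- Since `s` has at most one earlier neighbour `w`, the set `C` is `B′` or `B′ ⊝ w`. In the
      -- latter case the first bound needs non-negativity on a smaller subset and the second needs
      -- the upper bound on `B′ ⊝ w`; this is why all subsets and both bounds are treated together.
      C-bounds : P B′ ≤ P C × v * P C ≤ u * X F B′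
      C-bounds with Fin.any? (λ w → (B′ w 𝔹.≟ true) ×-dec (s ~? w))
      ... | yes (w , B′w , s~w) = subst (λ p → P B′ ≤ p × v * p ≤ u * X F B′) (P-cong eq)
          (  ≤-by (t * P (B′ ⊝N w ⊝ w))
               (0≤* 0≤t (nonNeg (ih _ λ x e → B′⊑F x (proj₁ (⊝N⁻ (⊝-⊑ _ w x e)))) adm))
               (trans (solve 2 (λ p q → p := (p :- q) :+ q) refl (P (B′ ⊝ w)) (t * P (B′ ⊝N w ⊝ w)))
                  (cong (_+ t * P (B′ ⊝N w ⊝ w)) (sym (P-delete w B′w))))
          , ℚ.≤-trans (*-monoˡ 0≤v (upper (ih (B′ ⊝ w) λ x e → B′⊑F x (⊝-⊑ B′ w x e))))
              (X-remove pf B′ w))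
        where
        eq : B′ ⊝ w ≐ C
        eq = ≐-by
          (λ x e → let B′x , w≢x = ⊝⁻ e in
            ⊝N⁺ B′x λ s~x → w≢x (s-one w x (B′⊑F w B′w) (B′⊑F x B′x) s~w s~x))
          (λ x e → let B′x , s≁x = ⊝N⁻ e in ⊝⁺ B′x λ { refl → s≁x s~w })
      ... | no none = subst (λ p → P B′ ≤ p × v * p ≤ u * X F B′) (P-cong eq)
          ( ℚ.≤-refl , *-mono 0≤v (0≤X F B′) v≤u (upper ih-B′) )
        where
        eq : B′ ≐ C
        eq = ≐-by (λ x B′x → ⊝N⁺ B′x λ s~x → none (x , B′x , s~x)) (λ x e → proj₁ (⊝N⁻ e))

      open Step (0≤Y F B′) (lower ih-B′) (upper ih-B′) (proj₁ C-bounds) (proj₂ C-bounds)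

      l≁B : ∀ w → B w ≡ true → l ~ w → w ≡ s
      l≁B w Bw l~w with ⊕⁻ (B⊑ w Bw)
      ... | inj₂ refl = ⊥-elim (~-irrefl refl l~w)
      ... | inj₁ e with ⊕⁻ e
      ... | inj₂ s≡w = sym s≡w
      ... | inj₁ Fw = ⊥-elim (l-leaf w Fw l~w)

      make : ∀ {ω η p} → x-weight (B s) (B l) ≡ ω → y-weight (B s) (B l) ≡ η → P B ≡ p →
        u * (ω * X F B′) ≤ v * p + t * (η * Y F B′) → p ≤ ω * X F B′ → Bounded ((s , l) ∷ F) B
      make refl refl refl low up = record
        { lower = subst (λ x → u * (x-weight (B s) (B l) * x) ≤ v * P B + t * (y-weight (B s) (B l) * Y F B)) (sym X≡)
            (subst (λ y → u * (x-weight (B s) (B l) * X F B′) ≤ v * P B + t * (y-weight (B s) (B l) * y)) (sym Y≡) low)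
        ; upper = subst (λ x → P B ≤ x-weight (B s) (B l) * x) (sym X≡) up }

      result : Bounded ((s , l) ∷ F) B
      result with true⊎false (B s) | true⊎false (B l)
      ... | inj₂ Bs | inj₂ Bl = make
        (cong₂ x-weight Bs Bl) (cong₂ y-weight Bs Bl)
        (P-cong λ w → sym (trans (⊝-absent (≢true⇒false λ e → true≢false (⊝-⊑ B s l e) Bl) w) (⊝-absent Bs w)))
        (subst₂ _≤_ (cong (u *_) (sym (ℚ.*-identityˡ _)))
          (cong (λ y → v * P B′ + t * y) (sym (ℚ.*-identityˡ _))) (lower ih-B′))
        (subst (P B′ ≤_) (sym (ℚ.*-identityˡ _)) (upper ih-B′))
      ... | inj₂ Bs | inj₁ Bl = make
        (cong₂ x-weight Bs Bl) (cong₂ y-weight Bs Bl)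
        (trans (P-isolated l Bl λ w Bw l~w → true≢false (subst (λ x → B x ≡ true) (l≁B w Bw l~w) Bw) Bs)
          (cong (u *_) (P-cong (≐-by
            (λ w e → let Bw , l≢w = ⊝⁻ e in ⊝⁺ (⊝⁺ Bw λ { refl → true≢false Bw Bs }) l≢w)
            (λ w e → let e₁ , l≢w = ⊝⁻ e in ⊝⁺ (⊝-⊑ B s w e₁) l≢w)))))
        low-l (*-monoˡ 0≤u (upper ih-B′))
      ... | inj₁ Bs | inj₂ Bl = make
        (cong₂ x-weight Bs Bl) (cong₂ y-weight Bs Bl)
        (trans (P-delete s Bs) (cong₂ (λ p q → p - t * q)
          (P-cong λ w → sym (⊝-absent (≢true⇒false λ e → true≢false (⊝-⊑ B s l e) Bl) w))
          (P-cong (≐-by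
            (λ w e → let e₁ , s≢w = ⊝⁻ e ; Bw , s≁w = ⊝N⁻ e₁ in
              ⊝N⁺ (⊝⁺ (⊝⁺ Bw s≢w) λ { refl → true≢false Bw Bl }) s≁w)
            (λ w e → let e₁ , s≁w = ⊝N⁻ e ; e₂ , _ = ⊝⁻ e₁ ; Bw , s≢w = ⊝⁻ e₂ in
              ⊝⁺ (⊝N⁺ Bw s≁w) s≢w)))))
        low-s up-s
      ... | inj₁ Bs | inj₁ Bl = make
        (cong₂ x-weight Bs Bl) (cong₂ y-weight Bs Bl)
        (P-pendant Bs Bl s~l l≁B) low-sl up-sl

  forest-bounded : ∀ {F} → PairForest G F → Admissible (length F) → ∀ B → B ⊑ support F → Bounded F B
  forest-bounded []                                   adm = empty-bounded
  forest-bounded {_ ∷ F} pf@(cons pf′ _ _ _ _ _) adm =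
    extend-bounded pf adm′ (forest-bounded pf′ adm′)
    where adm′ = admissible-pred (length F) adm

  -- One of the two neighbours of h survives the deletion of w, and deleting h then pays for itself.
  hub-bound : ∀ {F h z₁ z₂} {A : VSet n} → PairForest G F → Admissible (length F) →
    A ⊝ h ≐ support F → A h ≡ true →
    support F z₁ ≡ true → support F z₂ ≡ true → z₁ ≢ z₂ → h ~ z₁ → h ~ z₂ →
    ∀ w → A w ≡ true → P (A ⊝ w) ≤ v ^ length F
  hub-bound {F} {h} {z₁} {z₂} {A} pf adm A-h Ah Fz₁ Fz₂ z₁≢z₂ h~z₁ h~z₂ w Aw with h Fin.≟ w
  ... | yes refl = subst₂ _≤_ (sym (P-cong A-h)) (X-support F λ _ e → e)
                     (upper (forest-bounded pf adm (support F) λ _ e → e))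
  ... | no h≢w = pick (w Fin.≟ z₁)
    where
    C : VSet n
    C = A ⊝ w ⊝ h
    C⊑F : C ⊑ support F
    C⊑F x e = let e₁ , h≢x = ⊝⁻ e in trans (sym (A-h x)) (⊝⁺ (⊝-⊑ A w x e₁) h≢x)
    pos : ∀ B → B ⊑ C → 0ℚ ≤ P B
    pos B B⊑C = nonNeg (forest-bounded pf adm B (⊑-trans B⊑C C⊑F)) adm
    open ℚ.≤-Reasoning

    via : ∀ z → w ≢ z → support F z ≡ true → h ~ z → P (A ⊝ w) ≤ v ^ length F
    -- The factor `v / u` gained by keeping `h` cancels exactly the factor `u / v` that `X-remove`
    -- loses for `w`.
    via z w≢z Fz h~z = *-cancelˡ 0<u (begin
      u * P (A ⊝ w)        ≡⟨ cong (u *_) (P-delete h (⊝⁺ Ah (h≢w ∘ sym))) ⟩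
      u * (P C - t * P D)  ≤⟨ ≤-by (t * (u * P D - P C)) (0≤* 0≤t (0≤-- PC≤uPD))
                                (solve 3 (λ t c d → let u = con 1ℚ :- t in
                                  (u :- t) :* c := u :* (c :- t :* d) :+ t :* (u :* d :- c)) refl t (P C) (P D)) ⟩
      v * P C              ≤⟨ *-monoˡ 0≤v (upper (forest-bounded pf adm C C⊑F)) ⟩
      v * X F C            ≡⟨ cong (v *_) (X-cong F C≡F-w) ⟩
      v * X F (support F ⊝ w)  ≤⟨ X-remove pf (support F) w ⟩
      u * X F (support F)  ≡⟨ cong (u *_) (X-support F λ _ e → e) ⟩
      u * v ^ length F     ∎)
      where
      D : VSet n
      D = A ⊝ w ⊝N h ⊝ h
      Az×h≢z : A z ≡ true × h ≢ z
      Az×h≢z = ⊝⁻ (trans (A-h z) Fz)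
      Cz : C z ≡ true
      Cz = ⊝⁺ (⊝⁺ (proj₁ Az×h≢z) w≢z) (proj₂ Az×h≢z)
      pos′ : ∀ B → B ⊑ C ⊝ z → 0ℚ ≤ P B
      pos′ B B⊑ = pos B (⊑-trans B⊑ (⊝-⊑ C z))
      -- Both terms are compared with `C ⊝ z`: it contains `C ⊝N z ⊝ z`, and it contains `D` because
      -- `z` is a neighbour of `h`.
      PC≤uPD : P C ≤ u * P D
      PC≤uPD = begin
        P C                                  ≡⟨ P-delete z Cz ⟩
        P (C ⊝ z) - t * P (C ⊝N z ⊝ z)       ≤⟨ ℚ.+-monoʳ-≤ (P (C ⊝ z)) (ℚ.neg-antimono-≤ (*-monoˡ 0≤t
                                                  (P-antitone pos′ λ x e → let e₁ , z≢x = ⊝⁻ e in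
                                                    ⊝⁺ (proj₁ (⊝N⁻ e₁)) z≢x))) ⟩
        P (C ⊝ z) - t * P (C ⊝ z)            ≡⟨ solve 2 (λ t p → p :- t :* p := (con 1ℚ :- t) :* p) refl t (P (C ⊝ z)) ⟩
        u * P (C ⊝ z)                        ≤⟨ *-monoˡ 0≤u (P-antitone pos′ λ x e →
                                                  let e₁ , h≢x = ⊝⁻ e ; e₂ , h≁x = ⊝N⁻ e₁ in
                                                  ⊝⁺ (⊝⁺ e₂ h≢x) λ { refl → h≁x h~z }) ⟩
        u * P D                              ∎
      C≡F-w : ∀ x → support F x ≡ true → C x ≡ (support F ⊝ w) x
      C≡F-w x Fx = bool-ext
        (λ e → ⊝⁺ Fx (proj₂ (⊝⁻ (⊝-⊑ (A ⊝ w) h x e))))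
        (λ e → let Ax , h≢x = ⊝⁻ (trans (A-h x) Fx) in ⊝⁺ (⊝⁺ Ax (proj₂ (⊝⁻ e))) h≢x)
    pick : Dec (w ≡ z₁) → P (A ⊝ w) ≤ v ^ length F
    pick (yes refl) = via z₂ z₁≢z₂ Fz₂ h~z₂
    pick (no w≢z₁)  = via z₁ w≢z₁ Fz₁ h~z₁

-- Growing from an odd cycle

dbl : ℕ → ℕ
dbl zero    = zero
dbl (suc m) = suc (suc (dbl m))

extend : ∀ {n} → VSet n → Pairs n → VSet n
extend Z []             = Z
extend Z ((s , l) ∷ ps) = extend Z ps ⊕ s ⊕ l

extend-⊒ : ∀ {n} {Z : VSet n} ps → Z ⊑ extend Z ps
extend-⊒ []             w e = e
extend-⊒ ((s , l) ∷ ps) w e = ⊕⁺ˡ (⊕⁺ˡ (extend-⊒ ps w e))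

-- The vertices g i, …, g (i + j − 1).
segment : ∀ {n} → (ℕ → Fin n) → ℕ → ℕ → VSet n
segment g i zero    = ∅
segment g i (suc j) = segment g i j ⊕ g (i ℕ.+ j)

module _ {n : ℕ} {g : ℕ → Fin n} where
  segment⁻ : ∀ i j {w} → segment g i j w ≡ true → ∃[ k ] k ℕ.< j × g (i ℕ.+ k) ≡ w
  segment⁻ i (suc j) e with ⊕⁻ e
  ... | inj₁ e′ = let k , k<j , eq = segment⁻ i j e′ in k , ℕ.m<n⇒m<1+n k<j , eq
  ... | inj₂ eq = j , ℕ.n<1+n j , eq

  segment⁺ : ∀ i j {k} → k ℕ.< j → segment g i j (g (i ℕ.+ k)) ≡ true
  segment⁺ i (suc j) {k} k<1+j with k ℕ.≟ j
  ... | yes refl = ⊕⁺ʳ refl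
  ... | no k≢j   = ⊕⁺ˡ (segment⁺ i j (ℕ.≤∧≢⇒< (ℕ.≤-pred k<1+j) k≢j))

-- The vertices are indexed by natural numbers, with conditions only below `L`, so that arcs become
-- segments and need no modular arithmetic.
record ChordlessCycle {n : ℕ} (G : Graph n) (L : ℕ) : Set where
  open Graph G
  field
    g         : ℕ → Fin n
    inj       : ∀ {i j} → i ℕ.< L → j ℕ.< L → g i ≡ g j → i ≡ j
    adj       : ∀ {i} → suc i ℕ.< L → g i ~ g (suc i)
    closing   : ∀ {i} → suc i ≡ L → g i ~ g 0
    chordless : ∀ {i j} → i ℕ.< j → j ℕ.< L → g i ~ g j → j ≡ suc i ⊎ (i ≡ 0 × suc j ≡ L)

  cycle : VSet n
  cycle = segment g 0 L

data Growth {n : ℕ} (G : Graph n) (Z : VSet n) : Pairs n → Set where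
  []   : Growth G Z []
  grow : ∀ {ps s l p} → Growth G Z ps →
    extend Z ps s ≡ false → extend Z ps l ≡ false → Graph._~_ G s l →
    (∀ w → extend Z ps w ≡ true → ¬ Graph._~_ G l w) →
    extend Z ps p ≡ true → Graph._~_ G s p →
    (∀ w → extend Z ps w ≡ true → Graph._~_ G s w → w ≡ p) →
    Growth G Z ((s , l) ∷ ps)

module CycleBounds {n : ℕ} (G : Graph n) (t : ℚ) (0≤t : 0ℚ ≤ t) (0<v : 0ℚ < 1ℚ - t - t) where
  open Graph G
  open ForestBounds G t 0≤t 0<v public
  open +-*-Solver using (solve; _:+_; _:*_; _:-_; _:=_; con)

  f : ℕ → ℚ
  f k = v ^ suc k - t * u ^ k

  -- This is the recurrence for attaching a pendant path, with the subtracted polynomial at its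
  -- largest allowed value `v ^ suc k`.
  f-suc : ∀ k → f (suc k) ≡ u * f k - t * v ^ suc k
  f-suc k = solve 3 (λ t a b → let u = con 1ℚ :- t; v = u :- t in
    v :* (v :* a) :- t :* (u :* b) := u :* (v :* a :- t :* b) :- t :* (v :* a)) refl t (v ^ k) (u ^ k)

  -- The value at `- t` of the independence polynomial of the path with the given number of
  -- vertices.
  path : ℕ → ℚ
  path 0             = 1ℚ
  path 1             = u
  path (suc (suc j)) = path (suc j) - t * path j

  -- The right side, `c m` say, is the polynomial of the cycle of length 2m + 3. It satisfies
  -- `c (m + 1) ≥ u * c m - t * path (2m + 2)`, which is compared with `f-suc` through
  -- `path (2m + 2) ≤ v ^ (m + 1)`. For the triangle there is equality.
  cycle-lower : ∀ m → (∀ i → i ℕ.≤ m → 0ℚ ≤ path (dbl i) × path (dbl i) ≤ v ^ i) →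
    f m ≤ path (dbl (suc m)) - t * path (dbl m)
  cycle-lower 0 _ = ℚ.≤-reflexive (solve 1 (λ t → let u = con 1ℚ :- t; v = u :- t in
    v :* con 1ℚ :- t :* con 1ℚ := (u :- t :* con 1ℚ) :- t :* con 1ℚ) refl t)
  cycle-lower (suc m) bound = begin
    f (suc m)                          ≡⟨ f-suc m ⟩
    u * f m - t * v ^ suc m            ≤⟨ ℚ.+-mono-≤ (*-monoˡ 0≤u (cycle-lower m λ i i≤m → bound i (ℕ.m≤n⇒m≤1+n i≤m)))
                                            (ℚ.neg-antimono-≤ (*-monoˡ 0≤t (proj₂ (bound (suc m) ℕ.≤-refl)))) ⟩
    u * (path (dbl (suc m)) - t * path (dbl m)) - t * path (dbl (suc m))
                                       ≤⟨ step m (λ i i<m → proj₁ (bound i (ℕ.m≤n⇒m≤1+n (ℕ.<⇒≤ i<m)))) ⟩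
    path (dbl (suc (suc m))) - t * path (dbl (suc m)) ∎
    where
    open ℚ.≤-Reasoning
    step : ∀ m → (∀ i → i ℕ.< m → 0ℚ ≤ path (dbl i)) →
      u * (path (dbl (suc m)) - t * path (dbl m)) - t * path (dbl (suc m)) ≤
      path (dbl (suc (suc m))) - t * path (dbl (suc m))
    step 0 _ = ℚ.≤-reflexive (solve 1 (λ t → let
        u = con 1ℚ :- t; p₂ = u :- t :* con 1ℚ; p₃ = p₂ :- t :* u; p₄ = p₃ :- t :* p₂ in
      u :* (p₂ :- t :* con 1ℚ) :- t :* p₂ := p₄ :- t :* p₂) refl t)
    -- The excess is found in two stages: in terms of `p₂` and `p₃` it is
    -- `t * ((p₂ - p₃) - t * p₂)`, and then `p₂ - p₃` is `t` times `path (2m + 1)`, which exceeds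
    -- `p₂` by `t * p₀`.
    step (suc m) pos = ≤-by (t * t * (t * p₀)) (0≤* (0≤* 0≤t 0≤t) (0≤* 0≤t (pos m ℕ.≤-refl)))
      (trans (solve 3 (λ t p₂ p₃ → let p₄ = p₃ :- t :* p₂; p₆ = (p₄ :- t :* p₃) :- t :* p₄ in
          p₆ :- t :* p₄ := ((con 1ℚ :- t) :* (p₄ :- t :* p₂) :- t :* p₄) :+ t :* ((p₂ :- p₃) :- t :* p₂))
          refl t p₂ p₃)
        (cong (λ c → (u * (path (dbl (suc (suc m))) - t * p₂) - t * path (dbl (suc (suc m)))) + c)
          (solve 3 (λ t p₀ p₁ → let p₂ = p₁ :- t :* p₀; p₃ = p₂ :- t :* p₁ in
            t :* ((p₂ :- p₃) :- t :* p₂) := t :* t :* (t :* p₀)) refl t p₀ (path (suc (dbl m))))))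
      where
      p₀ p₂ p₃ : ℚ
      p₀ = path (dbl m)
      p₂ = path (dbl (suc m))
      p₃ = path (suc (dbl (suc m)))

  module _ {r : ℕ} (C : ChordlessCycle G (suc (dbl (suc r)))) where
    open ChordlessCycle C

    private
      d L : ℕ
      d = dbl (suc r)
      L = suc d

    chordless′ : ∀ {i j} → i ℕ.< L → j ℕ.< L → 0 ℕ.< i → 0 ℕ.< j → g i ~ g j → j ≡ suc i ⊎ i ≡ suc j
    chordless′ {i} {j} i<L j<L 0<i 0<j i~j with ℕ.<-cmp i j
    ... | tri< i<j _ _ with chordless i<j j<L i~j
    ...   | inj₁ eq = inj₁ eq
    ...   | inj₂ (refl , _) = ⊥-elim (ℕ.n≮0 0<i)
    chordless′ i<L j<L 0<i 0<j i~j | tri≈ _ refl _ = ⊥-elim (~-irrefl refl i~j)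
    chordless′ i<L j<L 0<i 0<j i~j | tri> _ _ j<i with chordless j<i i<L (~-sym i~j)
    ...   | inj₁ eq = inj₂ eq
    ...   | inj₂ (refl , _) = ⊥-elim (ℕ.n≮0 0<j)

    fresh : ∀ i j k → j ℕ.≤ k → i ℕ.+ k ℕ.< L → segment g i j (g (i ℕ.+ k)) ≡ false
    fresh i j k j≤k ik<L = ≢true⇒false λ e →
      let k′ , k′<j , eq = segment⁻ i j e
          k′<k = ℕ.<-≤-trans k′<j j≤k
      in ℕ.<⇒≢ k′<k (ℕ.+-cancelˡ-≡ i _ _ (inj (ℕ.<-trans (ℕ.+-monoʳ-< i k′<k) ik<L) ik<L eq))

    -- A segment that starts at index `suc i` avoids `g 0` and with it the closing edge, so it
    -- induces a path. Its last vertex is deleted at each step.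
    P-segment : ∀ i j → suc i ℕ.+ j ℕ.≤ L → P (segment g (suc i) j) ≡ path j
    P-segment i 0 _ = Q-empty (allFin n) λ _ → refl
    P-segment i 1 le = trans
      (P-isolated x (⊕⁺ʳ refl) λ w e x~w → only (⊕⁻ e) x~w)
      (trans (cong (u *_) (Q-empty (allFin n) λ w → ≢true⇒false λ e → none (⊝⁻ e))) (ℚ.*-identityʳ u))
      where
      x = g (suc i ℕ.+ 0)
      only : ∀ {w} → ∅ w ≡ true ⊎ x ≡ w → ¬ x ~ w
      only (inj₂ x≡w) = ~-irrefl x≡w
      none : ∀ {w} → segment g (suc i) 1 w ≡ true × x ≢ w → ⊥
      none (e , x≢w) with ⊕⁻ e
      ... | inj₂ x≡w = x≢w x≡w
    P-segment i (suc (suc j)) le = trans (P-delete x (⊕⁺ʳ refl)) (cong₂ (λ p q → p - t * q)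
      (trans (P-cong (⊕-⊝ (fresh (suc i) (suc j) (suc j) ℕ.≤-refl (ℕ.<-≤-trans (ℕ.+-monoʳ-< (suc i) (ℕ.n<1+n (suc j))) le))))
        (P-segment i (suc j) (ℕ.≤-trans (ℕ.+-monoʳ-≤ (suc i) (ℕ.n≤1+n (suc j))) le)))
      (trans (P-cong (≐-by to from))
        (P-segment i j (ℕ.≤-trans (ℕ.+-monoʳ-≤ (suc i) (ℕ.≤-trans (ℕ.n≤1+n j) (ℕ.n≤1+n (suc j)))) le))))
      where
      x y : Fin n
      x = g (suc i ℕ.+ suc j)
      y = g (suc i ℕ.+ j)
      x<L : suc i ℕ.+ suc j ℕ.< L
      x<L = ℕ.<-≤-trans (ℕ.+-monoʳ-< (suc i) (ℕ.n<1+n (suc j))) le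
      y<L : suc i ℕ.+ j ℕ.< L
      y<L = ℕ.<-trans (ℕ.+-monoʳ-< (suc i) (ℕ.n<1+n j)) x<L
      y~x : y ~ x
      y~x = subst (λ k → y ~ g k) (sym (ℕ.+-suc (suc i) j)) (adj (subst (ℕ._< L) (ℕ.+-suc (suc i) j) x<L))
      to : segment g (suc i) (suc (suc j)) ⊝N x ⊝ x ⊑ segment g (suc i) j
      to w e with ⊝⁻ e
      ... | e₁ , x≢w with ⊝N⁻ e₁
      ... | e₂ , x≁w with ⊕⁻ e₂
      ... | inj₂ x≡w = ⊥-elim (x≢w x≡w)
      ... | inj₁ e₃ with ⊕⁻ e₃
      ... | inj₂ refl = ⊥-elim (x≁w (~-sym y~x))
      ... | inj₁ e₄ = e₄
      from : segment g (suc i) j ⊑ segment g (suc i) (suc (suc j)) ⊝N x ⊝ x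
      from w e = ⊝⁺ (⊝N⁺ (⊕⁺ˡ (⊕⁺ˡ e)) x≁w)
        λ { refl → true≢false e (fresh (suc i) j (suc j) (ℕ.n≤1+n j) x<L) }
        where
        x≁w : ¬ x ~ w
        x≁w x~w with segment⁻ (suc i) j e
        ... | k , k<j , refl with chordless′ x<L (ℕ.<-trans (ℕ.+-monoʳ-< (suc i) k<j) y<L) ℕ.z<s ℕ.z<s x~w
        ...   | inj₁ eq = ℕ.<⇒≢ (ℕ.m<n⇒m<1+n (ℕ.m<n⇒m<1+n k<j))
                  (ℕ.+-cancelˡ-≡ (suc i) _ _ (trans eq (sym (ℕ.+-suc (suc i) (suc j)))))
        ...   | inj₂ eq = ℕ.<⇒≢ k<j (ℕ.suc-injective (sym (ℕ.+-cancelˡ-≡ (suc i) _ _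
                  (trans eq (sym (ℕ.+-suc (suc i) k))))))

    path-pairs : ℕ → Pairs n
    path-pairs zero    = []
    path-pairs (suc m) = (g (suc (dbl m)) , g (suc (suc (dbl m)))) ∷ path-pairs m

    support-path-pairs : ∀ m → support (path-pairs m) ≡ segment g 1 (dbl m)
    support-path-pairs zero    = refl
    support-path-pairs (suc m) = cong (λ A → A ⊕ _ ⊕ _) (support-path-pairs m)

    length-path-pairs : ∀ m → length (path-pairs m) ≡ m
    length-path-pairs zero    = refl
    length-path-pairs (suc m) = cong suc (length-path-pairs m)

    path-forest : ∀ m → dbl m ℕ.< L → PairForest G (path-pairs m)
    path-forest zero    _  = []
    path-forest (suc m) lt = cons (path-forest m (ℕ.<-trans (ℕ.n<1+n _) 1+e<L))
      (trans (cong (λ A → A _) (support-path-pairs m)) (fresh 1 e e ℕ.≤-refl 1+e<L))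
      (trans (cong (λ A → A _) (support-path-pairs m)) (fresh 1 e (suc e) (ℕ.n≤1+n e) lt))
      (adj lt)
      (λ w Fw l~w → leaf w (segment⁻ 1 e (subst (λ A → A w ≡ true) (support-path-pairs m) Fw)) l~w)
      λ w w′ Fw Fw′ s~w s~w′ → one w w′
        (segment⁻ 1 e (subst (λ A → A w ≡ true) (support-path-pairs m) Fw))
        (segment⁻ 1 e (subst (λ A → A w′ ≡ true) (support-path-pairs m) Fw′)) s~w s~w′
      where
      e = dbl m
      1+e<L : suc e ℕ.< L
      1+e<L = ℕ.<-trans (ℕ.n<1+n _) lt
      leaf : ∀ w → (∃[ k ] k ℕ.< e × g (suc k) ≡ w) → ¬ g (suc (suc e)) ~ w
      leaf _ (k , k<e , refl) l~w with chordless′ lt (ℕ.<-trans (ℕ.s<s k<e) 1+e<L) ℕ.z<s ℕ.z<s l~w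
      ... | inj₁ eq = ℕ.<⇒≢ (ℕ.<-trans k<e (ℕ.m<n⇒m<1+n (ℕ.n<1+n e))) (ℕ.suc-injective eq)
      ... | inj₂ eq = ℕ.<⇒≢ k<e (sym (ℕ.suc-injective (ℕ.suc-injective eq)))
      pred : ∀ {k} → k ℕ.< e → g (suc e) ~ g (suc k) → e ≡ suc k
      pred {k} k<e s~w with chordless′ 1+e<L (ℕ.<-trans (ℕ.s<s k<e) 1+e<L) ℕ.z<s ℕ.z<s s~w
      ... | inj₁ eq = ⊥-elim (ℕ.<⇒≢ (ℕ.m<n⇒m<1+n k<e) (ℕ.suc-injective eq))
      ... | inj₂ eq = ℕ.suc-injective eq
      one : ∀ w w′ → (∃[ k ] k ℕ.< e × g (suc k) ≡ w) → (∃[ k ] k ℕ.< e × g (suc k) ≡ w′) →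
        g (suc e) ~ w → g (suc e) ~ w′ → w ≡ w′
      one _ _ (k , k<e , refl) (k′ , k′<e , refl) s~w s~w′ =
        cong g (trans (sym (pred k<e s~w)) (pred k′<e s~w′))

    -- An even arc that avoids `g 0` is a forest whose pairs are its alternate edges, so the forest
    -- bounds apply with `X` equal to `v ^ i`.
    path-bounds : Admissible (suc r) → ∀ i → i ℕ.≤ suc r → 0ℚ ≤ path (dbl i) × path (dbl i) ≤ v ^ i
    path-bounds adm i i≤r = subst (0ℚ ≤_) P≡path (nonNeg bounds (subst Admissible (sym (length-path-pairs i)) adm-i))
      , subst₂ _≤_ P≡path (trans (X-support (path-pairs i) λ _ e → e) (cong (v ^_) (length-path-pairs i))) (upper bounds)
      where
      open Bounded
      adm-≤ : ∀ {m k} → m ℕ.≤′ k → Admissible k → Admissible m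
      adm-≤ (ℕ.≤′-reflexive refl) a = a
      adm-≤ {k = suc k} (ℕ.≤′-step m≤k) a = adm-≤ m≤k (admissible-pred k a)
      adm-i : Admissible i
      adm-i = adm-≤ (ℕ.≤⇒≤′ i≤r) adm
      dbl-mono : ∀ {a b} → a ℕ.≤ b → dbl a ℕ.≤ dbl b
      dbl-mono ℕ.z≤n     = ℕ.z≤n
      dbl-mono (ℕ.s≤s l) = ℕ.s≤s (ℕ.s≤s (dbl-mono l))
      bounds : Bounded (path-pairs i) (support (path-pairs i))
      bounds = forest-bounded (path-forest i (ℕ.s≤s (dbl-mono i≤r)))
        (subst Admissible (sym (length-path-pairs i)) adm-i) _ λ _ e → e
      P≡path : P (support (path-pairs i)) ≡ path (dbl i)
      P≡path = trans (cong P (support-path-pairs i)) (P-segment 0 (dbl i) (ℕ.s≤s (dbl-mono i≤r)))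

    private
      h z₁ z₂ : Fin n
      h  = g 0
      z₁ = g 1
      z₂ = g d

      h~z₁ : h ~ z₁
      h~z₁ = adj (ℕ.s≤s (ℕ.s≤s ℕ.z≤n))

      h~z₂ : h ~ z₂
      h~z₂ = ~-sym (closing refl)

      cycle⁻ : ∀ {w} → cycle w ≡ true → ∃[ k ] k ℕ.< L × g k ≡ w
      cycle⁻ = segment⁻ 0 L

      cycle⊝h : cycle ⊝ h ≐ segment g 1 d
      cycle⊝h = ≐-by to from
        where
        to : cycle ⊝ h ⊑ segment g 1 d
        to w e with ⊝⁻ e
        ... | e₁ , h≢w with cycle⁻ e₁
        ... | zero  , _ , eq = ⊥-elim (h≢w eq)
        ... | suc k , ℕ.s≤s k<d , refl = segment⁺ 1 d k<d
        from : segment g 1 d ⊑ cycle ⊝ h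
        from w e with segment⁻ 1 d e
        ... | k , k<d , refl = ⊝⁺ (segment⁺ 0 L (ℕ.s≤s k<d)) λ eq →
          ℕ.0≢1+n (inj ℕ.z<s (ℕ.s≤s k<d) eq)

      cycle⊝Nh : cycle ⊝N h ⊝ h ≐ segment g 2 (dbl r)
      cycle⊝Nh = ≐-by to from
        where
        to : cycle ⊝N h ⊝ h ⊑ segment g 2 (dbl r)
        to w e with ⊝⁻ e
        ... | e₁ , h≢w with ⊝N⁻ e₁
        ... | e₂ , h≁w with cycle⁻ e₂
        ... | zero        , _ , eq = ⊥-elim (h≢w eq)
        ... | suc zero    , _ , refl = ⊥-elim (h≁w h~z₁)
        ... | suc (suc k) , k<L , refl with k ℕ.≟ dbl r
        ...   | yes refl = ⊥-elim (h≁w h~z₂)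
        ...   | no k≢    = segment⁺ 2 (dbl r) (ℕ.≤∧≢⇒< (ℕ.≤-pred (ℕ.≤-pred (ℕ.≤-pred k<L))) k≢)
        from : segment g 2 (dbl r) ⊑ cycle ⊝N h ⊝ h
        from w e with segment⁻ 2 (dbl r) e
        ... | k , k<r , refl = ⊝⁺ (⊝N⁺ (segment⁺ 0 L k<L) h≁) λ eq → ℕ.0≢1+n (inj ℕ.z<s k<L eq)
          where
          k<L : suc (suc k) ℕ.< L
          k<L = ℕ.s≤s (ℕ.s≤s (ℕ.m<n⇒m<1+n k<r))
          h≁ : ¬ h ~ g (suc (suc k))
          h≁ h~ with chordless ℕ.z<s k<L h~
          ... | inj₂ (_ , eq) = ℕ.<⇒≢ k<r (ℕ.suc-injective (ℕ.suc-injective (ℕ.suc-injective eq)))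

    P-cycle : Admissible (suc r) → f r ≤ P cycle
    P-cycle adm = subst (f r ≤_) (sym (trans (P-delete h (segment⁺ 0 L ℕ.z<s)) (cong₂ (λ p q → p - t * q)
        (trans (P-cong cycle⊝h) (P-segment 0 d ℕ.≤-refl))
        (trans (P-cong cycle⊝Nh) (P-segment 1 (dbl r) (ℕ.n≤1+n _))))))
      (cycle-lower r λ i i≤r → path-bounds adm i (ℕ.m≤n⇒m≤1+n i≤r))

    private
      F₀ : Pairs n
      F₀ = path-pairs (suc r)

      -- `F₀` is the path left of the cycle once its hub `g 0` is gone. It stands at the end of the
      -- list, that is, at the start of the construction, so the pendant paths are attached after
      -- it.
      forest : Pairs n → Pairs n
      forest ps = ps ++ F₀

    cycle⊝h≐F₀ : cycle ⊝ h ≐ support F₀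
    cycle⊝h≐F₀ w = trans (cycle⊝h w) (sym (cong (λ A → A w) (support-path-pairs (suc r))))

    support⊑extend : ∀ ps → support (forest ps) ⊑ extend cycle ps
    support⊑extend []             w e = ⊝-⊑ cycle h w (trans (cycle⊝h≐F₀ w) e)
    support⊑extend ((s , l) ∷ ps) w e with ⊕⁻ e
    ... | inj₂ l≡w = ⊕⁺ʳ l≡w
    ... | inj₁ e₁ with ⊕⁻ e₁
    ...   | inj₂ s≡w = ⊕⁺ˡ (⊕⁺ʳ s≡w)
    ...   | inj₁ e₂  = ⊕⁺ˡ (⊕⁺ˡ (support⊑extend ps w e₂))

    private
      absent : ∀ ps {w} → extend cycle ps w ≡ false → support (forest ps) w ≡ false
      absent ps Ww = ≢true⇒false λ e → true≢false (support⊑extend ps _ e) Ww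

      F₀⊑ : ∀ ps → support F₀ ⊑ support (forest ps)
      F₀⊑ []             w e = e
      F₀⊑ ((s , l) ∷ ps) w e = ⊕⁺ˡ (⊕⁺ˡ (F₀⊑ ps w e))

      h∈ : ∀ ps → extend cycle ps h ≡ true
      h∈ ps = extend-⊒ ps h (segment⁺ 0 L ℕ.z<s)

    growth-forest : ∀ {ps} → Growth G cycle ps → PairForest G (forest ps)
    growth-forest [] = path-forest (suc r) (ℕ.n<1+n _)
    growth-forest {_ ∷ ps} (grow gr Ws Wl s~l leaf Wp s~p only) =
      cons (growth-forest gr) (absent ps Ws) (absent ps Wl) s~l
        (λ w Fw → leaf w (support⊑extend ps w Fw))
        λ w w′ Fw Fw′ s~w s~w′ → trans (only w (support⊑extend ps w Fw) s~w)
                                  (sym (only w′ (support⊑extend ps w′ Fw′) s~w′))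

    extend⊝h : ∀ {ps} → Growth G cycle ps → extend cycle ps ⊝ h ≐ support (forest ps)
    extend⊝h [] = cycle⊝h≐F₀
    extend⊝h {(s , l) ∷ ps} (grow gr Ws Wl _ _ _ _ _) = ≐-by to from
      where
      to : extend cycle ((s , l) ∷ ps) ⊝ h ⊑ support (forest ((s , l) ∷ ps))
      to w e with ⊝⁻ e
      ... | e₁ , h≢w with ⊕⁻ e₁
      ... | inj₂ l≡w = ⊕⁺ʳ l≡w
      ... | inj₁ e₂ with ⊕⁻ e₂
      ...   | inj₂ s≡w = ⊕⁺ˡ (⊕⁺ʳ s≡w)
      ...   | inj₁ e₃  = ⊕⁺ˡ (⊕⁺ˡ (trans (sym (extend⊝h gr w)) (⊝⁺ e₃ h≢w)))
      from : support (forest ((s , l) ∷ ps)) ⊑ extend cycle ((s , l) ∷ ps) ⊝ h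
      from w e with ⊕⁻ e
      ... | inj₂ refl = ⊝⁺ (⊕⁺ʳ refl) λ { refl → true≢false (h∈ ps) Wl }
      ... | inj₁ e₁ with ⊕⁻ e₁
      ...   | inj₂ refl = ⊝⁺ (⊕⁺ˡ (⊕⁺ʳ refl)) λ { refl → true≢false (h∈ ps) Ws }
      ...   | inj₁ e₂ = let Ww , h≢w = ⊝⁻ (trans (extend⊝h gr w) e₂) in ⊝⁺ (⊕⁺ˡ (⊕⁺ˡ Ww)) h≢w

    length-forest : ∀ ps → length (forest ps) ≡ suc (length ps ℕ.+ r)
    length-forest []       = length-path-pairs (suc r)
    length-forest (_ ∷ ps) = cong suc (length-forest ps)

    growth-lower : ∀ {ps} → Growth G cycle ps → Admissible (suc (length ps ℕ.+ r)) →
      f (length ps ℕ.+ r) ≤ P (extend cycle ps)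
    growth-lower [] adm = P-cycle adm
    growth-lower {(s , l) ∷ ps} (grow {p = p} gr Ws Wl s~l leaf Wp s~p only) adm = begin
      f (suc k)                           ≡⟨ f-suc k ⟩
      u * f k - t * v ^ suc k             ≤⟨ ℚ.+-mono-≤ (*-monoˡ 0≤u (growth-lower gr adm′))
                                               (ℚ.neg-antimono-≤ (*-monoˡ 0≤t hub)) ⟩
      u * P W - t * P (W ⊝ p)             ≡⟨ cong₂ (λ a b → u * a - t * b) (P-cong W≐) (P-cong W⊝p≐) ⟩
      u * P (W′ ⊝ s ⊝ l) - t * P (W′ ⊝ s ⊝ l ⊝N s)
                                          ≡⟨ P-pendant (⊕⁺ˡ (⊕⁺ʳ refl)) (⊕⁺ʳ refl) s~l l-leaf ⟨
      P W′                                ∎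
      where
      open ℚ.≤-Reasoning
      k  = length ps ℕ.+ r
      W  = extend cycle ps
      W′ = extend cycle ((s , l) ∷ ps)
      adm′ : Admissible (suc k)
      adm′ = admissible-pred (suc k) adm
      in-F : ∀ {k} → k ℕ.< d → support (forest ps) (g (suc k)) ≡ true
      in-F k<d = F₀⊑ ps _ (trans (cong (λ A → A _) (support-path-pairs (suc r))) (segment⁺ 1 d k<d))
      hub : P (W ⊝ p) ≤ v ^ suc k
      -- The hub is `g 0`. Its neighbours `g 1` and `g d` are distinct because `d` is at least 2,
      -- and the forest around it has `suc k` pairs.
      hub = subst (λ m → P (W ⊝ p) ≤ v ^ m) (length-forest ps)
        (hub-bound (growth-forest gr) (subst Admissible (sym (length-forest ps)) adm′) (extend⊝h gr) (h∈ ps)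
          (in-F ℕ.z<s) (in-F (ℕ.n<1+n _))
          (λ eq → ℕ.0≢1+n (ℕ.suc-injective (inj (ℕ.s≤s ℕ.z<s) (ℕ.n<1+n d) eq))) h~z₁ h~z₂ p Wp)
      W≐ : W ≐ W′ ⊝ s ⊝ l
      W≐ = ≐-by
        (λ w e → ⊝⁺ (⊝⁺ (⊕⁺ˡ (⊕⁺ˡ e)) λ { refl → true≢false e Ws }) λ { refl → true≢false e Wl })
        (λ w e → let e₁ , l≢w = ⊝⁻ e ; e₂ , s≢w = ⊝⁻ e₁ in old (⊕⁻ e₂) s≢w l≢w)
        where
        old : ∀ {w} → (W ⊕ s) w ≡ true ⊎ l ≡ w → s ≢ w → l ≢ w → W w ≡ true
        old (inj₂ eq) _ l≢w = ⊥-elim (l≢w eq)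
        old (inj₁ e) s≢w _ with ⊕⁻ e
        ... | inj₁ Ww = Ww
        ... | inj₂ eq = ⊥-elim (s≢w eq)
      W⊝p≐ : W ⊝ p ≐ W′ ⊝ s ⊝ l ⊝N s
      W⊝p≐ = ≐-by
        (λ w e → let Ww , p≢w = ⊝⁻ e in ⊝N⁺ (trans (sym (W≐ w)) Ww) λ s~w → p≢w (sym (only w Ww s~w)))
        (λ w e → let e₁ , s≁w = ⊝N⁻ e in ⊝⁺ (trans (W≐ w) e₁) λ { refl → s≁w s~p })
      l-leaf : ∀ w → W′ w ≡ true → l ~ w → w ≡ s
      l-leaf w e l~w with ⊕⁻ e
      ... | inj₂ refl = ⊥-elim (~-irrefl refl l~w)
      ... | inj₁ e₁ with ⊕⁻ e₁
      ...   | inj₂ eq = sym eq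
      ...   | inj₁ Ww = ⊥-elim (leaf w Ww l~w)

-- Cycles in unicyclic graphs

module _ {m : ℕ} where
  toℕ-mod : ∀ {k} → k ℕ.< suc m → toℕ (k mod suc m) ≡ k
  toℕ-mod k<m = trans (Fin.toℕ-fromℕ< _) (m<n⇒m%n≡m k<m)

  toℕ-next : ∀ {i : Fin (suc m)} → suc (toℕ i) ℕ.< suc m → toℕ (next i) ≡ suc (toℕ i)
  toℕ-next = toℕ-mod

  toℕ-next-last : ∀ {i : Fin (suc m)} → suc (toℕ i) ≡ suc m → toℕ (next i) ≡ 0
  toℕ-next-last {i} eq = trans (Fin.toℕ-fromℕ< _) (trans (cong (_% suc m) eq) (n%n≡0 (suc m)))

  next-cases : ∀ (i : Fin (suc m)) →
    suc (toℕ i) ℕ.< suc m × toℕ (next i) ≡ suc (toℕ i) ⊎ suc (toℕ i) ≡ suc m × toℕ (next i) ≡ 0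
  next-cases i with ℕ.m≤n⇒m<n∨m≡n (Fin.toℕ<n i)
  ... | inj₁ lt = inj₁ (lt , toℕ-next lt)
  ... | inj₂ eq = inj₂ (eq , toℕ-next-last eq)

  next-injective : ∀ {i j : Fin (suc m)} → next i ≡ next j → i ≡ j
  next-injective {i} {j} eq with next-cases i | next-cases j
  ... | inj₁ (_ , p) | inj₁ (_ , q) =
    Fin.toℕ-injective (ℕ.suc-injective (trans (sym p) (trans (cong toℕ eq) q)))
  ... | inj₂ (p , _) | inj₂ (q , _) = Fin.toℕ-injective (ℕ.suc-injective (trans p (sym q)))
  ... | inj₁ (_ , p) | inj₂ (_ , q) = ⊥-elim (ℕ.0≢1+n (trans (sym q) (trans (cong toℕ (sym eq)) p)))
  ... | inj₂ (_ , p) | inj₁ (_ , q) = ⊥-elim (ℕ.0≢1+n (trans (sym p) (trans (cong toℕ eq) q)))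

module _ {n : ℕ} (G : Graph n) where
  open Graph G

  module _ (h : ℕ → Fin n) (m : ℕ)
           (h-inj : ∀ {i j} → i ℕ.≤ 2 ℕ.+ m → j ℕ.≤ 2 ℕ.+ m → h i ≡ h j → i ≡ j)
           (h-adj : ∀ {i} → i ℕ.< 2 ℕ.+ m → h i ~ h (suc i))
           (h-close : h (2 ℕ.+ m) ~ h 0) where

    closedPath : Cycle G
    closedPath = record
      { len       = m
      ; vertex    = h ∘ toℕ
      ; injective = λ {i} {j} eq →
          Fin.toℕ-injective (h-inj (ℕ.≤-pred (Fin.toℕ<n i)) (ℕ.≤-pred (Fin.toℕ<n j)) eq)
      ; adjacent  = adjacent
      }
      where
      adjacent : ∀ i → h (toℕ i) ~ h (toℕ (next i))
      adjacent i with next-cases i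
      ... | inj₁ (lt , eq)  = subst (λ k → h (toℕ i) ~ h k) (sym eq) (h-adj (ℕ.≤-pred lt))
      ... | inj₂ (eq , eq₀) = subst₂ (λ j k → h j ~ h k) (sym (ℕ.suc-injective eq)) (sym eq₀) h-close

    closingEdge : closedPath ∋ᵉ (h (2 ℕ.+ m) , h 0)
    closingEdge = last , inj₁ (cong h (sym toℕ-last) , cong h (sym (toℕ-next-last (cong suc toℕ-last))))
      where
      last : Fin (3 ℕ.+ m)
      last = Fin.fromℕ (2 ℕ.+ m)
      toℕ-last : toℕ last ≡ 2 ℕ.+ m
      toℕ-last = Fin.toℕ-fromℕ (2 ℕ.+ m)

  record SimplePath (W : VSet n) (a b : Fin n) : Set where
    field
      at     : ℕ → Fin n
      size   : ℕ
      start  : at 0 ≡ a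
      end    : at size ≡ b
      inj    : ∀ {i j} → i ℕ.≤ size → j ℕ.≤ size → at i ≡ at j → i ≡ j
      adj    : ∀ {i} → i ℕ.< size → at i ~ at (suc i)
      within : ∀ {i} → i ℕ.≤ size → W (at i) ≡ true

  _◂_ : Fin n → (ℕ → Fin n) → ℕ → Fin n
  (x ◂ f) zero    = x
  (x ◂ f) (suc i) = f i

  ◂-inj : ∀ {x f m} → (∀ {i j} → i ℕ.≤ m → j ℕ.≤ m → f i ≡ f j → i ≡ j) →
    (∀ {i} → i ℕ.≤ m → f i ≢ x) →
    ∀ {i j} → i ℕ.≤ suc m → j ℕ.≤ suc m → (x ◂ f) i ≡ (x ◂ f) j → i ≡ j
  ◂-inj inj new {zero}  {zero}  _ _ _ = refl
  ◂-inj inj new {zero}  {suc j} _ (ℕ.s≤s q) eq = ⊥-elim (new q (sym eq))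
  ◂-inj inj new {suc i} {zero}  (ℕ.s≤s p) _ eq = ⊥-elim (new p eq)
  ◂-inj inj new {suc i} {suc j} (ℕ.s≤s p) (ℕ.s≤s q) eq = cong suc (inj p q eq)

  Inside : VSet n → Fin n → Fin n → Set
  Inside W a b = a ~ b × W a ≡ true × W b ≡ true

  -- Loop erasure: if `a` recurs on the simple path found for the rest of the walk, only the part
  -- from that occurrence on is kept.
  simplePath : ∀ {W a b} → W a ≡ true → Star (Inside W) a b → SimplePath W a b
  simplePath {a = a} Wa ε = record
    { at = λ _ → a ; size = 0 ; start = refl ; end = refl
    ; inj = λ { ℕ.z≤n ℕ.z≤n _ → refl } ; adj = λ () ; within = λ _ → Wa }
  simplePath {W} {a} {b} Wa ((a~c , _ , Wc) ◅ rest)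
    with simplePath Wc rest
  ... | record { at = f ; size = m ; start = refl ; end = end ; inj = inj ; adj = adj ; within = within }
    with ℕ.anyUpTo? (λ i → f i Fin.≟ a) (suc m)
  ... | yes (k , ℕ.s≤s k≤m , fk≡a) = record
    { at = λ i → f (k ℕ.+ i) ; size = m ℕ.∸ k
    ; start = trans (cong f (ℕ.+-identityʳ k)) fk≡a
    ; end = trans (cong f (ℕ.m+[n∸m]≡n k≤m)) end
    ; inj = λ p q eq → ℕ.+-cancelˡ-≡ k _ _ (inj (bound p) (bound q) eq)
    ; adj = λ {i} p → subst (λ j → f (k ℕ.+ i) ~ f j) (sym (ℕ.+-suc k i))
        (adj (ℕ.<-≤-trans (ℕ.+-monoʳ-< k p) (ℕ.≤-reflexive (ℕ.m+[n∸m]≡n k≤m))))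
    ; within = λ p → within (bound p) }
    where
    bound : ∀ {i} → i ℕ.≤ m ℕ.∸ k → k ℕ.+ i ℕ.≤ m
    bound p = ℕ.≤-trans (ℕ.+-monoʳ-≤ k p) (ℕ.≤-reflexive (ℕ.m+[n∸m]≡n k≤m))
  ... | no fresh = record
    { at = a ◂ f ; size = suc m ; start = refl ; end = end
    ; inj = ◂-inj inj λ {i} i≤m fi≡a → fresh (i , ℕ.s≤s i≤m , fi≡a)
    ; adj = λ { {zero} _ → a~c ; {suc i} (ℕ.s≤s p) → adj p }
    ; within = λ { {zero} _ → Wa ; {suc i} (ℕ.s≤s p) → within p } }

  module _ (unicyclic : Unicyclic G) where
    private
      C : Cycle G
      C = proj₁ unicyclic

      same : ∀ D → SameCycle C D
      same = proj₂ unicyclic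

    open Cycle C

    private
      L : ℕ
      L = 3 ℕ.+ len

    around : ℕ → Fin n
    around k = vertex (k mod L)

    around-toℕ : ∀ i → around (toℕ i) ≡ vertex i
    around-toℕ i = cong vertex (Fin.toℕ-injective (toℕ-mod (Fin.toℕ<n i)))

    around-inj : ∀ {i j} → i ℕ.< L → j ℕ.< L → around i ≡ around j → i ≡ j
    around-inj i<L j<L eq = trans (sym (toℕ-mod i<L)) (trans (cong toℕ (injective eq)) (toℕ-mod j<L))

    around-adj : ∀ {i} → suc i ℕ.< L → around i ~ around (suc i)
    around-adj {i} lt = subst (λ j → around i ~ vertex j)
      (Fin.toℕ-injective (trans (toℕ-next (subst (λ k → suc k ℕ.< L) (sym i≡) lt))
        (trans (cong suc i≡) (sym (toℕ-mod lt)))))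
      (adjacent (i mod L))
      where
      i≡ : toℕ (i mod L) ≡ i
      i≡ = toℕ-mod (ℕ.<-trans (ℕ.n<1+n i) lt)

    around-close : ∀ {i} → suc i ≡ L → around i ~ around 0
    around-close {i} eq = subst (λ j → around i ~ vertex j)
      (Fin.toℕ-injective (toℕ-next-last {i = i mod L} (trans (cong suc i≡) eq)))
      (adjacent (i mod L))
      where
      i≡ : toℕ (i mod L) ≡ i
      i≡ = toℕ-mod (ℕ.≤-reflexive eq)

    -- Uniqueness of the cycle in the form used below: any closed simple path has the edges of `C`,
    -- in particular its closing edge lies on `C`.
    closed⇒edge : ∀ h m →
      (∀ {i j} → i ℕ.≤ 2 ℕ.+ m → j ℕ.≤ 2 ℕ.+ m → h i ≡ h j → i ≡ j) →
      (∀ {i} → i ℕ.< 2 ℕ.+ m → h i ~ h (suc i)) → h (2 ℕ.+ m) ~ h 0 → C ∋ᵉ (h (2 ℕ.+ m) , h 0)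
    closed⇒edge h m inj adj close = Equivalence.from (same (closedPath h m inj adj close) _)
      (closingEdge h m inj adj close)

    -- A chord, together with the arc it cuts off, is a cycle, hence has the edges of C.
    around-edge : ∀ {i j} → i ℕ.< j → j ℕ.< L → around i ~ around j → C ∋ᵉ (around j , around i)
    around-edge {i} {j} i<j j<L i~j with ℕ.m≤n⇒∃[o]m+o≡n i<j
    -- Consecutive vertices cut off no shorter cycle; here the edge is one of `C` by construction.
    ... | zero , refl = i mod L , inj₂ (refl , cong vertex (Fin.toℕ-injective
        (trans (trans (toℕ-mod j<L) (cong suc (ℕ.+-identityʳ i)))
          (sym (trans (toℕ-next (subst (λ k → suc k ℕ.< L) (sym i≡)
            (subst (λ k → suc k ℕ.< L) (ℕ.+-identityʳ i) j<L))) (cong suc i≡))))))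
      where
      i≡ : toℕ (i mod L) ≡ i
      i≡ = toℕ-mod (ℕ.<-trans i<j j<L)
    ... | suc m , eq = subst₂ (λ a b → C ∋ᵉ (around a , around b)) end (ℕ.+-identityʳ i)
      (closed⇒edge (λ k → around (i ℕ.+ k)) m
        (λ p q e → ℕ.+-cancelˡ-≡ i _ _ (around-inj (bound p) (bound q) e))
        (λ {k} p → subst (λ k′ → around (i ℕ.+ k) ~ around k′) (sym (ℕ.+-suc i k))
          (around-adj (subst (ℕ._< L) (ℕ.+-suc i k) (bound p))))
        (subst₂ (λ a b → around a ~ around b) (sym end) (sym (ℕ.+-identityʳ i)) (~-sym i~j)))
      where
      end : i ℕ.+ (2 ℕ.+ m) ≡ j
      end = trans (ℕ.+-suc i (suc m)) eq
      bound : ∀ {k} → k ℕ.≤ 2 ℕ.+ m → i ℕ.+ k ℕ.< L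
      bound p = ℕ.≤-<-trans (ℕ.+-monoʳ-≤ i p) (subst (ℕ._< L) (sym end) j<L)

    chordlessCycle : ChordlessCycle G L
    chordlessCycle = record
      { g = around ; inj = around-inj ; adj = around-adj
      ; closing = around-close ; chordless = chordless }
      where
      chordless : ∀ {i j} → i ℕ.< j → j ℕ.< L → around i ~ around j → j ≡ suc i ⊎ (i ≡ 0 × suc j ≡ L)
      chordless {i} {j} i<j j<L i~j with around-edge i<j j<L i~j
      ... | m , inj₁ (j≡m , i≡m′) = go (next-cases m)
        where
        j≡ : j ≡ toℕ m
        j≡ = trans (sym (toℕ-mod j<L)) (cong toℕ (injective j≡m))
        i≡ : i ≡ toℕ (next m)
        i≡ = trans (sym (toℕ-mod (ℕ.<-trans i<j j<L))) (cong toℕ (injective i≡m′))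
        go : suc (toℕ m) ℕ.< L × toℕ (next m) ≡ suc (toℕ m) ⊎ suc (toℕ m) ≡ L × toℕ (next m) ≡ 0 →
          j ≡ suc i ⊎ (i ≡ 0 × suc j ≡ L)
        go (inj₁ (_ , eq)) = ⊥-elim (ℕ.<⇒≱ i<j (ℕ.≤-trans (ℕ.n≤1+n j)
          (ℕ.≤-reflexive (sym (trans i≡ (trans eq (cong suc (sym j≡))))))))
        go (inj₂ (eq , eq₀)) = inj₂ (trans i≡ eq₀ , trans (cong suc j≡) eq)
      ... | m , inj₂ (i≡m , j≡m′) = go (next-cases m)
        where
        i≡ : i ≡ toℕ m
        i≡ = trans (sym (toℕ-mod (ℕ.<-trans i<j j<L))) (cong toℕ (injective i≡m))
        j≡ : j ≡ toℕ (next m)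
        j≡ = trans (sym (toℕ-mod j<L)) (cong toℕ (injective j≡m′))
        go : suc (toℕ m) ℕ.< L × toℕ (next m) ≡ suc (toℕ m) ⊎ suc (toℕ m) ≡ L × toℕ (next m) ≡ 0 →
          j ≡ suc i ⊎ (i ≡ 0 × suc j ≡ L)
        go (inj₁ (_ , eq)) = inj₁ (trans j≡ (trans eq (cong suc (sym i≡))))
        go (inj₂ (_ , eq₀)) = ⊥-elim (ℕ.n≮0 (subst (i ℕ.<_) (trans j≡ eq₀) i<j))

    open ChordlessCycle chordlessCycle using (cycle)

    vertex∈cycle : ∀ i → cycle (vertex i) ≡ true
    vertex∈cycle i = subst (λ w → cycle w ≡ true) (around-toℕ i) (segment⁺ 0 L (Fin.toℕ<n i))

    cycle⁻′ : ∀ {w} → cycle w ≡ true → ∃[ i ] vertex i ≡ w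
    cycle⁻′ e = let k , _ , eq = segment⁻ 0 L e in k mod L , eq

    vertex-edge : ∀ i j → vertex i ~ vertex j → j ≡ next i ⊎ i ≡ next j
    vertex-edge i j i~j with ℕ.<-cmp (toℕ i) (toℕ j)
    ... | tri≈ _ eq _ = ⊥-elim (~-irrefl (cong vertex (Fin.toℕ-injective eq)) i~j)
    ... | tri< lt _ _ = orient (subst₂ (λ a b → C ∋ᵉ (a , b)) (around-toℕ j) (around-toℕ i)
            (around-edge lt (Fin.toℕ<n j) (subst₂ _~_ (sym (around-toℕ i)) (sym (around-toℕ j)) i~j)))
      where
      orient : C ∋ᵉ (vertex j , vertex i) → j ≡ next i ⊎ i ≡ next j
      orient (m , inj₁ (p , q)) = inj₂ (trans (injective q) (cong next (sym (injective p))))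
      orient (m , inj₂ (p , q)) = inj₁ (trans (injective q) (cong next (sym (injective p))))
    ... | tri> _ _ lt = orient (subst₂ (λ a b → C ∋ᵉ (a , b)) (around-toℕ i) (around-toℕ j)
            (around-edge lt (Fin.toℕ<n i) (subst₂ _~_ (sym (around-toℕ j)) (sym (around-toℕ i)) (~-sym i~j))))
      where
      orient : C ∋ᵉ (vertex i , vertex j) → j ≡ next i ⊎ i ≡ next j
      orient (m , inj₁ (p , q)) = inj₁ (trans (injective q) (cong next (sym (injective p))))
      orient (m , inj₂ (p , q)) = inj₂ (trans (injective q) (cong next (sym (injective p))))

    ConnectedSet : VSet n → Set
    ConnectedSet W = ∀ a b → W a ≡ true → W b ≡ true → Star (Inside W) a b

    -- Two neighbours a ≠ b of v in W would close up to a cycle through v.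
    unique-neighbour : ∀ {W v a b} → cycle ⊑ W → ConnectedSet W → W v ≡ false →
      W a ≡ true → W b ≡ true → v ~ a → v ~ b → a ≡ b
    unique-neighbour {W} {v} {a} {b} Z⊑W conn Wv Wa Wb v~a v~b
      with simplePath Wa (conn a b Wa Wb)
    ... | record { at = f ; size = zero ; start = refl ; end = refl } = refl
    ... | record { at = f ; size = suc m ; start = refl ; end = refl ; inj = inj ; adj = adj ; within = within } =
      -- By uniqueness the cycle through `v` has the edges of `C`, so `v` lies on `C` and hence in
      -- `W`, contrary to `Wv`.
      ⊥-elim (true≢false (Z⊑W v (on-cycle (closed⇒edge (v ◂ f) m
        (◂-inj inj λ i≤m fi≡v → true≢false (subst (λ x → W x ≡ true) fi≡v (within i≤m)) Wv)
        (λ { {zero} _ → v~a ; {suc i} (ℕ.s≤s p) → adj p })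
        (~-sym v~b)))) Wv)
      where
      on-cycle : ∀ {x} → C ∋ᵉ (x , v) → cycle v ≡ true
      on-cycle (i , inj₁ (_ , refl)) = vertex∈cycle (next i)
      on-cycle (i , inj₂ (refl , _)) = vertex∈cycle i

-- Well-covered graphs

count : ∀ {n} → VSet n → ℕ
count {zero}  A = 0
count {suc n} A = (if A zero then suc else id) (count (A ∘ suc))

count-cong : ∀ {n} {A B : VSet n} → A ≐ B → count A ≡ count B
count-cong {zero}  eq = refl
count-cong {suc n} {B = B} eq rewrite eq zero =
  cong (if B zero then suc else id) (count-cong (eq ∘ suc))

count-mono : ∀ {n} {A B : VSet n} → A ⊑ B → count A ℕ.≤ count B
count-mono {zero}          A⊑B = ℕ.z≤n
count-mono {suc n} {A} {B} A⊑B with A zero in a | B zero in b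
... | true  | true  = ℕ.s≤s (count-mono (A⊑B ∘ suc))
... | true  | false = ⊥-elim (true≢false (A⊑B zero a) b)
... | false | true  = ℕ.m≤n⇒m≤1+n (count-mono (A⊑B ∘ suc))
... | false | false = count-mono (A⊑B ∘ suc)

⊝-suc : ∀ {n} (A : VSet (suc n)) v → (A ⊝ suc v) ∘ suc ≐ (A ∘ suc) ⊝ v
⊝-suc A v w = bool-ext {(A ⊝ suc v) (suc w)} {((A ∘ suc) ⊝ v) w}
  (λ e → let Aw , v≢w = ⊝⁻ {A = A} e in ⊝⁺ {A = A ∘ suc} Aw (v≢w ∘ cong suc))
  (λ e → let Aw , v≢w = ⊝⁻ {A = A ∘ suc} e in ⊝⁺ {A = A} Aw (v≢w ∘ Fin.suc-injective))

count-⊝ : ∀ {n} (A : VSet n) v → A v ≡ true → count A ≡ suc (count (A ⊝ v))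
count-⊝ A zero Av rewrite Av | ⊝-self A zero =
  cong suc (count-cong λ w → sym (⊝-other {A = A} {zero} {suc w} λ ()))
count-⊝ A (suc v) Av rewrite ⊝-other {A = A} {suc v} {zero} (λ ()) with A zero
... | true  = cong suc (trans (count-⊝ (A ∘ suc) v Av) (cong suc (count-cong λ w → sym (⊝-suc A v w))))
... | false = trans (count-⊝ (A ∘ suc) v Av) (cong suc (count-cong λ w → sym (⊝-suc A v w)))

count-⊕ : ∀ {n} (A : VSet n) v → A v ≡ false → count (A ⊕ v) ≡ suc (count A)
count-⊕ A v Av = trans (count-⊝ (A ⊕ v) v (⊕⁺ʳ refl)) (cong suc (count-cong (⊕-⊝ {A = A} Av)))

count-full : ∀ n → count (full {n}) ≡ n
count-full zero    = refl
count-full (suc n) = cong suc (count-full n)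

count-∅ : ∀ n → count (∅ {n}) ≡ 0
count-∅ zero    = refl
count-∅ (suc n) = count-∅ n

∣S∣≡count : ∀ {n} (S : Subset n) → ∣ S ∣ ≡ count (lookup S)
∣S∣≡count []          = refl
∣S∣≡count (true  ∷ S) = cong suc (∣S∣≡count S)
∣S∣≡count (false ∷ S) = ∣S∣≡count S

module _ {n : ℕ} (G : Graph n) where
  open Graph G

  IndependentSet MaximalSet : VSet n → Set
  IndependentSet A = ∀ u v → A u ≡ true → A v ≡ true → ¬ u ~ v
  MaximalSet A = IndependentSet A × (∀ v → A v ≡ true ⊎ ∃[ u ] (A u ≡ true × u ~ v))

  independent-⊕ : ∀ {A x} → IndependentSet A → (∀ u → A u ≡ true → ¬ u ~ x) → IndependentSet (A ⊕ x)
  independent-⊕ ind new u v Au Av u~v with ⊕⁻ Au | ⊕⁻ Av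
  ... | inj₁ u∈   | inj₁ v∈   = ind u v u∈ v∈ u~v
  ... | inj₁ u∈   | inj₂ refl = new u u∈ u~v
  ... | inj₂ refl | inj₁ v∈   = new v v∈ (~-sym u~v)
  ... | inj₂ refl | inj₂ refl = ~-irrefl refl u~v

  -- Greedy extension: a vertex is added unless it already has a neighbour in the set, and that
  -- neighbour stays there until the end.
  maximal⊒ : ∀ {A} → IndependentSet A → ∃[ M ] (A ⊑ M × MaximalSet M)
  maximal⊒ ind = let M , A⊑M , indM , dom = go (allFin n) ind in
    M , A⊑M , indM , λ v → dom v (∈-allFin v)
    where
    go : ∀ xs {A} → IndependentSet A → ∃[ M ] (A ⊑ M × IndependentSet M ×
      (∀ v → v ∈ xs → M v ≡ true ⊎ ∃[ u ] (M u ≡ true × u ~ v)))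
    go []       {A} ind = A , (λ _ e → e) , ind , λ _ ()
    go (x ∷ xs) {A} ind with Fin.any? (λ u → (A u 𝔹.≟ true) ×-dec (u ~? x))
    ... | yes (u , Au , u~x) with go xs ind
    ...   | M , A⊑M , indM , dom = M , A⊑M , indM ,
      λ { v (here refl) → inj₂ (u , A⊑M u Au , u~x) ; v (there v∈) → dom v v∈ }
    go (x ∷ xs) {A} ind | no none with go xs (independent-⊕ ind λ u Au u~x → none (u , Au , u~x))
    ...   | M , A⊑M , indM , dom = M , (λ w e → A⊑M w (⊕⁺ˡ e)) , indM ,
      λ { v (here refl) → inj₁ (A⊑M x (⊕⁺ʳ refl)) ; v (there v∈) → dom v v∈ }

  module _ (wellCovered : WellCovered G) where
    maximal-count : ∀ {A B} → MaximalSet A → MaximalSet B → count A ≡ count B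
    maximal-count {A} {B} maxA maxB = begin
      count A              ≡⟨ size A ⟨
      ∣ Vec.tabulate A ∣   ≡⟨ wellCovered _ _ (maximal maxA) (maximal maxB) ⟩
      ∣ Vec.tabulate B ∣   ≡⟨ size B ⟩
      count B              ∎
      where
      open ≡-Reasoning
      size : ∀ A → ∣ Vec.tabulate A ∣ ≡ count A
      size A = trans (∣S∣≡count (Vec.tabulate A)) (count-cong (lookup∘tabulate A))
      ∈⁻ : ∀ {A v} → v ∈ˢ Vec.tabulate A → A v ≡ true
      ∈⁻ {A} {v} v∈ = trans (sym (lookup∘tabulate A v)) ([]=⇒lookup v∈)
      ∈⁺ : ∀ {A v} → A v ≡ true → v ∈ˢ Vec.tabulate A
      ∈⁺ {A} {v} Av = lookup⇒[]= v _ (trans (lookup∘tabulate A v) Av)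
      maximal : ∀ {A} → MaximalSet A → MaximalIndependent G (Vec.tabulate A)
      maximal {A} (ind , dom) = (λ u v u∈ v∈ → ind u v (∈⁻ u∈) (∈⁻ v∈)) ,
        λ T indT A⊆T → Subset.⊆-antisym (λ {v} v∈T → ∈⁺ (decide indT A⊆T v∈T (dom v))) A⊆T
        where
        decide : ∀ {T v} → Independent G T → (∀ {w} → w ∈ˢ Vec.tabulate A → w ∈ˢ T) → v ∈ˢ T →
          A v ≡ true ⊎ ∃[ u ] (A u ≡ true × u ~ v) → A v ≡ true
        decide indT A⊆T v∈T (inj₁ Av) = Av
        decide indT A⊆T v∈T (inj₂ (u , Au , u~v)) = ⊥-elim (indT u _ (A⊆T (∈⁺ Au)) v∈T u~v)

    -- A is what remains after deleting the closed neighbourhood of the independent set K.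
    record Remainder (K A : VSet n) : Set where
      field
        independent : IndependentSet K
        avoids      : ∀ {v} → A v ≡ true → K v ≡ false
        apart       : ∀ {u v} → K u ≡ true → A v ≡ true → ¬ u ~ v
        covered     : ∀ {v} → A v ≡ false → K v ≡ true ⊎ ∃[ u ] (K u ≡ true × u ~ v)

    -- Exchanging s for l and l′ in a maximal independent set would enlarge it.
    no-twin-leaves : ∀ {K A s l l′} → Remainder K A → A s ≡ true → A l ≡ true → A l′ ≡ true → l ≢ l′ →
      s ~ l → s ~ l′ → (∀ w → A w ≡ true → l ~ w → w ≡ s) → (∀ w → A w ≡ true → l′ ~ w → w ≡ s) → ⊥
    no-twin-leaves {K} {A} {s} {l} {l′} rem As Al Al′ l≢l′ s~l s~l′ leaf leaf′
      with maximal⊒ (independent-⊕ (Remainder.independent rem) λ u Ku → Remainder.apart rem Ku As)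
    ... | M , K⊕s⊑M , maxM@(indM , _) = ℕ.1+n≰n (begin
      suc (count M)          ≡⟨ cong suc (count-⊝ M s Ms) ⟩
      suc (suc (count T))    ≡⟨ cong suc (count-⊕ T l (absent s~l)) ⟨
      suc (count (T ⊕ l))    ≡⟨ count-⊕ (T ⊕ l) l′ (≢true⇒false λ e → clash (⊕⁻ e)) ⟨
      count (T ⊕ l ⊕ l′)     ≤⟨ count-mono (proj₁ (proj₂ ext)) ⟩
      count (proj₁ ext)      ≡⟨ maximal-count (proj₂ (proj₂ ext)) maxM ⟩
      count M                ∎)
      where
      open ℕ.≤-Reasoning
      open Remainder rem
      Ms : M s ≡ true
      Ms = K⊕s⊑M s (⊕⁺ʳ refl)
      T : VSet n
      T = M ⊝ s
      absent : ∀ {x} → s ~ x → T x ≡ false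
      absent s~x = ≢true⇒false λ e → indM s _ Ms (proj₁ (⊝⁻ e)) s~x
      -- A member of `M` outside `A` cannot be adjacent to `x`: it either belongs to `K`, which is
      -- apart from `A`, or has a neighbour in `K`, which would be an edge inside `M`.
      apart-T : ∀ {x} → A x ≡ true → (∀ w → A w ≡ true → x ~ w → w ≡ s) → ∀ u → T u ≡ true → ¬ u ~ x
      apart-T Ax leaf u Tu u~x with ⊝⁻ Tu | true⊎false (A u)
      ... | Mu , s≢u | inj₁ Au = s≢u (sym (leaf u Au (~-sym u~x)))
      ... | Mu , s≢u | inj₂ Au with covered Au
      ...   | inj₁ Ku = apart Ku Ax u~x
      ...   | inj₂ (k , Kk , k~u) = indM k u (K⊕s⊑M k (⊕⁺ˡ Kk)) Mu k~u
      clash : T l′ ≡ true ⊎ l ≡ l′ → ⊥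
      clash (inj₁ e) = true≢false e (absent s~l′)
      clash (inj₂ e) = l≢l′ e
      indT : IndependentSet T
      indT u v Tu Tv = indM u v (proj₁ (⊝⁻ Tu)) (proj₁ (⊝⁻ Tv))
      ext : ∃[ M′ ] (T ⊕ l ⊕ l′ ⊑ M′ × MaximalSet M′)
      ext = maximal⊒ (independent-⊕ (independent-⊕ indT (apart-T Al leaf)) new)
        where
        new : ∀ u → (T ⊕ l) u ≡ true → ¬ u ~ l′
        new u e u~l′ with ⊕⁻ e
        ... | inj₁ Tu = apart-T Al′ leaf′ u Tu u~l′
        ... | inj₂ refl with leaf l′ Al′ u~l′
        ...   | refl = ~-irrefl refl s~l′

-- Decomposition into pendant paths

dbl-* : ∀ k → dbl k ≡ k ℕ.* 2
dbl-* zero    = refl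
dbl-* (suc k) = cong (2 ℕ.+_) (dbl-* k)

dbl-+ : ∀ a b → dbl (a ℕ.+ b) ≡ dbl a ℕ.+ dbl b
dbl-+ zero    b = refl
dbl-+ (suc a) b = cong (2 ℕ.+_) (dbl-+ a b)

parity : ∀ m → (∃[ k ] m ≡ dbl k) ⊎ (∃[ k ] m ≡ suc (dbl k))
parity zero          = inj₁ (0 , refl)
parity (suc m) with parity m
... | inj₁ (k , refl) = inj₂ (k , refl)
... | inj₂ (k , refl) = inj₁ (suc k , refl)

odd⇒≢dbl : ∀ {n} → Odd n → ∀ k → n ≢ dbl k
odd⇒≢dbl odd k eq = odd (divides k (trans eq (dbl-* k)))

module _ {n : ℕ} (G : Graph n) where
  open Graph G

  module _ {S : VSet n → Set}
           (step : ∀ {W v p} → S W → W v ≡ false → W p ≡ true → v ~ p →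
                   ∃[ W′ ] (S W′ × W ⊑ W′ × W′ v ≡ true)) where

    reach : ∀ {W a x} → S W → W a ≡ true → Star _~_ a x → ∃[ W′ ] (S W′ × W ⊑ W′ × W′ x ≡ true)
    reach {W} sW Wa ε = W , sW , (λ _ e → e) , Wa
    reach {W} sW Wa (_◅_ {j = c} a~c rest) with true⊎false (W c)
    ... | inj₁ Wc = reach sW Wc rest
    ... | inj₂ Wc =
      let W₁ , s₁ , W⊑W₁ , W₁c = step sW Wc Wa (~-sym a~c)
          W₂ , s₂ , W₁⊑W₂ , W₂x = reach s₁ W₁c rest
      in W₂ , s₂ , ⊑-trans W⊑W₁ W₁⊑W₂ , W₂x

    -- Walks from `a` to every vertex in turn, absorbing what is met outside the set. A step may
    -- absorb more than the requested vertex, so the same argument serves `Ordered`, which grows by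
    -- vertices, and `Paired`, which grows by pairs.
    exhaust : ∀ {W a} → Connected G → S W → W a ≡ true → ∃[ W′ ] (S W′ × (∀ x → W′ x ≡ true))
    exhaust {W} {a} conn sW Wa = let W′ , s′ , _ , all = go (allFin n) sW Wa in
      W′ , s′ , λ x → all x (∈-allFin x)
      where
      go : ∀ xs {W} → S W → W a ≡ true → ∃[ W′ ] (S W′ × W ⊑ W′ × (∀ x → x ∈ xs → W′ x ≡ true))
      go []       {W} sW Wa = W , sW , (λ _ e → e) , λ _ ()
      go (x ∷ xs) {W} sW Wa =
        let W₁ , s₁ , W⊑W₁ , W₁x = reach sW Wa (conn a x)
            W₂ , s₂ , W₁⊑W₂ , all = go xs s₁ (W⊑W₁ a Wa)
        in W₂ , s₂ , ⊑-trans W⊑W₁ W₁⊑W₂ , λ { y (here refl) → W₁⊑W₂ x W₁x ; y (there y∈) → all y y∈ }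

  data Ordered (Z : VSet n) : VSet n → Set where
    base : Ordered Z Z
    add  : ∀ {W v} → Ordered Z W → (∀ a b → W a ≡ true → W b ≡ true → v ~ a → v ~ b → a ≡ b) →
      Ordered Z (W ⊕ v)

  module _ (unicyclic : Unicyclic G) where
    open Cycle (proj₁ unicyclic)

    private
      L : ℕ
      L = 3 ℕ.+ len

      chordless : ChordlessCycle G L
      chordless = chordlessCycle G unicyclic

    open ChordlessCycle chordless using (cycle; g; adj)

    private
      _∋Star_ : VSet n → Fin n → Set
      W ∋Star b = Star (Inside G W) (g 0) b

      inside-sym : ∀ {W a b} → Inside G W a b → Inside G W b a
      inside-sym (a~b , Wa , Wb) = ~-sym a~b , Wb , Wa

      inside-mono : ∀ {W W′} → W ⊑ W′ → ∀ {a b} → Inside G W a b → Inside G W′ a b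
      inside-mono W⊑W′ (a~b , Wa , Wb) = a~b , W⊑W′ _ Wa , W⊑W′ _ Wb

    cycle-connected : ConnectedSet G unicyclic cycle
    cycle-connected a b Za Zb with segment⁻ 0 L Za | segment⁻ 0 L Zb
    ... | i , i<L , refl | j , j<L , refl = Star.reverse inside-sym (along i i<L) ◅◅ along j j<L
      where
      along : ∀ i → i ℕ.< L → cycle ∋Star g i
      along zero    _  = ε
      along (suc i) lt = along i i<L′ ◅◅ (adj lt , segment⁺ 0 L i<L′ , segment⁺ 0 L lt) ◅ ε
        where i<L′ = ℕ.<-trans (ℕ.n<1+n i) lt

    connected-⊕ : ∀ {W v p} → ConnectedSet G unicyclic W → W p ≡ true → v ~ p →
      ConnectedSet G unicyclic (W ⊕ v)
    connected-⊕ {W} {v} {p} conn Wp v~p a b Wa Wb with ⊕⁻ Wa | ⊕⁻ Wb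
    ... | inj₁ a∈   | inj₁ b∈   = Star.map (inside-mono λ _ → ⊕⁺ˡ) (conn a b a∈ b∈)
    ... | inj₂ refl | inj₁ b∈   = (v~p , ⊕⁺ʳ refl , ⊕⁺ˡ Wp) ◅ Star.map (inside-mono λ _ → ⊕⁺ˡ) (conn p b Wp b∈)
    ... | inj₁ a∈   | inj₂ refl = Star.map (inside-mono λ _ → ⊕⁺ˡ) (conn a p a∈ Wp) ◅◅ (~-sym v~p , ⊕⁺ˡ Wp , ⊕⁺ʳ refl) ◅ ε
    ... | inj₂ refl | inj₂ refl = ε

    -- A vertex of `A` whose successor is missing from `A` can have only its predecessor as a
    -- neighbour in `A`. If there is no such vertex, `A` is closed under `next` and is therefore
    -- empty or the whole cycle.
    cycle-neighbours : ∀ A → A ⊑ cycle →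
      (∀ w → A w ≡ false) ⊎ A ≐ cycle ⊎
      ∃[ l ] (A l ≡ true × (∀ a b → A a ≡ true → A b ≡ true → l ~ a → l ~ b → a ≡ b))
    cycle-neighbours A A⊑Z
      with Fin.any? (λ i → (A (vertex i) 𝔹.≟ true) ×-dec (A (vertex (next i)) 𝔹.≟ false))
    ... | yes (i , Ai , Ai′) = inj₂ (inj₂ (vertex i , Ai , λ a b Aa Ab → one (cycle⁻′ G unicyclic (A⊑Z a Aa)) (cycle⁻′ G unicyclic (A⊑Z b Ab)) Aa Ab))
      where
      before : ∀ j → A (vertex j) ≡ true → vertex i ~ vertex j → i ≡ next j
      before j Aj i~j with vertex-edge G unicyclic i j i~j
      ... | inj₁ refl = ⊥-elim (true≢false Aj Ai′)
      ... | inj₂ eq   = eq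
      one : ∀ {a b} → (∃[ j ] vertex j ≡ a) → (∃[ k ] vertex k ≡ b) → A a ≡ true → A b ≡ true →
        vertex i ~ a → vertex i ~ b → a ≡ b
      one (j , refl) (k , refl) Aj Ak i~j i~k =
        cong vertex (next-injective (trans (sym (before j Aj i~j)) (before k Ak i~k)))
    ... | no none with Fin.any? (λ i → A (vertex i) 𝔹.≟ true)
    ...   | no empty = inj₁ λ w → ≢true⇒false λ Aw →
      let i , eq = cycle⁻′ G unicyclic (A⊑Z w Aw) in empty (i , subst (λ x → A x ≡ true) (sym eq) Aw)
    ...   | yes (i , Ai) = inj₂ (inj₁ (≐-by A⊑Z λ w Zw →
      let k , k<L , eq = segment⁻ 0 L Zw in subst (λ x → A x ≡ true) eq (upwards 0 first k ℕ.z≤n k<L)))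
      where
      closed : ∀ j → A (vertex j) ≡ true → A (vertex (next j)) ≡ true
      closed j Aj with true⊎false (A (vertex (next j)))
      ... | inj₁ e = e
      ... | inj₂ e = ⊥-elim (none (j , Aj , e))
      upwards : ∀ j → A (g j) ≡ true → ∀ k → j ℕ.≤ k → k ℕ.< L → A (g k) ≡ true
      upwards j Aj k j≤k k<L with ℕ.m≤n⇒m<n∨m≡n j≤k
      ... | inj₂ refl = Aj
      upwards j Aj (suc k) j≤k k<L | inj₁ (ℕ.s≤s j≤k′) =
        subst (λ m → A (vertex m) ≡ true)
          (Fin.toℕ-injective (trans (toℕ-next (subst (λ m → suc m ℕ.< L) (sym k≡) k<L))
            (trans (cong suc k≡) (sym (toℕ-mod k<L)))))
          (closed (k mod L) (upwards j Aj k j≤k′ k<L′))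
        where
        k<L′ = ℕ.<-trans (ℕ.n<1+n k) k<L
        k≡ : toℕ (k mod L) ≡ k
        k≡ = toℕ-mod k<L′
      top : ℕ
      top = 2 ℕ.+ len
      -- `upwards` only reaches larger indices, so the argument climbs to the top index, wraps round
      -- to 0 and starts again from there.
      first : A (g 0) ≡ true
      first = subst (λ m → A (vertex m) ≡ true)
        (Fin.toℕ-injective (toℕ-next-last {i = top mod L} (cong suc (toℕ-mod (ℕ.n<1+n top)))))
        (closed (top mod L) (upwards (toℕ i)
          (subst (λ w → A w ≡ true) (sym (around-toℕ G unicyclic i)) Ai) top
          (ℕ.≤-pred (Fin.toℕ<n i)) (ℕ.n<1+n top)))

    -- The vertex of `A` that was added last has at most one neighbour in `A`; if `A` contains no
    -- added vertex, it lies inside the cycle.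
    ordered-leaf : ∀ {W} → Ordered cycle W → ∀ A → A ⊑ W →
      (∀ w → A w ≡ false) ⊎ A ≐ cycle ⊎
      ∃[ l ] (A l ≡ true × (∀ a b → A a ≡ true → A b ≡ true → l ~ a → l ~ b → a ≡ b))
    ordered-leaf base A A⊑W = cycle-neighbours A A⊑W
    ordered-leaf (add {W} {v} ord one) A A⊑W⊕v with true⊎false (A v)
    ... | inj₁ Av = inj₂ (inj₂ (v , Av , λ a b Aa Ab v~a v~b → one a b (old Aa v~a) (old Ab v~b) v~a v~b))
      where
      old : ∀ {a} → A a ≡ true → v ~ a → W a ≡ true
      old {a} Aa v~a with ⊕⁻ (A⊑W⊕v a Aa)
      ... | inj₁ Wa  = Wa
      ... | inj₂ v≡a = ⊥-elim (~-irrefl v≡a v~a)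
    ... | inj₂ Av = ordered-leaf ord A λ w Aw → old w Aw (⊕⁻ (A⊑W⊕v w Aw))
      where
      old : ∀ w → A w ≡ true → W w ≡ true ⊎ v ≡ w → W w ≡ true
      old w Aw (inj₁ Ww)   = Ww
      old w Aw (inj₂ refl) = ⊥-elim (true≢false Aw Av)

    record Joined (W : VSet n) : Set where
      field
        ⊒cycle    : cycle ⊑ W
        connected : ConnectedSet G unicyclic W

    joined-cycle : Joined cycle
    joined-cycle = record { ⊒cycle = λ _ e → e ; connected = cycle-connected }

    joined-⊕ : ∀ {W v p} → Joined W → W p ≡ true → v ~ p → Joined (W ⊕ v)
    joined-⊕ j Wp v~p = record
      { ⊒cycle = λ w e → ⊕⁺ˡ (⊒cycle w e) ; connected = connected-⊕ connected Wp v~p }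
      where open Joined j

    g0∈cycle : cycle (g 0) ≡ true
    g0∈cycle = segment⁺ 0 L ℕ.z<s

    leaf-or-cycle : Connected G → ∀ A →
      (∀ w → A w ≡ false) ⊎ A ≐ cycle ⊎
      ∃[ l ] (A l ≡ true × (∀ a b → A a ≡ true → A b ≡ true → l ~ a → l ~ b → a ≡ b))
    leaf-or-cycle conn A =
      let W , (ord , _) , all = exhaust {S = λ W → Ordered cycle W × Joined W} step conn (base , joined-cycle) g0∈cycle
      in ordered-leaf ord A λ w _ → all w
      where
      step : ∀ {W v p} → Ordered cycle W × Joined W → W v ≡ false → W p ≡ true → v ~ p →
        ∃[ W′ ] ((Ordered cycle W′ × Joined W′) × W ⊑ W′ × W′ v ≡ true)
      step {W} {v} (ord , j) Wv Wp v~p = W ⊕ v ,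
        (add ord (λ a b Wa Wb → unique-neighbour G unicyclic (Joined.⊒cycle j) (Joined.connected j) Wv Wa Wb) , joined-⊕ j Wp v~p) ,
        (λ _ → ⊕⁺ˡ) , ⊕⁺ʳ refl

    -- Peeling works from the leaves inwards, whereas `Growth` works from the cycle outwards. So
    -- only the matching of each leaf with its support is recorded, and connectedness later puts the
    -- pairs in the order that growth requires.
    record Matched (A : VSet n) : Set where
      field
        ⊒cycle : cycle ⊑ A
        mate   : Fin n → Fin n
        mate∈  : ∀ {v} → A v ≡ true → cycle v ≡ false → A (mate v) ≡ true × cycle (mate v) ≡ false
        v~mate : ∀ {v} → A v ≡ true → cycle v ≡ false → v ~ mate v
        mate²  : ∀ {v} → A v ≡ true → cycle v ≡ false → mate (mate v) ≡ v

    matched-cycle : ∀ {A} → A ≐ cycle → Matched A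
    matched-cycle {A} A≐Z = record
      { ⊒cycle = λ w Zw → trans (A≐Z w) Zw ; mate = id
      ; mate∈ = λ Av Zv → ⊥-elim (off Av Zv) ; v~mate = λ Av Zv → ⊥-elim (off Av Zv) ; mate² = λ _ _ → refl }
      where
      off : ∀ {v} → A v ≡ true → ¬ (cycle v ≡ false)
      off {v} Av Zv = true≢false (trans (sym (A≐Z v)) Av) Zv

    matched-pair : ∀ {A l s} → A l ≡ true → A s ≡ true → l ~ s → Matched (A ⊝ l ⊝ s) → Matched A
    matched-pair {A} {l} {s} Al As l~s M = record
      { ⊒cycle = λ w Zw → in-A (⊒cycle w Zw)
      ; mate = mate′
      ; mate∈ = λ {v} Av Zv → mate∈′ v Av Zv (v Fin.≟ l) (v Fin.≟ s)
      ; v~mate = λ {v} Av Zv → v~mate′ v Av Zv (v Fin.≟ l) (v Fin.≟ s)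
      ; mate² = λ {v} Av Zv → mate²′ v Av Zv (v Fin.≟ l) (v Fin.≟ s)
      }
      where
      open Matched M
      in-A : ∀ {w} → (A ⊝ l ⊝ s) w ≡ true → A w ≡ true
      in-A e = ⊝-⊑ A l _ (⊝-⊑ (A ⊝ l) s _ e)
      l≢s : l ≢ s
      l≢s eq = ~-irrefl eq l~s
      Zl : cycle l ≡ false
      Zl = ≢true⇒false λ e → proj₂ (⊝⁻ (⊝-⊑ (A ⊝ l) s l (⊒cycle l e))) refl
      Zs : cycle s ≡ false
      Zs = ≢true⇒false λ e → proj₂ (⊝⁻ (⊒cycle s e)) refl
      mate′ : Fin n → Fin n
      mate′ v = if does (v Fin.≟ l) then s else if does (v Fin.≟ s) then l else mate v
      at-l : mate′ l ≡ s
      at-l with l Fin.≟ l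
      ... | yes _ = refl
      ... | no l≢l = ⊥-elim (l≢l refl)
      at-s : mate′ s ≡ l
      at-s with s Fin.≟ l | s Fin.≟ s
      ... | yes eq | _ = ⊥-elim (l≢s (sym eq))
      ... | no _ | yes _ = refl
      ... | no _ | no s≢s = ⊥-elim (s≢s refl)
      elsewhere : ∀ {v} → v ≢ l → v ≢ s → mate′ v ≡ mate v
      elsewhere {v} v≢l v≢s with v Fin.≟ l | v Fin.≟ s
      ... | yes eq | _ = ⊥-elim (v≢l eq)
      ... | no _ | yes eq = ⊥-elim (v≢s eq)
      ... | no _ | no _ = refl
      rest : ∀ {v} → A v ≡ true → v ≢ l → v ≢ s → (A ⊝ l ⊝ s) v ≡ true
      rest Av v≢l v≢s = ⊝⁺ (⊝⁺ Av (v≢l ∘ sym)) (v≢s ∘ sym)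
      mate∈′ : ∀ v → A v ≡ true → cycle v ≡ false → Dec (v ≡ l) → Dec (v ≡ s) →
        A (mate′ v) ≡ true × cycle (mate′ v) ≡ false
      mate∈′ v Av Zv (yes refl) _ = subst (λ x → A x ≡ true × cycle x ≡ false) (sym at-l) (As , Zs)
      mate∈′ v Av Zv (no _) (yes refl) = subst (λ x → A x ≡ true × cycle x ≡ false) (sym at-s) (Al , Zl)
      mate∈′ v Av Zv (no v≢l) (no v≢s) = subst (λ x → A x ≡ true × cycle x ≡ false) (sym (elsewhere v≢l v≢s))
        (let Am , Zm = mate∈ (rest Av v≢l v≢s) Zv in in-A Am , Zm)
      v~mate′ : ∀ v → A v ≡ true → cycle v ≡ false → Dec (v ≡ l) → Dec (v ≡ s) → v ~ mate′ v
      v~mate′ v Av Zv (yes refl) _ = subst (v ~_) (sym at-l) l~s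
      v~mate′ v Av Zv (no _) (yes refl) = subst (v ~_) (sym at-s) (~-sym l~s)
      v~mate′ v Av Zv (no v≢l) (no v≢s) = subst (v ~_) (sym (elsewhere v≢l v≢s)) (v~mate (rest Av v≢l v≢s) Zv)
      mate²′ : ∀ v → A v ≡ true → cycle v ≡ false → Dec (v ≡ l) → Dec (v ≡ s) → mate′ (mate′ v) ≡ v
      mate²′ v Av Zv (yes refl) _ = trans (cong mate′ at-l) at-s
      mate²′ v Av Zv (no _) (yes refl) = trans (cong mate′ at-s) at-l
      mate²′ v Av Zv (no v≢l) (no v≢s) =
        let Am , Zm = mate∈ (rest Av v≢l v≢s) Zv ; Am′ , s≢m = ⊝⁻ Am ; _ , l≢m = ⊝⁻ Am′ in
        trans (cong mate′ (elsewhere v≢l v≢s))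
          (trans (elsewhere (l≢m ∘ sym) (s≢m ∘ sym)) (mate² (rest Av v≢l v≢s) Zv))

    module _ (conn : Connected G) (wc : WellCovered G) where

      -- Repeatedly delete a leaf together with its support.
      peel : ∀ fuel {K A} → count A ℕ.≤ fuel → Remainder G wc K A →
        (∀ v → A v ≡ true → ∃[ w ] (A w ≡ true × v ~ w)) → (∃[ k ] count A ≡ dbl k) ⊎ Matched A
      peel fuel {K} {A} le rem ¬iso with leaf-or-cycle conn A
      ... | inj₁ empty = inj₁ (0 , trans (count-cong empty) (count-∅ n))
      ... | inj₂ (inj₁ A≐Z) = inj₂ (matched-cycle A≐Z)
      ... | inj₂ (inj₂ (l , Al , one)) with ¬iso l Al
      ...   | s , As , l~s = result fuel le
        where
        A′ : VSet n
        A′ = A ⊝ l ⊝ s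
        l≢s : l ≢ s
        l≢s eq = ~-irrefl eq l~s
        leaf : ∀ w → A w ≡ true → l ~ w → w ≡ s
        leaf w Aw l~w = one w s Aw As l~w l~s
        count-A : count A ≡ suc (suc (count A′))
        count-A = trans (count-⊝ A l Al) (cong suc (count-⊝ (A ⊝ l) s (⊝⁺ As l≢s)))
        open Remainder rem
        -- Within `A` the closed neighbourhood of `l` is just `l` and `s`, so deleting both amounts
        -- to adding `l` to the chosen independent set.
        rem′ : Remainder G wc (K ⊕ l) A′
        rem′ = record
          { independent = independent-⊕ G independent λ u Ku → apart Ku Al
          ; avoids = λ A′v → ≢true⇒false λ e → avoids′ A′v (⊕⁻ e)
          ; apart = λ Ku A′v u~v → apart′ (⊕⁻ Ku) A′v u~v
          ; covered = covered′
          }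
          where
          avoids′ : ∀ {v} → A′ v ≡ true → K v ≡ true ⊎ l ≡ v → ⊥
          avoids′ A′v (inj₁ Kv) = true≢false Kv (avoids (⊝-⊑ A l _ (⊝-⊑ (A ⊝ l) s _ A′v)))
          avoids′ A′v (inj₂ l≡v) = proj₂ (⊝⁻ (⊝-⊑ (A ⊝ l) s _ A′v)) l≡v
          apart′ : ∀ {u v} → K u ≡ true ⊎ l ≡ u → A′ v ≡ true → ¬ u ~ v
          apart′ (inj₁ Ku) A′v u~v = apart Ku (⊝-⊑ A l _ (⊝-⊑ (A ⊝ l) s _ A′v)) u~v
          apart′ {v = v} (inj₂ refl) A′v l~v =
            proj₂ (⊝⁻ A′v) (sym (leaf v (⊝-⊑ A l _ (⊝-⊑ (A ⊝ l) s _ A′v)) l~v))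
          covered′ : ∀ {v} → A′ v ≡ false → (K ⊕ l) v ≡ true ⊎ ∃[ u ] ((K ⊕ l) u ≡ true × u ~ v)
          covered′ {v} A′v with v Fin.≟ l | v Fin.≟ s
          ... | yes refl | _ = inj₁ (⊕⁺ʳ refl)
          ... | no _ | yes refl = inj₂ (l , ⊕⁺ʳ refl , l~s)
          ... | no v≢l | no v≢s with covered (≢true⇒false λ Av → true≢false (⊝⁺ (⊝⁺ Av (v≢l ∘ sym)) (v≢s ∘ sym)) A′v)
          ...   | inj₁ Kv = inj₁ (⊕⁺ˡ Kv)
          ...   | inj₂ (u , Ku , u~v) = inj₂ (u , ⊕⁺ˡ Ku , u~v)
        -- A vertex isolated by the deletion would have `s` as its only neighbour in `A` and be a
        -- second leaf at `s`, which `no-twin-leaves` excludes.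
        ¬iso′ : ∀ v → A′ v ≡ true → ∃[ w ] (A′ w ≡ true × v ~ w)
        ¬iso′ v A′v with Fin.any? (λ w → (A′ w 𝔹.≟ true) ×-dec (v ~? w))
        ... | yes found = found
        ... | no none with ⊝⁻ A′v
        ...   | e , s≢v with ⊝⁻ e
        ...   | Av , l≢v = ⊥-elim (no-twin-leaves G wc rem As Al Av l≢v (~-sym l~s) s~v leaf only-s)
          where
          only-s : ∀ w → A w ≡ true → v ~ w → w ≡ s
          only-s w Aw v~w with w Fin.≟ s | w Fin.≟ l
          ... | yes eq | _ = eq
          ... | no _ | yes refl = ⊥-elim (s≢v (sym (leaf v Av (~-sym v~w))))
          ... | no w≢s | no w≢l = ⊥-elim (none (w , ⊝⁺ (⊝⁺ Aw (w≢l ∘ sym)) (w≢s ∘ sym) , v~w))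
          s~v : s ~ v
          s~v = let w , Aw , v~w = ¬iso v Av in ~-sym (subst (v ~_) (only-s w Aw v~w) v~w)
        result : ∀ fuel → count A ℕ.≤ fuel → (∃[ k ] count A ≡ dbl k) ⊎ Matched A
        result zero le with () ← ℕ.≤-trans (ℕ.≤-reflexive (sym count-A)) le
        result (suc fuel) le with peel fuel (ℕ.≤-pred (ℕ.≤-trans (ℕ.≤-trans (ℕ.n≤1+n _) (ℕ.≤-reflexive (sym count-A))) le)) rem′ ¬iso′
        ... | inj₁ (k , eq) = inj₁ (suc k , trans count-A (cong (2 ℕ.+_) eq))
        ... | inj₂ M = inj₂ (matched-pair Al As l~s M)

      has-neighbour : ∀ v → ∃[ w ] v ~ w
      has-neighbour v with g 0 Fin.≟ v
      ... | no g0≢v = first (conn v (g 0)) g0≢v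
        where
        first : ∀ {x} → Star _~_ v x → x ≢ v → ∃[ w ] v ~ w
        first ε x≢v = ⊥-elim (x≢v refl)
        first (v~w ◅ _) _ = _ , v~w
      ... | yes refl = g 1 , adj (ℕ.s≤s (ℕ.s≤s ℕ.z≤n))

      -- Peeling deletes two vertices at a time and stops at the empty set or at the cycle; the
      -- former would make `n` even.
      matched : Odd n → Matched full
      matched odd with peel n {∅} {full} (ℕ.≤-reflexive (count-full n)) remainder
                         (λ v _ → let w , v~w = has-neighbour v in w , refl , v~w)
        where
        remainder : Remainder G wc ∅ full
        remainder = record
          { independent = λ _ _ () ; avoids = λ _ → refl ; apart = λ () ; covered = λ () }
      ... | inj₁ (k , eq) = ⊥-elim (odd⇒≢dbl odd k (trans (sym (count-full n)) eq))
      ... | inj₂ M = M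

      module _ (M : Matched full) where
        open Matched M using (mate; mate∈; v~mate; mate²)

        record Paired (W : VSet n) : Set where
          field
            pairs  : Pairs n
            W≡     : W ≡ extend cycle pairs
            growth : Growth G cycle pairs
            joined : Joined W
            closed : ∀ {v} → W v ≡ true → cycle v ≡ false → W (mate v) ≡ true

        -- The new vertex enters together with its mate, which is new because `W` is closed under
        -- `mate`. Uniqueness of neighbours is used twice: for `s` over `W` it gives the single
        -- attachment `p`, and for `l` over `W ⊕ s` it leaves `s` as the only neighbour.
        add-pair : ∀ {W v p} → Paired W → W v ≡ false → W p ≡ true → v ~ p →
          ∃[ W′ ] (Paired W′ × W ⊑ W′ × W′ v ≡ true)
        add-pair {W} {s} {p} record { pairs = ps ; W≡ = refl ; growth = gr ; joined = j ; closed = closed } Ws Wp s~p =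
          W ⊕ s ⊕ l , record
            { pairs = (s , l) ∷ ps ; W≡ = refl
            ; growth = grow gr Ws Wl s~l leaf Wp s~p
                (λ w Ww s~w → unique-neighbour G unicyclic (⊒cycle j) (connected j) Ws Ww Wp s~w s~p)
            ; joined = j″ ; closed = λ Wv Zv → closed′ (⊕⁻ Wv) Zv }
          , (λ _ e → ⊕⁺ˡ (⊕⁺ˡ e)) , ⊕⁺ˡ (⊕⁺ʳ refl)
          where
          open Joined
          l : Fin n
          l = mate s
          Zs : cycle s ≡ false
          Zs = ≢true⇒false λ e → true≢false (⊒cycle j s e) Ws
          s~l : s ~ l
          s~l = v~mate refl Zs
          mate-l : mate l ≡ s
          mate-l = mate² refl Zs
          Wl : W l ≡ false
          Wl = ≢true⇒false λ e →
            true≢false (subst (λ x → W x ≡ true) mate-l (closed e (proj₂ (mate∈ {s} refl Zs)))) Ws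
          j′ : Joined (W ⊕ s)
          j′ = joined-⊕ j Wp s~p
          j″ : Joined (W ⊕ s ⊕ l)
          j″ = joined-⊕ j′ (⊕⁺ʳ refl) (~-sym s~l)
          W⊕s-l : (W ⊕ s) l ≡ false
          W⊕s-l = ≢true⇒false λ e → out (⊕⁻ e)
            where
            out : W l ≡ true ⊎ s ≡ l → ⊥
            out (inj₁ e)  = true≢false e Wl
            out (inj₂ eq) = ~-irrefl eq s~l
          leaf : ∀ w → W w ≡ true → ¬ l ~ w
          leaf w Ww l~w = true≢false (subst (λ x → W x ≡ true)
            (unique-neighbour G unicyclic (⊒cycle j′) (connected j′) W⊕s-l (⊕⁺ˡ Ww) (⊕⁺ʳ refl) l~w (~-sym s~l)) Ww) Ws
          closed′ : ∀ {v} → (W ⊕ s) v ≡ true ⊎ l ≡ v → cycle v ≡ false → (W ⊕ s ⊕ l) (mate v) ≡ true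
          closed′ (inj₂ refl) _ = ⊕⁺ˡ (⊕⁺ʳ (sym mate-l))
          closed′ (inj₁ e) Zv with ⊕⁻ e
          ... | inj₁ Wv   = ⊕⁺ˡ (⊕⁺ˡ (closed Wv Zv))
          ... | inj₂ refl = ⊕⁺ʳ refl

        paired : ∃[ W ] (Paired W × (∀ x → W x ≡ true))
        paired = exhaust add-pair conn start g0∈cycle
          where
          start : Paired cycle
          start = record { pairs = [] ; W≡ = refl ; growth = [] ; joined = joined-cycle
            ; closed = λ Zv Zv′ → ⊥-elim (true≢false Zv Zv′) }

  count-cycle : ∀ {L} (C : ChordlessCycle G L) → count (ChordlessCycle.cycle C) ≡ L
  count-cycle {L} C = go L ℕ.≤-refl
    where
    open ChordlessCycle C
    go : ∀ j → j ℕ.≤ L → count (segment g 0 j) ≡ j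
    go zero    _   = count-∅ n
    go (suc j) j<L = trans (count-⊕ (segment g 0 j) (g j) (≢true⇒false λ e →
        let k , k<j , eq = segment⁻ 0 j e in ℕ.<⇒≢ k<j (inj (ℕ.<-trans k<j j<L) j<L eq)))
      (cong suc (go j (ℕ.<⇒≤ j<L)))

  count-growth : ∀ {Z ps} → Growth G Z ps → count (extend Z ps) ≡ dbl (length ps) ℕ.+ count Z
  count-growth [] = refl
  count-growth {Z} {(s , l) ∷ ps} (grow gr Ws Wl s~l _ _ _ _) =
    trans (count-⊕ (extend Z ps ⊕ s) l (≢true⇒false λ e → out (⊕⁻ e)))
      (cong suc (trans (count-⊕ (extend Z ps) s Ws) (cong suc (count-growth gr))))
    where
    out : extend Z ps l ≡ true ⊎ s ≡ l → ⊥
    out (inj₁ e)  = true≢false e Wl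
    out (inj₂ eq) = ~-irrefl eq s~l

record Decomposition {n : ℕ} (G : Graph n) : Set where
  field
    r      : ℕ
    pairs  : Pairs n
    C      : ChordlessCycle G (suc (dbl (suc r)))
    growth : Growth G (ChordlessCycle.cycle C) pairs
    all    : ∀ x → extend (ChordlessCycle.cycle C) pairs x ≡ true
    order  : n ≡ suc (dbl (suc (length pairs ℕ.+ r)))

decompose : ∀ {n} → Odd n → (G : Graph n) → Connected G → WellCovered G → Unicyclic G → Decomposition G
decompose {n} odd G conn wc unicyclic@(C , _)
  with paired G unicyclic conn wc (matched G unicyclic conn wc odd)
... | W , record { pairs = ps ; W≡ = refl ; growth = gr } , all = build (parity (Cycle.len C)) (chordlessCycle G unicyclic) gr all
  where
  -- The length is generalised to `m`, so that its parity can be substituted in the cycle and in the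
  -- growth at once; an odd `m` would make `n` even.
  build : ∀ {m} → (∃[ k ] m ≡ dbl k) ⊎ (∃[ k ] m ≡ suc (dbl k)) → (C′ : ChordlessCycle G (3 ℕ.+ m)) →
    Growth G (ChordlessCycle.cycle C′) ps → (∀ x → extend (ChordlessCycle.cycle C′) ps x ≡ true) → Decomposition G
  build {m} par C′ gr all = case par
    where
    n≡ : n ≡ dbl (length ps) ℕ.+ (3 ℕ.+ m)
    n≡ = begin
      n                                                ≡⟨ count-full n ⟨
      count (full {n})                                 ≡⟨ count-cong (λ x → sym (all x)) ⟩
      count (extend (ChordlessCycle.cycle C′) ps)      ≡⟨ count-growth G gr ⟩
      dbl (length ps) ℕ.+ count (ChordlessCycle.cycle C′) ≡⟨ cong (dbl (length ps) ℕ.+_) (count-cycle G C′) ⟩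
      dbl (length ps) ℕ.+ (3 ℕ.+ m)                    ∎
      where open ≡-Reasoning
    case : (∃[ k ] m ≡ dbl k) ⊎ (∃[ k ] m ≡ suc (dbl k)) → Decomposition G
    case (inj₂ (k , refl)) = ⊥-elim (odd⇒≢dbl odd (length ps ℕ.+ suc (suc k))
      (trans n≡ (sym (dbl-+ (length ps) (suc (suc k))))))
    case (inj₁ (r , refl)) = record
      { r = r ; pairs = ps ; C = C′ ; growth = gr ; all = all
      ; order = begin
          n                                      ≡⟨ n≡ ⟩
          dbl (length ps) ℕ.+ (3 ℕ.+ dbl r)      ≡⟨ ℕ.+-comm (dbl (length ps)) (3 ℕ.+ dbl r) ⟩
          3 ℕ.+ (dbl r ℕ.+ dbl (length ps))      ≡⟨ cong (3 ℕ.+_) (ℕ.+-comm (dbl r) (dbl (length ps))) ⟩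
          3 ℕ.+ (dbl (length ps) ℕ.+ dbl r)      ≡⟨ cong (3 ℕ.+_) (dbl-+ (length ps) r) ⟨
          3 ℕ.+ dbl (length ps ℕ.+ r)            ∎ }
      where open ≡-Reasoning

-- The polynomial of Mₙ

module _ {k : ℕ} where
  embed : MVertex k → Fin (3 ℕ.+ k ℕ.* 2)
  embed (inj₁ a)       = a ↑ˡ (k ℕ.* 2)
  embed (inj₂ (j , s)) = 3 ↑ʳ combine j s

  Mview-embed : ∀ x → Mview k (embed x) ≡ x
  Mview-embed (inj₁ a) rewrite Fin.splitAt-↑ˡ 3 a (k ℕ.* 2) = refl
  Mview-embed (inj₂ (j , s)) rewrite Fin.splitAt-↑ʳ 3 (k ℕ.* 2) (combine j s) =
    cong inj₂ (Fin.remQuot-combine j s)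

  embed-Mview : ∀ w → embed (Mview k w) ≡ w
  embed-Mview w with splitAt 3 w in eq
  ... | inj₁ a = Fin.splitAt⁻¹-↑ˡ eq
  ... | inj₂ b = trans (cong (3 ↑ʳ_) (Fin.combine-remQuot {k} 2 b)) (Fin.splitAt⁻¹-↑ʳ eq)

  embed-unique : ∀ {w x} → Mview k w ≡ x → embed x ≡ w
  embed-unique refl = embed-Mview _

module TrianglePolynomial (k : ℕ) (t : ℚ) where
  private
    T : Graph (3 ℕ.+ k ℕ.* 2)
    T = triangleWithK₂s k

  open Graph T
  open Polynomial T t

  abstract
    setOf : {S : MVertex k → Set} → (∀ x → Dec (S x)) → VSet (3 ℕ.+ k ℕ.* 2)
    setOf S? w = does (S? (Mview k w))

    setOf⁻ : ∀ {S : MVertex k → Set} (S? : ∀ x → Dec (S x)) {w} → setOf S? w ≡ true → S (Mview k w)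
    setOf⁻ S? {w} e with yes s ← S? (Mview k w) = s

    setOf⁺ : ∀ {S : MVertex k → Set} (S? : ∀ x → Dec (S x)) {w} → S (Mview k w) → setOf S? w ≡ true
    setOf⁺ S? {w} s with S? (Mview k w)
    ... | yes _ = refl
    ... | no ¬s = ⊥-elim (¬s s)

  setOf-embed : ∀ {S : MVertex k → Set} (S? : ∀ x → Dec (S x)) {x} → S x → setOf S? (embed x) ≡ true
  setOf-embed {S} S? {x} s = setOf⁺ S? (subst S (sym (Mview-embed x)) s)

  adjacent⁻ : ∀ x w → embed x ~ w → MAdj x (Mview k w)
  adjacent⁻ x w = subst (λ y → MAdj y (Mview k w)) (Mview-embed x)

  adjacent⁺ : ∀ x w → MAdj x (Mview k w) → embed x ~ w
  adjacent⁺ x w = subst (λ y → MAdj y (Mview k w)) (sym (Mview-embed x))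

  edge : ∀ x y → MAdj x y → embed x ~ embed y
  edge x y adj = adjacent⁺ x (embed y) (subst (MAdj x) (sym (Mview-embed y)) adj)

  Copy Leaf : ℕ → MVertex k → Set
  Copy j (inj₁ _)       = ⊥
  Copy j (inj₂ (i , _)) = toℕ i ℕ.< j
  Leaf j (inj₁ _)       = ⊥
  Leaf j (inj₂ (i , s)) = toℕ i ℕ.< j × s ≡ 1F

  Copy? : ∀ j x → Dec (Copy j x)
  Copy? j (inj₁ _)       = no λ ()
  Copy? j (inj₂ (i , _)) = toℕ i ℕ.<? j

  Leaf? : ∀ j x → Dec (Leaf j x)
  Leaf? j (inj₁ _)       = no λ ()
  Leaf? j (inj₂ (i , s)) = (toℕ i ℕ.<? j) ×-dec (s Fin.≟ 1F)

  private
    split-< : ∀ {j} (j<k : j ℕ.< k) (i : Fin k) → toℕ i ℕ.< suc j → toℕ i ℕ.< j ⊎ i ≡ Fin.fromℕ< j<k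
    split-< j<k i lt with ℕ.m≤n⇒m<n∨m≡n (ℕ.≤-pred lt)
    ... | inj₁ i<j = inj₁ i<j
    ... | inj₂ eq  = inj₂ (Fin.toℕ-injective (trans eq (sym (Fin.toℕ-fromℕ< j<k))))

    other : ∀ {s : Fin 2} → 0F ≢ s → s ≡ 1F
    other {0F} ne = ⊥-elim (ne refl)
    other {1F} ne = refl

    other′ : ∀ {s : Fin 2} → 1F ≢ s → s ≡ 0F
    other′ {0F} ne = refl
    other′ {1F} ne = ⊥-elim (ne refl)

  P-copies : ∀ j → j ℕ.≤ k → P (setOf (Copy? j)) ≡ v ^ j
  P-copies zero _ = Q-empty (allFin _) λ w → ≢true⇒false λ e → none (Mview k w) (setOf⁻ (Copy? 0) e)
    where
    none : ∀ x → ¬ Copy 0 x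
    none (inj₂ _) ()
  P-copies (suc j) j<k = trans
    (P-K₂ (setOf-embed (Copy? (suc j)) jj) (setOf-embed (Copy? (suc j)) jj) (edge a b (refl , λ ())) only-b only-a)
    (cong (v *_) (trans (P-cong (≐-by to from)) (P-copies j (ℕ.<⇒≤ j<k))))
    where
    J : Fin k
    J = Fin.fromℕ< j<k
    a b : MVertex k
    a = inj₂ (J , 0F)
    b = inj₂ (J , 1F)
    jj : toℕ J ℕ.< suc j
    jj = ℕ.s≤s (ℕ.≤-reflexive (Fin.toℕ-fromℕ< j<k))
    only-b : ∀ w → setOf (Copy? (suc j)) w ≡ true → embed a ~ w → w ≡ embed b
    only-b w e a~w = go (Mview k w) refl (setOf⁻ (Copy? (suc j)) e) (adjacent⁻ a w a~w)
      where
      go : ∀ x → Mview k w ≡ x → Copy (suc j) x → MAdj a x → w ≡ embed b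
      go (inj₂ (i , s)) eq _ (refl , ne) with refl ← other ne = sym (embed-unique eq)
    only-a : ∀ w → setOf (Copy? (suc j)) w ≡ true → embed b ~ w → w ≡ embed a
    only-a w e b~w = go (Mview k w) refl (setOf⁻ (Copy? (suc j)) e) (adjacent⁻ b w b~w)
      where
      go : ∀ x → Mview k w ≡ x → Copy (suc j) x → MAdj b x → w ≡ embed a
      go (inj₂ (i , s)) eq _ (refl , ne) with refl ← other′ ne = sym (embed-unique eq)
    to : setOf (Copy? (suc j)) ⊝ embed a ⊝ embed b ⊑ setOf (Copy? j)
    to w e with ⊝⁻ e
    ... | e₁ , b≢w with ⊝⁻ e₁
    ... | e₂ , a≢w = setOf⁺ (Copy? j) (go (Mview k w) refl (setOf⁻ (Copy? (suc j)) e₂))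
      where
      go : ∀ x → Mview k w ≡ x → Copy (suc j) x → Copy j x
      go (inj₂ (i , s)) eq lt with split-< j<k i lt
      ... | inj₁ i<j = i<j
      go (inj₂ (i , 0F)) eq lt | inj₂ refl = ⊥-elim (a≢w (embed-unique eq))
      go (inj₂ (i , 1F)) eq lt | inj₂ refl = ⊥-elim (b≢w (embed-unique eq))
    from : setOf (Copy? j) ⊑ setOf (Copy? (suc j)) ⊝ embed a ⊝ embed b
    from w e = ⊝⁺ (⊝⁺ (setOf⁺ (Copy? (suc j)) (weaken (Mview k w) (setOf⁻ (Copy? j) e)))
        (differs 0F)) (differs 1F)
      where
      weaken : ∀ x → Copy j x → Copy (suc j) x
      weaken (inj₂ _) lt = ℕ.m<n⇒m<1+n lt
      differs : ∀ s → embed (inj₂ (J , s)) ≢ w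
      differs s refl = ℕ.<⇒≢ (subst (Copy j) (Mview-embed (inj₂ (J , s))) (setOf⁻ (Copy? j) e)) (Fin.toℕ-fromℕ< j<k)

  P-leaves : ∀ j → j ℕ.≤ k → P (setOf (Leaf? j)) ≡ u ^ j
  P-leaves zero _ = Q-empty (allFin _) λ w → ≢true⇒false λ e → none (Mview k w) (setOf⁻ (Leaf? 0) e)
    where
    none : ∀ x → ¬ Leaf 0 x
    none (inj₂ _) (() , _)
  P-leaves (suc j) j<k = trans
    (P-isolated (embed b) (setOf-embed (Leaf? (suc j)) (jj , refl)) isolated)
    (cong (u *_) (trans (P-cong (≐-by to from)) (P-leaves j (ℕ.<⇒≤ j<k))))
    where
    J : Fin k
    J = Fin.fromℕ< j<k
    b : MVertex k
    b = inj₂ (J , 1F)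
    jj : toℕ J ℕ.< suc j
    jj = ℕ.s≤s (ℕ.≤-reflexive (Fin.toℕ-fromℕ< j<k))
    isolated : ∀ w → setOf (Leaf? (suc j)) w ≡ true → ¬ embed b ~ w
    isolated w e b~w = go (Mview k w) (setOf⁻ (Leaf? (suc j)) e) (adjacent⁻ b w b~w)
      where
      go : ∀ x → Leaf (suc j) x → ¬ MAdj b x
      go (inj₂ (i , s)) (_ , refl) (_ , ne) = ne refl
    to : setOf (Leaf? (suc j)) ⊝ embed b ⊑ setOf (Leaf? j)
    to w e with ⊝⁻ e
    ... | e₁ , b≢w = setOf⁺ (Leaf? j) (go (Mview k w) refl (setOf⁻ (Leaf? (suc j)) e₁))
      where
      go : ∀ x → Mview k w ≡ x → Leaf (suc j) x → Leaf j x
      go (inj₂ (i , s)) eq (lt , refl) with split-< j<k i lt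
      ... | inj₁ i<j = i<j , refl
      ... | inj₂ refl = ⊥-elim (b≢w (embed-unique eq))
    from : setOf (Leaf? j) ⊑ setOf (Leaf? (suc j)) ⊝ embed b
    from w e = ⊝⁺ (setOf⁺ (Leaf? (suc j)) (weaken (Mview k w) (setOf⁻ (Leaf? j) e))) differs
      where
      weaken : ∀ x → Leaf j x → Leaf (suc j) x
      weaken (inj₂ _) (lt , eq) = ℕ.m<n⇒m<1+n lt , eq
      differs : embed b ≢ w
      differs refl = ℕ.<⇒≢ (proj₁ (subst (Leaf j) (Mview-embed b) (setOf⁻ (Leaf? j) e))) (Fin.toℕ-fromℕ< j<k)

  -- Deleting the distinguished vertex leaves k + 1 disjoint edges, the extra one coming from the
  -- triangle; deleting its closed neighbourhood leaves the k outer ends of the copies.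
  P-triangleWithK₂s : P full ≡ v ^ suc k - t * u ^ k
  P-triangleWithK₂s = trans (P-delete c refl) (cong₂ (λ p q → p - t * q)
    (trans (P-K₂ (in-rest x₁ λ ()) (in-rest x₂ λ ()) (edge x₁ x₂ λ ()) only-2 only-1)
      (cong (v *_) (trans (P-cong (≐-by toᶜ fromᶜ)) (P-copies k ℕ.≤-refl))))
    (trans (P-cong (≐-by toˡ fromˡ)) (P-leaves k ℕ.≤-refl)))
    where
    x₀ x₁ x₂ : MVertex k
    x₀ = inj₁ 0F
    x₁ = inj₁ 1F
    x₂ = inj₁ 2F
    c : Fin (3 ℕ.+ k ℕ.* 2)
    c = embed x₀
    apart : ∀ {x w} → Mview k w ≢ x → embed x ≢ w
    apart {x} ne refl = ne (Mview-embed x)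
    in-rest : ∀ x → x ≢ x₀ → (full ⊝ c) (embed x) ≡ true
    in-rest x ne = ⊝⁺ refl (apart λ eq → ne (trans (sym (Mview-embed x)) eq))
    only-2 : ∀ w → (full ⊝ c) w ≡ true → embed x₁ ~ w → w ≡ embed x₂
    only-2 w e x₁~w with Mview k w in eq | adjacent⁻ x₁ w x₁~w
    ... | inj₁ 0F | _ = ⊥-elim (proj₂ (⊝⁻ e) (embed-unique eq))
    ... | inj₁ 1F | ne = ⊥-elim (ne refl)
    ... | inj₁ 2F | _ = sym (embed-unique eq)
    ... | inj₂ _ | () , _
    only-1 : ∀ w → (full ⊝ c) w ≡ true → embed x₂ ~ w → w ≡ embed x₁
    only-1 w e x₂~w with Mview k w in eq | adjacent⁻ x₂ w x₂~w
    ... | inj₁ 0F | _ = ⊥-elim (proj₂ (⊝⁻ e) (embed-unique eq))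
    ... | inj₁ 1F | _ = sym (embed-unique eq)
    ... | inj₁ 2F | ne = ⊥-elim (ne refl)
    ... | inj₂ _ | () , _
    toᶜ : full ⊝ c ⊝ embed x₁ ⊝ embed x₂ ⊑ setOf (Copy? k)
    toᶜ w e with ⊝⁻ e
    ... | e₁ , x₂≢w with ⊝⁻ e₁
    ... | e₂ , x₁≢w with ⊝⁻ e₂
    ... | _ , x₀≢w = setOf⁺ (Copy? k) (go (Mview k w) refl)
      where
      go : ∀ x → Mview k w ≡ x → Copy k x
      go (inj₁ 0F) eq = ⊥-elim (x₀≢w (embed-unique eq))
      go (inj₁ 1F) eq = ⊥-elim (x₁≢w (embed-unique eq))
      go (inj₁ 2F) eq = ⊥-elim (x₂≢w (embed-unique eq))
      go (inj₂ (i , _)) eq = Fin.toℕ<n i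
    fromᶜ : setOf (Copy? k) ⊑ full ⊝ c ⊝ embed x₁ ⊝ embed x₂
    fromᶜ w e = ⊝⁺ (⊝⁺ (⊝⁺ refl (apart (off 0F))) (apart (off 1F))) (apart (off 2F))
      where
      off : ∀ a → Mview k w ≢ inj₁ a
      off a eq = subst (Copy k) eq (setOf⁻ (Copy? k) e)
    toˡ : full ⊝N c ⊝ c ⊑ setOf (Leaf? k)
    toˡ w e with ⊝⁻ e
    ... | e₁ , c≢w = setOf⁺ (Leaf? k) (go (Mview k w) refl (λ adj → proj₂ (⊝N⁻ e₁) (adjacent⁺ x₀ w adj)))
      where
      go : ∀ x → Mview k w ≡ x → ¬ MAdj x₀ x → Leaf k x
      go (inj₁ 0F) eq _ = ⊥-elim (c≢w (embed-unique eq))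
      go (inj₁ 1F) eq nadj = ⊥-elim (nadj λ ())
      go (inj₁ 2F) eq nadj = ⊥-elim (nadj λ ())
      go (inj₂ (i , 0F)) eq nadj = ⊥-elim (nadj (refl , refl))
      go (inj₂ (i , 1F)) eq nadj = Fin.toℕ<n i , refl
    fromˡ : setOf (Leaf? k) ⊑ full ⊝N c ⊝ c
    fromˡ w e = ⊝⁺ (⊝N⁺ refl λ c~w → nadj (Mview k w) (setOf⁻ (Leaf? k) e) (adjacent⁻ x₀ w c~w))
      (apart λ eq → subst (Leaf k) eq (setOf⁻ (Leaf? k) e))
      where
      nadj : ∀ x → Leaf k x → ¬ MAdj x₀ x
      nadj (inj₂ (i , s)) (_ , refl) (_ , ())

-- The independence polynomial as a sum over subsets

ι : ℕ → ℚ
ι c = ℤ.+ c ℚ./ 1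

ι-suc : ∀ c → ι (suc c) ≡ 1ℚ + ι c
ι-suc c = ℚ.toℚᵘ-injective (begin
  ℚ.toℚᵘ (ι (suc c))                   ≈⟨ ℚ.toℚᵘ-fromℚᵘ (mkℚᵘ (ℤ.+ suc c) 0) ⟩
  mkℚᵘ (ℤ.+ suc c) 0                     ≈⟨ ℚᵘ.*≡* (cong (λ m → (ℤ.+ 1 ℤ.+ m) ℤ.* ℤ.+ 1) (sym (ℤ.*-identityʳ (ℤ.+ c)))) ⟩
  mkℚᵘ (ℤ.+ 1) 0 ℚᵘ.+ mkℚᵘ (ℤ.+ c) 0       ≈⟨ ℚᵘ.+-congʳ (mkℚᵘ (ℤ.+ 1) 0) (ℚ.toℚᵘ-fromℚᵘ (mkℚᵘ (ℤ.+ c) 0)) ⟨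
  ℚ.toℚᵘ 1ℚ ℚᵘ.+ ℚ.toℚᵘ (ι c)          ≈⟨ ℚ.toℚᵘ-homo-+ 1ℚ (ι c) ⟨
  ℚ.toℚᵘ (1ℚ + ι c)                    ∎)
  where
  open ℚᵘ.≃-Reasoning

sumTo : ℕ → (ℕ → ℚ) → ℚ
sumTo zero    h = 0ℚ
sumTo (suc N) h = h 0 + sumTo N (h ∘ suc)

foldr-upTo : ∀ (h : ℕ → ℚ) f N → foldr _+_ 0ℚ (map h (applyUpTo f N)) ≡ sumTo N (h ∘ f)
foldr-upTo h f zero    = refl
foldr-upTo h f (suc N) = cong (h (f 0) +_) (foldr-upTo h (f ∘ suc) N)

sumTo-cong : ∀ N {h h′} → (∀ k → h k ≡ h′ k) → sumTo N h ≡ sumTo N h′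
sumTo-cong zero    eq = refl
sumTo-cong (suc N) eq = cong₂ _+_ (eq 0) (sumTo-cong N (eq ∘ suc))

sumTo-0 : ∀ N → sumTo N (λ _ → 0ℚ) ≡ 0ℚ
sumTo-0 zero    = refl
sumTo-0 (suc N) = trans (ℚ.+-identityˡ _) (sumTo-0 N)

sumTo-+ : ∀ N h h′ → sumTo N (λ k → h k + h′ k) ≡ sumTo N h + sumTo N h′
sumTo-+ zero    h h′ = refl
sumTo-+ (suc N) h h′ = trans (cong (h 0 + h′ 0 +_) (sumTo-+ N (h ∘ suc) (h′ ∘ suc)))
  (solve 4 (λ a b c d → (a :+ b) :+ (c :+ d) := (a :+ c) :+ (b :+ d)) refl
    (h 0) (h′ 0) (sumTo N (h ∘ suc)) (sumTo N (h′ ∘ suc)))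
  where open +-*-Solver

indicator : Bool → ℚ
indicator b = if b then 1ℚ else 0ℚ

sumTo-indicator : ∀ N b j (h : ℕ → ℚ) → j ℕ.< N →
  sumTo N (λ k → indicator (b ∧ does (j ℕ.≟ k)) * h k) ≡ indicator b * h j
sumTo-indicator (suc N) b zero h _ = begin
  indicator (b ∧ true) * h 0 + sumTo N (λ k → indicator (b ∧ false) * h (suc k))
    ≡⟨ cong₂ (λ p q → indicator p * h 0 + q) (𝔹.∧-identityʳ b) (trans (sumTo-cong N λ k →
         trans (cong (λ p → indicator p * h (suc k)) (𝔹.∧-zeroʳ b)) (ℚ.*-zeroˡ (h (suc k)))) (sumTo-0 N)) ⟩
  indicator b * h 0 + 0ℚ   ≡⟨ ℚ.+-identityʳ _ ⟩
  indicator b * h 0        ∎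
  where open ≡-Reasoning
sumTo-indicator (suc N) b (suc j) h (ℕ.s≤s j<N) = begin
  indicator (b ∧ false) * h 0 + sumTo N (λ k → indicator (b ∧ does (j ℕ.≟ k)) * h (suc k))
    ≡⟨ cong₂ _+_ (trans (cong (λ p → indicator p * h 0) (𝔹.∧-zeroʳ b)) (ℚ.*-zeroˡ (h 0))) (sumTo-indicator N b j (h ∘ suc) j<N) ⟩
  0ℚ + indicator b * h (suc j)   ≡⟨ ℚ.+-identityˡ _ ⟩
  indicator b * h (suc j)        ∎
  where open ≡-Reasoning

ι-filter : ∀ {A : Set} {P : A → Set} (P? : ∀ x → Dec (P x)) x xs →
  ι (length (filter P? (x ∷ xs))) ≡ indicator (does (P? x)) + ι (length (filter P? xs))
ι-filter P? x xs with does (P? x)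
... | true  = ι-suc (length (filter P? xs))
... | false = sym (ℚ.+-identityˡ _)

total : ∀ {A : Set} → (A → ℚ) → List A → ℚ
total h []       = 0ℚ
total h (x ∷ xs) = h x + total h xs

total-++ : ∀ {A : Set} (h : A → ℚ) xs ys → total h (xs ++ ys) ≡ total h xs + total h ys
total-++ h []       ys = sym (ℚ.+-identityˡ _)
total-++ h (x ∷ xs) ys = trans (cong (h x +_) (total-++ h xs ys)) (sym (ℚ.+-assoc (h x) _ _))

total-map : ∀ {A B : Set} (h : B → ℚ) (f : A → B) xs → total h (map f xs) ≡ total (h ∘ f) xs
total-map h f []       = refl
total-map h f (x ∷ xs) = cong (h (f x) +_) (total-map h f xs)

total-cong : ∀ {A : Set} {h h′ : A → ℚ} → (∀ x → h x ≡ h′ x) → ∀ xs → total h xs ≡ total h′ xs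
total-cong eq []       = refl
total-cong eq (x ∷ xs) = cong₂ _+_ (eq x) (total-cong eq xs)

total-* : ∀ {A : Set} c (h : A → ℚ) xs → total (λ x → c * h x) xs ≡ c * total h xs
total-* c h []       = sym (ℚ.*-zeroʳ c)
total-* c h (x ∷ xs) = trans (cong (c * h x +_) (total-* c h xs)) (sym (ℚ.*-distribˡ-+ c (h x) (total h xs)))

total-0 : ∀ {A : Set} (xs : List A) → total (λ _ → 0ℚ) xs ≡ 0ℚ
total-0 []       = refl
total-0 (x ∷ xs) = trans (ℚ.+-identityˡ _) (total-0 xs)

module _ {n : ℕ} (G : Graph n) where
  open Graph G

  abstract
    value : ℚ → ℚ
    value q = foldr _+_ 0ℚ (map (λ k → ι (indepCount G k) * q ^ k) (upTo (suc n)))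

    value-unfold : ∀ q → value q ≡ foldr _+_ 0ℚ (map (λ k → ι (indepCount G k) * q ^ k) (upTo (suc n)))
    value-unfold q = refl

  -- Addition and multiplication of reals act term by term, so every question about `I G x` becomes
  -- one about `value` at rational arguments.
  seq-I : ∀ x m → seq (I G x) m ≡ value (seq x m)
  seq-I x m = trans (go (upTo (suc n))) (sym (value-unfold (seq x m)))
    where
    power : ∀ k → seq (x ^ᴿ k) m ≡ seq x m ^ k
    power zero    = refl
    power (suc k) = cong (seq x m *_) (power k)
    go : ∀ ks → seq (foldr _+ᴿ_ 0ᴿ (map (λ k → fromℕᴿ (indepCount G k) *ᴿ x ^ᴿ k) ks)) m ≡
                foldr _+_ 0ℚ (map (λ k → ι (indepCount G k) * seq x m ^ k) ks)
    go []       = refl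
    go (k ∷ ks) = cong₂ (λ a b → ι (indepCount G k) * a + b) (power k) (go ks)

  module _ (q : ℚ) where
    private
      weight : Subset n → ℚ
      weight S = indicator (does (independent? G S)) * q ^ ∣ S ∣

      counted : ∀ k (S : Subset n) → Dec (Independent G S × ∣ S ∣ ≡ k)
      counted k S = independent? G S ×-dec (∣ S ∣ ℕ.≟ k)

      -- Interchange of summation: each set contributes to the single summand whose index is its
      -- size, and that index is within range because a subset has at most `n` elements.
      by-size : ∀ Ss → sumTo (suc n) (λ k → ι (length (filter (counted k) Ss)) * q ^ k) ≡ total weight Ss
      by-size []       = trans (sumTo-cong (suc n) λ k → ℚ.*-zeroˡ (q ^ k)) (sumTo-0 (suc n))
      by-size (S ∷ Ss) = begin
        sumTo (suc n) (λ k → ι (length (filter (counted k) (S ∷ Ss))) * q ^ k)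
          ≡⟨ sumTo-cong (suc n) (λ k → trans (cong (_* q ^ k) (ι-filter (counted k) S Ss))
               (ℚ.*-distribʳ-+ (q ^ k) (indicator (does (counted k S))) (ι (length (filter (counted k) Ss))))) ⟩
        sumTo (suc n) (λ k → indicator (does (counted k S)) * q ^ k + ι (length (filter (counted k) Ss)) * q ^ k)
          ≡⟨ sumTo-+ (suc n) (λ k → indicator (does (counted k S)) * q ^ k) (λ k → ι (length (filter (counted k) Ss)) * q ^ k) ⟩
        sumTo (suc n) (λ k → indicator (does (counted k S)) * q ^ k) +
        sumTo (suc n) (λ k → ι (length (filter (counted k) Ss)) * q ^ k)
          ≡⟨ cong₂ _+_ (sumTo-indicator (suc n) (does (independent? G S)) ∣ S ∣ (q ^_) (ℕ.s≤s (Subset.∣p∣≤n S))) (by-size Ss) ⟩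
        weight S + total weight Ss ∎
        where open ≡-Reasoning

    open Polynomial G (- q)

    private
      -- Tests whether the image of `S` under `f` is an independent subset of `A`, with the
      -- recursion of `Q`: a chosen vertex removes its neighbours from `A`. The embedding `f` lets
      -- the induction pass to the remaining vertices.
      admits : ∀ {m} → (Fin m → Fin n) → VSet n → Subset m → Bool
      admits f A []          = true
      admits f A (false ∷ S) = admits (f ∘ suc) A S
      admits f A (true  ∷ S) = A (f zero) ∧ admits (f ∘ suc) (A ⊝N f zero) S

      admits⁻ : ∀ {m} (f : Fin m → Fin n) A S → admits f A S ≡ true →
        (∀ i → i ∈ˢ S → A (f i) ≡ true) × (∀ i j → i ∈ˢ S → j ∈ˢ S → ¬ f i ~ f j)
      admits⁻ f A []          _ = (λ _ ()) , λ _ _ ()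
      admits⁻ f A (false ∷ S) e = let inA , ind = admits⁻ (f ∘ suc) A S e in
        (λ { (suc i) (there i∈) → inA i i∈ }) ,
        λ { (suc i) (suc j) (there i∈) (there j∈) → ind i j i∈ j∈ }
      admits⁻ f A (true ∷ S) e =
        let A0 , e′ = ∧-true e ; inA , ind = admits⁻ (f ∘ suc) (A ⊝N f zero) S e′ in
        (λ { zero here → A0 ; (suc i) (there i∈) → proj₁ (⊝N⁻ (inA i i∈)) }) ,
        λ { zero    zero    _          _          → ~-irrefl refl
          ; zero    (suc j) _          (there j∈) → proj₂ (⊝N⁻ (inA j j∈))
          ; (suc i) zero    (there i∈) _          → proj₂ (⊝N⁻ (inA i i∈)) ∘ ~-sym
          ; (suc i) (suc j) (there i∈) (there j∈) → ind i j i∈ j∈ }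

      admits⁺ : ∀ {m} (f : Fin m → Fin n) A S → (∀ i → i ∈ˢ S → A (f i) ≡ true) →
        (∀ i j → i ∈ˢ S → j ∈ˢ S → ¬ f i ~ f j) → admits f A S ≡ true
      admits⁺ f A []          inA ind = refl
      admits⁺ f A (false ∷ S) inA ind = admits⁺ (f ∘ suc) A S (λ i i∈ → inA (suc i) (there i∈))
        λ i j i∈ j∈ → ind (suc i) (suc j) (there i∈) (there j∈)
      admits⁺ f A (true ∷ S) inA ind rewrite inA zero here = admits⁺ (f ∘ suc) (A ⊝N f zero) S
        (λ i i∈ → ⊝N⁺ (inA (suc i) (there i∈)) (ind zero (suc i) here (there i∈)))
        λ i j i∈ j∈ → ind (suc i) (suc j) (there i∈) (there j∈)

      total-admits : ∀ m (f : Fin m → Fin n) A →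
        total (λ S → indicator (admits f A S) * q ^ ∣ S ∣) (subsets m) ≡ Q (tabulate f) A
      total-admits zero    f A = refl
      total-admits (suc m) f A = begin
        total w (map (false ∷_) (subsets m) ++ map (true ∷_) (subsets m))
          ≡⟨ total-++ w (map (false ∷_) (subsets m)) (map (true ∷_) (subsets m)) ⟩
        total w (map (false ∷_) (subsets m)) + total w (map (true ∷_) (subsets m))
          ≡⟨ cong₂ _+_ (trans (total-map w (false ∷_) (subsets m)) (total-admits m (f ∘ suc) A))
               (total-map w (true ∷_) (subsets m)) ⟩
        Q vs A + total (λ S → indicator (A (f zero) ∧ admits (f ∘ suc) (A ⊝N f zero) S) * (q * q ^ ∣ S ∣)) (subsets m)
          ≡⟨ with-first (true⊎false (A (f zero))) ⟩
        Q (f zero ∷ vs) A ∎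
        where
        open ≡-Reasoning
        open +-*-Solver
        w : Subset (suc m) → ℚ
        w S = indicator (admits f A S) * q ^ ∣ S ∣
        vs : List (Fin n)
        vs = tabulate (f ∘ suc)
        with-first : A (f zero) ≡ true ⊎ A (f zero) ≡ false →
          Q vs A + total (λ S → indicator (A (f zero) ∧ admits (f ∘ suc) (A ⊝N f zero) S) * (q * q ^ ∣ S ∣)) (subsets m)
          ≡ Q (f zero ∷ vs) A
        with-first (inj₁ e) rewrite e = trans
          (cong (Q vs A +_) (trans (total-cong (λ S → solve 3 (λ a b c → a :* (b :* c) := b :* (a :* c)) refl
              (indicator (admits (f ∘ suc) (A ⊝N f zero) S)) q (q ^ ∣ S ∣)) (subsets m))
            (trans (total-* q _ (subsets m)) (cong (q *_) (total-admits m (f ∘ suc) (A ⊝N f zero))))))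
          (solve 3 (λ a q b → a :+ q :* b := a :- (:- q) :* b) refl (Q vs A) q (Q vs (A ⊝N f zero)))
        with-first (inj₂ e) rewrite e = trans
          (cong (Q vs A +_) (trans (total-cong (λ S → ℚ.*-zeroˡ (q * q ^ ∣ S ∣)) (subsets m)) (total-0 (subsets m))))
          (ℚ.+-identityʳ _)

    value≡P : value q ≡ P full
    value≡P = begin
      value q  ≡⟨ value-unfold q ⟩
      foldr _+_ 0ℚ (map (λ k → ι (indepCount G k) * q ^ k) (upTo (suc n)))  ≡⟨ foldr-upTo (λ k → ι (indepCount G k) * q ^ k) id (suc n) ⟩
      sumTo (suc n) (λ k → ι (indepCount G k) * q ^ k)  ≡⟨ by-size (subsets n) ⟩
      total weight (subsets n)  ≡⟨ total-cong (λ S → cong (λ b → indicator b * q ^ ∣ S ∣) (same S)) (subsets n) ⟩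
      total (λ S → indicator (admits id full S) * q ^ ∣ S ∣) (subsets n)  ≡⟨ total-admits n id full ⟩
      P full ∎
      where
      open ≡-Reasoning
      same : ∀ S → does (independent? G S) ≡ admits id full S
      same S = bool-ext
        (λ e → admits⁺ id full S (λ _ _ → refl) (from-does (independent? G S) e))
        (λ e → dec-true (independent? G S) (proj₂ (admits⁻ id full S e)))
        where
        from-does : ∀ {P : Set} (d : Dec P) → does d ≡ true → P
        from-does (yes p) _ = p

-- From rationals to reals

≤-∣∣ : ∀ a → a ≤ ℚ.∣ a ∣
≤-∣∣ a with ℚ.≤-total 0ℚ a
... | inj₁ 0≤a = ℚ.≤-reflexive (sym (ℚ.0≤p⇒∣p∣≡p 0≤a))
... | inj₂ a≤0 = ℚ.≤-trans a≤0 (ℚ.0≤∣p∣ a)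

∣∣-≤ : ∀ {a c} → a ≤ c → - a ≤ c → ℚ.∣ a ∣ ≤ c
∣∣-≤ {a} a≤c -a≤c with ℚ.∣p∣≡p∨∣p∣≡-p a
... | inj₁ eq = subst (_≤ _) (sym eq) a≤c
... | inj₂ eq = subst (_≤ _) (sym eq) -a≤c

neg-minus : ∀ a b → - (a - b) ≡ b - a
neg-minus = solve 2 (λ a b → :- (a :- b) := b :- a) refl
  where open +-*-Solver

∣-∣-≤ : ∀ {a b c} → a ≤ b + c → b ≤ a + c → ℚ.∣ a - b ∣ ≤ c
∣-∣-≤ {a} {b} {c} p q = ∣∣-≤ (shift p) (subst (_≤ c) (sym (neg-minus a b)) (shift q))
  where
  shift : ∀ {x y} → x ≤ y + c → x - y ≤ c
  shift {x} {y} le = subst (x - y ≤_) (solve 2 (λ y c → (y :+ c) :- y := c) refl y c) (ℚ.+-monoˡ-≤ (- y) le)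
    where open +-*-Solver

∣-∣-≤⁻ : ∀ {a b c} → ℚ.∣ a - b ∣ ≤ c → a ≤ b + c
∣-∣-≤⁻ {a} {b} {c} le = begin
  a              ≡⟨ solve 2 (λ a b → a := b :+ (a :- b)) refl a b ⟩
  b + (a - b)    ≤⟨ ℚ.+-monoʳ-≤ b (ℚ.≤-trans (≤-∣∣ (a - b)) le) ⟩
  b + c          ∎
  where
  open ℚ.≤-Reasoning
  open +-*-Solver

-- Lipschitz on `[- 1 , 1]`, together with a bound there, which makes the class closed under
-- products.
record Tame (h : ℚ → ℚ) : Set where
  field
    bound lipschitz : ℚ
    0≤bound : 0ℚ ≤ bound
    0≤lipschitz : 0ℚ ≤ lipschitz
    bounded : ∀ {a} → ℚ.∣ a ∣ ≤ 1ℚ → ℚ.∣ h a ∣ ≤ bound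
    lip : ∀ {a b} → ℚ.∣ a ∣ ≤ 1ℚ → ℚ.∣ b ∣ ≤ 1ℚ → ℚ.∣ h a - h b ∣ ≤ lipschitz * ℚ.∣ a - b ∣

tame-cong : ∀ {h k} → (∀ q → h q ≡ k q) → Tame h → Tame k
tame-cong eq H = record
  { bound = bound ; lipschitz = lipschitz ; 0≤bound = 0≤bound ; 0≤lipschitz = 0≤lipschitz
  ; bounded = λ {a} le → subst (λ x → ℚ.∣ x ∣ ≤ bound) (eq a) (bounded le)
  ; lip = λ {a} {b} la lb → subst₂ (λ x y → ℚ.∣ x - y ∣ ≤ lipschitz * ℚ.∣ a - b ∣) (eq a) (eq b) (lip la lb) }
  where open Tame H

tame-const : ∀ c → Tame (λ _ → c)
tame-const c = record
  { bound = ℚ.∣ c ∣ ; lipschitz = 0ℚ ; 0≤bound = ℚ.0≤∣p∣ c ; 0≤lipschitz = ℚ.≤-refl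
  ; bounded = λ _ → ℚ.≤-refl
  ; lip = λ {a} {b} _ _ → ℚ.≤-reflexive (trans (cong ℚ.∣_∣ (ℚ.+-inverseʳ c)) (sym (ℚ.*-zeroˡ ℚ.∣ a - b ∣))) }

tame-id : Tame (λ q → q)
tame-id = record
  { bound = 1ℚ ; lipschitz = 1ℚ ; 0≤bound = 0≤1 ; 0≤lipschitz = 0≤1
  ; bounded = λ le → le
  ; lip = λ {a} {b} _ _ → ℚ.≤-reflexive (sym (ℚ.*-identityˡ ℚ.∣ a - b ∣)) }

tame-+ : ∀ {h k} → Tame h → Tame k → Tame (λ q → h q + k q)
tame-+ {h} {k} H K = record
  { bound = H.bound + K.bound ; lipschitz = H.lipschitz + K.lipschitz
  ; 0≤bound = 0≤+ H.0≤bound K.0≤bound ; 0≤lipschitz = 0≤+ H.0≤lipschitz K.0≤lipschitz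
  ; bounded = λ {a} le → ℚ.≤-trans (ℚ.∣p+q∣≤∣p∣+∣q∣ (h a) (k a)) (ℚ.+-mono-≤ (H.bounded le) (K.bounded le))
  ; lip = λ {a} {b} la lb → begin
      ℚ.∣ (h a + k a) - (h b + k b) ∣
        ≡⟨ cong ℚ.∣_∣ (solve 4 (λ a b c d → (a :+ b) :- (c :+ d) := (a :- c) :+ (b :- d)) refl (h a) (k a) (h b) (k b)) ⟩
      ℚ.∣ (h a - h b) + (k a - k b) ∣        ≤⟨ ℚ.∣p+q∣≤∣p∣+∣q∣ (h a - h b) (k a - k b) ⟩
      ℚ.∣ h a - h b ∣ + ℚ.∣ k a - k b ∣      ≤⟨ ℚ.+-mono-≤ (H.lip la lb) (K.lip la lb) ⟩
      H.lipschitz * ℚ.∣ a - b ∣ + K.lipschitz * ℚ.∣ a - b ∣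
        ≡⟨ ℚ.*-distribʳ-+ ℚ.∣ a - b ∣ H.lipschitz K.lipschitz ⟨
      (H.lipschitz + K.lipschitz) * ℚ.∣ a - b ∣ ∎ }
  where
  module H = Tame H
  module K = Tame K
  open ℚ.≤-Reasoning
  open +-*-Solver

tame-* : ∀ {h k} → Tame h → Tame k → Tame (λ q → h q * k q)
tame-* {h} {k} H K = record
  { bound = H.bound * K.bound ; lipschitz = H.bound * K.lipschitz + K.bound * H.lipschitz
  ; 0≤bound = 0≤* H.0≤bound K.0≤bound
  ; 0≤lipschitz = 0≤+ (0≤* H.0≤bound K.0≤lipschitz) (0≤* K.0≤bound H.0≤lipschitz)
  ; bounded = λ {a} le → subst (_≤ H.bound * K.bound) (sym (ℚ.∣p*q∣≡∣p∣*∣q∣ (h a) (k a)))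
      (*-mono (ℚ.0≤∣p∣ (h a)) K.0≤bound (H.bounded le) (K.bounded le))
  ; lip = λ {a} {b} la lb → begin
      ℚ.∣ h a * k a - h b * k b ∣
        ≡⟨ cong ℚ.∣_∣ (solve 4 (λ a b c d → a :* b :- c :* d := a :* (b :- d) :+ d :* (a :- c)) refl (h a) (k a) (h b) (k b)) ⟩
      ℚ.∣ h a * (k a - k b) + k b * (h a - h b) ∣
        ≤⟨ ℚ.∣p+q∣≤∣p∣+∣q∣ (h a * (k a - k b)) (k b * (h a - h b)) ⟩
      ℚ.∣ h a * (k a - k b) ∣ + ℚ.∣ k b * (h a - h b) ∣
        ≡⟨ cong₂ _+_ (ℚ.∣p*q∣≡∣p∣*∣q∣ (h a) (k a - k b)) (ℚ.∣p*q∣≡∣p∣*∣q∣ (k b) (h a - h b)) ⟩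
      ℚ.∣ h a ∣ * ℚ.∣ k a - k b ∣ + ℚ.∣ k b ∣ * ℚ.∣ h a - h b ∣
        ≤⟨ ℚ.+-mono-≤
             (*-mono (ℚ.0≤∣p∣ (h a)) (0≤* K.0≤lipschitz (ℚ.0≤∣p∣ (a - b))) (H.bounded la) (K.lip la lb))
             (*-mono (ℚ.0≤∣p∣ (k b)) (0≤* H.0≤lipschitz (ℚ.0≤∣p∣ (a - b))) (K.bounded lb) (H.lip la lb)) ⟩
      H.bound * (K.lipschitz * ℚ.∣ a - b ∣) + K.bound * (H.lipschitz * ℚ.∣ a - b ∣)
        ≡⟨ solve 5 (λ p q r s d → p :* (q :* d) :+ r :* (s :* d) := (p :* q :+ r :* s) :* d) refl
             H.bound K.lipschitz K.bound H.lipschitz ℚ.∣ a - b ∣ ⟩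
      (H.bound * K.lipschitz + K.bound * H.lipschitz) * ℚ.∣ a - b ∣ ∎ }
  where
  module H = Tame H
  module K = Tame K
  open ℚ.≤-Reasoning
  open +-*-Solver

tame-^ : ∀ k → Tame (_^ k)
tame-^ zero    = tame-const 1ℚ
tame-^ (suc k) = tame-* tame-id (tame-^ k)

abstract
  tame-value : ∀ {n} (G : Graph n) → Tame (value G)
  tame-value {n} G = tame-cong (λ q → sym (value-unfold G q)) (go (upTo (suc n)))
    where
    go : ∀ ks → Tame (λ q → foldr _+_ 0ℚ (map (λ k → ι (indepCount G k) * q ^ k) ks))
    go []       = tame-const 0ℚ
    go (k ∷ ks) = tame-+ (tame-* (tame-const (ι (indepCount G k))) (tame-^ k)) (go ks)

0<½ : 0ℚ < ½
0<½ = ℚ.positive⁻¹ ½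

halves : ∀ e → ½ * e + ½ * e ≡ e
halves e = trans (sym (ℚ.*-distribʳ-+ e ½ ½)) (ℚ.*-identityˡ e)

n*½ⁿ≤1 : ∀ N → (1ℚ + ι N) * ½ ^ N ≤ 1ℚ
n*½ⁿ≤1 zero    = ℚ.≤-refl
n*½ⁿ≤1 (suc N) = begin
  (1ℚ + ι (suc N)) * (½ * ½ ^ N)          ≡⟨ cong (λ c → (1ℚ + c) * (½ * ½ ^ N)) (ι-suc N) ⟩
  (1ℚ + (1ℚ + ι N)) * (½ * ½ ^ N)         ≤⟨ ≤-by (½ * (ι N * ½ ^ N)) (0≤* (ℚ.<⇒≤ 0<½) (0≤* (0≤ι N) (0≤^ N (ℚ.<⇒≤ 0<½))))
                                               (solve 2 (λ c h → (con 1ℚ :+ c) :* h :=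
                                                 (con 1ℚ :+ (con 1ℚ :+ c)) :* (con ½ :* h) :+ con ½ :* (c :* h)) refl (ι N) (½ ^ N)) ⟩
  (1ℚ + ι N) * ½ ^ N                      ≤⟨ n*½ⁿ≤1 N ⟩
  1ℚ                                      ∎
  where
  open ℚ.≤-Reasoning
  open +-*-Solver
  0≤ι : ∀ N → 0ℚ ≤ ι N
  0≤ι zero    = ℚ.≤-refl
  0≤ι (suc N) = subst (0ℚ ≤_) (sym (ι-suc N)) (0≤+ 0≤1 (0≤ι N))

1≤p*↧p : ∀ e → 0ℚ < e → 1ℚ ≤ e * ι (ℚ.↧ₙ e)
1≤p*↧p e@(ℚ.mkℚ (ℤ.+ suc a) d _) _ = ℚ.toℚᵘ-cancel-≤ (begin
  ℚ.toℚᵘ 1ℚ                                   ≤⟨ ℚᵘ.*≤* (ℤ.+≤+ (ℕ.≤-trans (ℕ.≤-reflexive lhs) (ℕ.≤-trans (ℕ.m≤n*m (suc d) (suc a)) (ℕ.≤-reflexive (sym rhs))))) ⟩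
  mkℚᵘ (ℤ.+ suc a) d ℚᵘ.* mkℚᵘ (ℤ.+ suc d) 0  ≃⟨ ℚᵘ.*-congˡ {mkℚᵘ (ℤ.+ suc a) d} (ℚ.toℚᵘ-fromℚᵘ (mkℚᵘ (ℤ.+ suc d) 0)) ⟨
  ℚ.toℚᵘ e ℚᵘ.* ℚ.toℚᵘ (ι (suc d))             ≃⟨ ℚ.toℚᵘ-homo-* e (ι (suc d)) ⟨
  ℚ.toℚᵘ (e * ι (suc d))                       ∎)
  where
  open ℚᵘ.≤-Reasoning
  lhs : 1 ℕ.* (suc d ℕ.* 1) ≡ suc d
  lhs = trans (ℕ.*-identityˡ _) (ℕ.*-identityʳ _)
  rhs : suc a ℕ.* suc d ℕ.* 1 ≡ suc a ℕ.* suc d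
  rhs = ℕ.*-identityʳ _
1≤p*↧p (ℚ.mkℚ (ℤ.+ zero) d _) (ℚ.*<* (ℤ.+<+ ()))
1≤p*↧p (ℚ.mkℚ (ℤ.-[1+ a ]) d _) (ℚ.*<* ())

-- The denominator of `e` serves as `N`: `(1 + N) ½^N ≤ 1`, whereas `e N ≥ 1` because the numerator
-- of `e` is at least 1.
½^-archimedean : ∀ e → 0ℚ < e → ∃[ N ] ½ ^ N < e
½^-archimedean e 0<e = N , ℚ.*-cancelˡ-<-nonNeg (1ℚ + ι N) {{ℚ.nonNegative 0≤c}} (begin-strict
  (1ℚ + ι N) * ½ ^ N   ≤⟨ n*½ⁿ≤1 N ⟩
  1ℚ                   ≤⟨ 1≤p*↧p e 0<e ⟩
  e * ι N              <⟨ subst (_< e + e * ι N) (ℚ.+-identityˡ (e * ι N)) (ℚ.+-monoˡ-< (e * ι N) 0<e) ⟩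
  e + e * ι N          ≡⟨ solve 2 (λ e c → e :+ e :* c := (con 1ℚ :+ c) :* e) refl e (ι N) ⟩
  (1ℚ + ι N) * e       ∎)
  where
  open ℚ.≤-Reasoning
  open +-*-Solver
  N : ℕ
  N = ℚ.↧ₙ e
  0≤c : 0ℚ ≤ 1ℚ + ι N
  0≤c = 0≤+ 0≤1 (ℚ.nonNegative⁻¹ (ι N) {{ℚ.normalize-nonNeg N 1}})

quotient : ∀ c e → 0ℚ < c → 0ℚ < e → ∃[ d ] (0ℚ < d × c * d ≡ e)
quotient c e 0<c 0<e = 1/c * e , 0<* (ℚ.positive⁻¹ 1/c {{ℚ.1/pos⇒pos c {{c-pos}}}}) 0<e ,
  trans (sym (ℚ.*-assoc c 1/c e)) (trans (cong (_* e) (ℚ.*-inverseʳ c {{ℚ.pos⇒nonZero c {{c-pos}}}})) (ℚ.*-identityˡ e))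
  where
  c-pos : ℚ.Positive c
  c-pos = ℚ.positive 0<c
  1/c : ℚ
  1/c = ℚ.1/_ c {{ℚ.pos⇒nonZero c {{c-pos}}}}

½^-suc : ∀ m → ½ ^ suc m ≤ ½ ^ m
½^-suc m = ≤-by (½ * ½ ^ m) (0≤* (ℚ.<⇒≤ 0<½) (0≤^ m (ℚ.<⇒≤ 0<½))) (sym (halves (½ ^ m)))

½^-antitone : ∀ {m n} → m ℕ.≤′ n → ½ ^ n ≤ ½ ^ m
½^-antitone (ℕ.≤′-reflexive refl)  = ℚ.≤-refl
½^-antitone (ℕ.≤′-step {n} m≤n) = ℚ.≤-trans (½^-suc n) (½^-antitone m≤n)

∣∣≤1 : ∀ {a} → - 1ℚ ≤ a → a ≤ 1ℚ → ℚ.∣ a ∣ ≤ 1ℚ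
∣∣≤1 lo hi = ∣∣-≤ hi (ℚ.neg-antimono-≤ lo)

-1≤-½ : - 1ℚ ≤ - ½
-1≤-½ = ≤-by ½ (ℚ.<⇒≤ 0<½) refl

-- Bisection for a root in `[- ½ , 0]`

module Bisection (p : ℚ → ℚ) (tame : Tame p) (0≤p0 : 0ℚ ≤ p 0ℚ) (p-½≤0 : p (- ½) ≤ 0ℚ) where
  open Tame tame

  -- The initial interval already has length `½`, hence the exponent `suc m`.
  width : ℕ → ℚ
  width m = ½ ^ suc m

  0≤width : ∀ m → 0ℚ ≤ width m
  0≤width m = 0≤^ (suc m) (ℚ.<⇒≤ 0<½)

  -- The approximation is the right end `b`, where `p` is non-negative. The comparison later starts
  -- from this sign and extends it to all of `[b , 0]`.
  record State (m : ℕ) : Set where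
    field
      b   : ℚ
      pos : 0ℚ ≤ p b
      neg : p (b - width m) ≤ 0ℚ
      b≤0 : b ≤ 0ℚ
      -½≤ : - ½ ≤ b - width m
  open State

  private
    half-step : ∀ b d → (b - ½ * d) - ½ * d ≡ b - d
    half-step = solve 2 (λ b d → (b :- con ½ :* d) :- con ½ :* d := b :- d) refl
      where open +-*-Solver

    minus-≤ : ∀ {a d} → 0ℚ ≤ d → a - d ≤ a
    minus-≤ {a} {d} 0≤d = ≤-by d 0≤d (solve 2 (λ a d → a := (a :- d) :+ d) refl a d)
      where open +-*-Solver

    shift : ∀ x y c d → x - c ≤ y - d → 0ℚ ≤ d → x ≤ y + c
    shift x y c d le 0≤d = begin
      x             ≡⟨ solve 2 (λ x c → x := (x :- c) :+ c) refl x c ⟩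
      (x - c) + c   ≤⟨ ℚ.+-monoˡ-≤ c (ℚ.≤-trans le (minus-≤ {y} 0≤d)) ⟩
      y + c         ∎
      where
      open ℚ.≤-Reasoning
      open +-*-Solver

  bisect : ∀ {m} (s : State m) → Dec (0ℚ ≤ p (b s - width (suc m))) → State (suc m)
  bisect {m} s (yes 0≤p) = record
    { b = b s - width (suc m) ; pos = 0≤p
    ; neg = subst (λ a → p a ≤ 0ℚ) (sym (half-step (b s) (width m))) (neg s)
    ; b≤0 = ℚ.≤-trans (minus-≤ (0≤width (suc m))) (b≤0 s)
    ; -½≤ = subst (- ½ ≤_) (sym (half-step (b s) (width m))) (-½≤ s) }
  bisect {m} s (no ¬0≤p) = record
    { b = b s ; pos = pos s ; neg = ℚ.<⇒≤ (ℚ.≰⇒> ¬0≤p) ; b≤0 = b≤0 s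
    ; -½≤ = ℚ.≤-trans (-½≤ s) (ℚ.+-monoʳ-≤ (b s) (ℚ.neg-antimono-≤ (½^-suc (suc m)))) }

  bisect-shrinks : ∀ {m} (s : State m) d →
    b (bisect s d) ≤ b s × b s - width m ≤ b (bisect s d) - width (suc m)
  bisect-shrinks {m} s (yes _) = minus-≤ (0≤width (suc m)) , ℚ.≤-reflexive (sym (half-step (b s) (width m)))
  bisect-shrinks {m} s (no _)  = ℚ.≤-refl , ℚ.+-monoʳ-≤ (b s) (ℚ.neg-antimono-≤ (½^-suc (suc m)))

  state : ∀ m → State m
  state zero    = record { b = 0ℚ ; pos = 0≤p0 ; neg = p-½≤0 ; b≤0 = ℚ.≤-refl ; -½≤ = ℚ.≤-refl }
  state (suc m) = bisect (state m) (0ℚ ℚ.≤? p (b (state m) - width (suc m)))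

  approx : ℕ → ℚ
  approx m = b (state m)

  nested : ∀ {m n} → m ℕ.≤′ n → approx n ≤ approx m × approx m - width m ≤ approx n - width n
  nested (ℕ.≤′-reflexive refl) = ℚ.≤-refl , ℚ.≤-refl
  nested (ℕ.≤′-step {n} m≤n) =
    let hi , lo = nested m≤n
        hi′ , lo′ = bisect-shrinks (state n) (0ℚ ℚ.≤? p (b (state n) - width (suc n)))
    in ℚ.≤-trans hi′ hi , ℚ.≤-trans lo lo′

  approx-cauchy : IsCauchy approx
  approx-cauchy e 0<e = let N , small = ½^-archimedean e 0<e in N , λ m n N≤m N≤n →
    ℚ.≤-<-trans (∣-∣-≤ (close N≤m N≤n) (close N≤n N≤m)) (ℚ.≤-<-trans (½^-suc N) small)
    where
    close : ∀ {N m n} → N ℕ.≤ m → N ℕ.≤ n → approx m ≤ approx n + width N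
    close {N} {m} {n} N≤m N≤n = ℚ.≤-trans (proj₁ (nested (ℕ.≤⇒≤′ N≤m)))
      (shift (approx N) (approx n) (width N) (width n) (proj₂ (nested (ℕ.≤⇒≤′ N≤n))) (0≤width n))

  root : ℝ
  root = mkℝ approx approx-cauchy

  approx-bounds : ∀ m → - ½ ≤ approx m × approx m ≤ 0ℚ
  approx-bounds m = ℚ.≤-trans (-½≤ (state m)) (minus-≤ (0≤width m)) , b≤0 (state m)

  p-approx : ∀ e → 0ℚ < e → ∃[ N ] (∀ n → N ℕ.≤ n → p (approx n) < e)
  p-approx e 0<e =
    -- Dividing by `lipschitz + 1ℚ` is safe even when the Lipschitz constant is 0.
    let d , 0<d , Kd≡e = quotient (lipschitz + 1ℚ) e 0<K 0<e
        N , small = ½^-archimedean d 0<d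
    in N , λ n N≤n → ℚ.≤-<-trans (bound′ n)
      (subst (lipschitz * width n <_) Kd≡e
        (ℚ.≤-<-trans (ℚ.*-monoʳ-≤-nonNeg (width n) {{ℚ.nonNegative (0≤width n)}} K≤K+1)
          (ℚ.*-monoʳ-<-pos (lipschitz + 1ℚ) {{ℚ.positive 0<K}}
            (ℚ.≤-<-trans (ℚ.≤-trans (½^-suc n) (½^-antitone (ℕ.≤⇒≤′ N≤n))) small))))
    where
    K≤K+1 : lipschitz ≤ lipschitz + 1ℚ
    K≤K+1 = ≤-by 1ℚ 0≤1 refl
    0<K : 0ℚ < lipschitz + 1ℚ
    0<K = ℚ.+-mono-≤-< 0≤lipschitz (ℚ.positive⁻¹ 1ℚ)
    bound′ : ∀ n → p (approx n) ≤ lipschitz * width n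
    bound′ n = begin
      p x                              ≤⟨ ∣-∣-≤⁻ (lip (∣∣≤1 (ℚ.≤-trans -1≤-½ (proj₁ (approx-bounds n))) (ℚ.≤-trans x≤0 0≤1))
                                             (∣∣≤1 (ℚ.≤-trans -1≤-½ (-½≤ (state n))) (ℚ.≤-trans (minus-≤ (0≤width n)) (ℚ.≤-trans x≤0 0≤1)))) ⟩
      p y + lipschitz * ℚ.∣ x - y ∣    ≤⟨ ℚ.+-monoˡ-≤ (lipschitz * ℚ.∣ x - y ∣) (neg (state n)) ⟩
      0ℚ + lipschitz * ℚ.∣ x - y ∣     ≡⟨ ℚ.+-identityˡ _ ⟩
      lipschitz * ℚ.∣ x - y ∣          ≡⟨ cong (λ a → lipschitz * ℚ.∣ a ∣) (solve 2 (λ x d → x :- (x :- d) := d) refl x (width n)) ⟩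
      lipschitz * ℚ.∣ width n ∣        ≡⟨ cong (lipschitz *_) (ℚ.0≤p⇒∣p∣≡p (0≤width n)) ⟩
      lipschitz * width n              ∎
      where
      open ℚ.≤-Reasoning
      open +-*-Solver
      x y : ℚ
      x = approx n
      y = x - width n
      x≤0 : x ≤ 0ℚ
      x≤0 = b≤0 (state n)

  p-approx≈0 : ∀ e → 0ℚ < e → ∃[ N ] (∀ n → N ℕ.≤ n → ℚ.∣ p (approx n) - 0ℚ ∣ < e)
  p-approx≈0 e 0<e = let N , small = p-approx e 0<e in N , λ n N≤n →
    subst (_< e) (sym (trans (cong ℚ.∣_∣ (ℚ.+-identityʳ (p (approx n)))) (ℚ.0≤p⇒∣p∣≡p (pos (state n))))) (small n N≤n)

-- The condition says ((1 − 2s) / (1 − s))^(k+1) ≥ s / (1 − s); as s decreases,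
-- the left side grows and the right side shrinks.
sign-monotone : ∀ k {s t} → 0ℚ ≤ t → t ≤ s → s ≤ ½ →
  s * (1ℚ - s) ^ k ≤ (1ℚ - s - s) ^ suc k → t * (1ℚ - t) ^ k ≤ (1ℚ - t - t) ^ suc k
sign-monotone k {s} {t} 0≤t t≤s s≤½ le = *-cancelˡ (0<^ (suc k) 0<u) (begin
  u ^ suc k * (t * u′ ^ k)         ≡⟨ solve 4 (λ u a t b → u :* a :* (t :* b) := (b :* a) :* (t :* u)) refl u (u ^ k) t (u′ ^ k) ⟩
  u′ ^ k * u ^ k * (t * u)         ≤⟨ *-monoˡ (0≤* (0≤^ k 0≤u′) (0≤^ k (ℚ.<⇒≤ 0<u))) tu≤su′ ⟩
  u′ ^ k * u ^ k * (s * u′)        ≡⟨ solve 4 (λ b a s u′ → b :* a :* (s :* u′) := u′ :* b :* (s :* a)) refl (u′ ^ k) (u ^ k) s u′ ⟩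
  u′ ^ suc k * (s * u ^ k)         ≤⟨ *-monoˡ (0≤^ (suc k) 0≤u′) le ⟩
  u′ ^ suc k * v ^ suc k           ≡⟨ ^-distrib-* u′ v (suc k) ⟨
  (u′ * v) ^ suc k                 ≤⟨ ^-mono (suc k) (0≤* 0≤u′ 0≤v) u′v≤uv′ ⟩
  (u * v′) ^ suc k                 ≡⟨ ^-distrib-* u v′ (suc k) ⟩
  u ^ suc k * v′ ^ suc k           ∎)
  where
  open ℚ.≤-Reasoning
  open +-*-Solver
  u v u′ v′ : ℚ
  u = 1ℚ - s
  v = 1ℚ - s - s
  u′ = 1ℚ - t
  v′ = 1ℚ - t - t
  0≤½-s : 0ℚ ≤ ½ - s
  0≤½-s = 0≤-- s≤½
  0≤v : 0ℚ ≤ v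
  0≤v = subst (0ℚ ≤_) (solve 1 (λ s → (con ½ :- s) :+ (con ½ :- s) := con 1ℚ :- s :- s) refl s) (0≤+ 0≤½-s 0≤½-s)
  0<u : 0ℚ < u
  0<u = ℚ.<-≤-trans 0<½ (≤-by (½ - s) 0≤½-s (solve 1 (λ s → con 1ℚ :- s := con ½ :+ (con ½ :- s)) refl s))
  0≤u′ : 0ℚ ≤ u′
  0≤u′ = ℚ.≤-trans (ℚ.<⇒≤ 0<u) (ℚ.+-monoʳ-≤ 1ℚ (ℚ.neg-antimono-≤ t≤s))
  tu≤su′ : t * u ≤ s * u′
  tu≤su′ = ≤-by (s - t) (0≤-- t≤s) (solve 2 (λ s t → s :* (con 1ℚ :- t) := t :* (con 1ℚ :- s) :+ (s :- t)) refl s t)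
  u′v≤uv′ : u′ * v ≤ u * v′
  u′v≤uv′ = ≤-by (s - t) (0≤-- t≤s) (solve 2 (λ s t →
    (con 1ℚ :- s) :* (con 1ℚ :- t :- t) := (con 1ℚ :- t) :* (con 1ℚ :- s :- s) :+ (s :- t)) refl s t)

-- Only `t ≡ ½` has to be excluded: there the right side of the hypothesis vanishes while the left
-- side is positive.
0<1-2t : ∀ k {t} → t ≤ ½ → t * (1ℚ - t) ^ k ≤ (1ℚ - t - t) ^ suc k → 0ℚ < 1ℚ - t - t
0<1-2t k {t} t≤½ le with ℚ.<-cmp t ½
... | tri< t<½ _ _ = subst (0ℚ <_) (solve 1 (λ t → (con ½ :- t) :+ (con ½ :- t) := con 1ℚ :- t :- t) refl t)
                       (ℚ.+-mono-< 0<½-t 0<½-t)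
  where
  open +-*-Solver
  0<½-t : 0ℚ < ½ - t
  0<½-t = subst (_< ½ - t) (ℚ.+-inverseʳ t) (ℚ.+-monoˡ-< (- t) t<½)
... | tri> _ _ ½<t = ⊥-elim (ℚ.<-irrefl refl (ℚ.<-≤-trans ½<t t≤½))
... | tri≈ _ refl _ = ⊥-elim (ℚ.<-irrefl refl (ℚ.<-≤-trans (0<* 0<½ (0<^ k 0<½)) (subst (½ * ½ ^ k ≤_) (ℚ.*-zeroˡ (0ℚ ^ k)) le)))

positive-⊓ : ∀ {d} → 0ℚ < d → 0ℚ < d ℚ.⊓ ½
positive-⊓ {d} 0<d with ℚ.⊓-sel d ½
... | inj₁ eq = subst (0ℚ <_) (sym eq) 0<d
... | inj₂ eq = subst (0ℚ <_) (sym eq) 0<½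

0<+1 : ∀ c → 0ℚ ≤ c → 0ℚ < c + 1ℚ
0<+1 c 0≤c = ℚ.+-mono-≤-< 0≤c (ℚ.positive⁻¹ 1ℚ)

*-<-+1 : ∀ c {d d₀} → 0ℚ ≤ c → 0ℚ < d → d ≤ d₀ → c * d < (c + 1ℚ) * d₀
*-<-+1 c {d} {d₀} 0≤c 0<d d≤d₀ = begin-strict
  c * d            ≡⟨ ℚ.+-identityʳ (c * d) ⟨
  c * d + 0ℚ       <⟨ ℚ.+-monoʳ-< (c * d) 0<d ⟩
  c * d + d        ≡⟨ solve 2 (λ c d → c :* d :+ d := (c :+ con 1ℚ) :* d) refl c d ⟩
  (c + 1ℚ) * d     ≤⟨ *-monoˡ (ℚ.<⇒≤ (0<+1 c 0≤c)) d≤d₀ ⟩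
  (c + 1ℚ) * d₀    ∎
  where
  open ℚ.≤-Reasoning
  open +-*-Solver

-- Stated for arbitrary reals: with y = I G x, conversion checking would normalise rational sums.
≈0-by : ∀ (y : ℝ) (a : ℕ → ℚ) → (∀ n → seq y n ≡ a n) →
  (∀ e → 0ℚ < e → ∃[ N ] (∀ n → N ℕ.≤ n → ℚ.∣ a n - 0ℚ ∣ < e)) → y ≈ᴿ 0ᴿ
≈0-by y a eq small e 0<e = let N , lt = small e 0<e in N , λ n N≤n →
  subst (λ q → ℚ.∣ q - 0ℚ ∣ < e) (sym (eq n)) (lt n N≤n)

≤ᴿ-by : ∀ (y z : ℝ) (a b : ℕ → ℚ) → (∀ n → seq y n ≡ a n) → (∀ n → seq z n ≡ b n) →
  (∀ e → 0ℚ < e → ∃[ N ] (∀ n → N ℕ.≤ n → a n < b n + e)) → y ≤ᴿ z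
≤ᴿ-by y z a b y≡ z≡ below e 0<e = let N , lt = below e 0<e in N , λ n N≤n →
  subst₂ (λ p q → p < q + e) (sym (y≡ n)) (sym (z≡ n)) (lt n N≤n)

-- From rational to real arguments

module Comparison {m n : ℕ} (T : Graph m) (G : Graph n)
  (0≤value-T-0 : 0ℚ ≤ value T 0ℚ) (value-T-½≤0 : value T (- ½) ≤ 0ℚ)
  (upward : ∀ {b q} → - ½ ≤ b → b ≤ q → q ≤ 0ℚ → 0ℚ ≤ value T b → 0ℚ ≤ value T q)
  (lower : ∀ {q} → - ½ ≤ q → q ≤ 0ℚ → 0ℚ ≤ value T q → value T q ≤ value G q)
  where

  open Bisection (value T) (tame-value T) 0≤value-T-0 value-T-½≤0

  private
    module T = Tame (tame-value T)
    module G = Tame (tame-value G)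

  -- A point within `d` of `[b , 0]` is moved into that interval, where `lower` applies; the move
  -- costs `d` times each Lipschitz constant. The bounds `- ½ ≤ b` and `d ≤ ½` keep every point in
  -- `[- 1 , 1]`.
  value-lower-near : ∀ {b d q} → - ½ ≤ b → b ≤ 0ℚ → 0ℚ ≤ value T b → 0ℚ ≤ d → d ≤ ½ →
    b ≤ q + d → q ≤ 0ℚ + d → value T q ≤ value G q + (T.lipschitz + G.lipschitz) * d
  value-lower-near {b} {d} {q} -½≤b b≤0 0≤Tb 0≤d d≤½ b≤q+d q≤d =
    near (proj₁ clamp) (proj₂ clamp)
    where
    open ℚ.≤-Reasoning
    open +-*-Solver
    clamp : ∃[ q′ ] (b ≤ q′ × q′ ≤ 0ℚ × ℚ.∣ q - q′ ∣ ≤ d)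
    clamp with ℚ.≤-total q b
    ... | inj₁ q≤b = b , ℚ.≤-refl , b≤0 , ∣-∣-≤ (ℚ.≤-trans q≤b (≤-by d 0≤d refl)) b≤q+d
    ... | inj₂ b≤q with ℚ.≤-total q 0ℚ
    ...   | inj₁ q≤0 = q , b≤q , q≤0 , ∣-∣-≤ {q} {q} (≤-by d 0≤d refl) (≤-by d 0≤d refl)
    ...   | inj₂ 0≤q = 0ℚ , b≤0 , ℚ.≤-refl , ∣-∣-≤ q≤d (ℚ.≤-trans 0≤q (≤-by d 0≤d refl))
    -1≤q : - 1ℚ ≤ q
    -1≤q = begin
      - 1ℚ         ≡⟨⟩
      - ½ - ½      ≤⟨ ℚ.+-mono-≤ -½≤b (ℚ.neg-antimono-≤ d≤½) ⟩
      b - d        ≤⟨ ℚ.+-monoˡ-≤ (- d) b≤q+d ⟩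
      (q + d) - d  ≡⟨ solve 2 (λ q d → (q :+ d) :- d := q) refl q d ⟩
      q            ∎
    ∣q∣≤1 : ℚ.∣ q ∣ ≤ 1ℚ
    ∣q∣≤1 = ∣∣≤1 -1≤q (ℚ.≤-trans q≤d (ℚ.≤-trans (ℚ.≤-reflexive (ℚ.+-identityˡ d)) (ℚ.≤-trans d≤½ (≤-by ½ (ℚ.<⇒≤ 0<½) refl))))
    near : ∀ q′ → b ≤ q′ × q′ ≤ 0ℚ × ℚ.∣ q - q′ ∣ ≤ d → value T q ≤ value G q + (T.lipschitz + G.lipschitz) * d
    near q′ (b≤q′ , q′≤0 , close) = begin
      value T q                                                  ≤⟨ ∣-∣-≤⁻ (T.lip ∣q∣≤1 ∣q′∣≤1) ⟩
      value T q′ + T.lipschitz * ℚ.∣ q - q′ ∣                    ≤⟨ ℚ.+-mono-≤ (lower -½≤q′ q′≤0 0≤Tq′) (*-monoˡ T.0≤lipschitz close) ⟩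
      value G q′ + T.lipschitz * d                               ≤⟨ ℚ.+-monoˡ-≤ (T.lipschitz * d) (∣-∣-≤⁻ {value G q′} {value G q} (G.lip ∣q′∣≤1 ∣q∣≤1)) ⟩
      value G q + G.lipschitz * ℚ.∣ q′ - q ∣ + T.lipschitz * d   ≤⟨ ℚ.+-monoˡ-≤ (T.lipschitz * d) (ℚ.+-monoʳ-≤ (value G q) (*-monoˡ G.0≤lipschitz close′)) ⟩
      value G q + G.lipschitz * d + T.lipschitz * d              ≡⟨ solve 4 (λ g a c d → g :+ a :* d :+ c :* d := g :+ (c :+ a) :* d) refl (value G q) G.lipschitz T.lipschitz d ⟩
      value G q + (T.lipschitz + G.lipschitz) * d                ∎
      where
      -½≤q′ : - ½ ≤ q′
      -½≤q′ = ℚ.≤-trans -½≤b b≤q′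
      ∣q′∣≤1 : ℚ.∣ q′ ∣ ≤ 1ℚ
      ∣q′∣≤1 = ∣∣≤1 (ℚ.≤-trans -1≤-½ -½≤q′) (ℚ.≤-trans q′≤0 0≤1)
      close′ : ℚ.∣ q′ - q ∣ ≤ d
      close′ = subst (_≤ d) (trans (sym (ℚ.∣-p∣≡∣p∣ (q - q′))) (cong ℚ.∣_∣ (neg-minus q q′))) close
      0≤Tq′ : 0ℚ ≤ value T q′
      0≤Tq′ = upward -½≤b b≤q′ q′≤0 0≤Tb

  -- r is a variable because conversion checking would unfold I at root itself.
  above-root⇒G⪯T : ∀ r → (∀ n → seq r n ≡ approx n) → G ⪯ T
  above-root⇒G⪯T r r≡ ξ (_ , largest) x ξ≤x x≤0 = ≤ᴿ-by (I T x) (I G x) a b (seq-I T x) (seq-I G x)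
    λ e 0<e → choose 0<e (quotient (K + 1ℚ) e 0<K+1 0<e)
    where
    a b : ℕ → ℚ
    a m = value T (seq x m)
    b m = value G (seq x m)
    K : ℚ
    K = T.lipschitz + G.lipschitz
    0≤K : 0ℚ ≤ K
    0≤K = 0≤+ T.0≤lipschitz G.0≤lipschitz
    0<K+1 : 0ℚ < K + 1ℚ
    0<K+1 = 0<+1 K 0≤K
    I-root : I T r ≈ᴿ 0ᴿ
    I-root = ≈0-by (I T r) (λ n → value T (approx n))
      (λ n → trans (seq-I T r n) (cong (value T) (r≡ n))) p-approx≈0
    chain : ∀ {a b c d} → a < b + ½ * d → b < c + ½ * d → a ≤ c + d
    chain {a} {b} {c} {d} a<b b<c = ℚ.<⇒≤ (begin-strict
      a                       <⟨ a<b ⟩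
      b + ½ * d               <⟨ ℚ.+-monoˡ-< (½ * d) b<c ⟩
      c + ½ * d + ½ * d       ≡⟨ ℚ.+-assoc c (½ * d) (½ * d) ⟩
      c + (½ * d + ½ * d)     ≡⟨ cong (c +_) (halves d) ⟩
      c + d                   ∎)
      where open ℚ.≤-Reasoning
    pointwise : ∀ {e d} → 0ℚ < d → d ≤ ½ → K * d < e → ∀ m →
      approx m < seq ξ m + ½ * d → seq ξ m < seq x m + ½ * d → seq x m < 0ℚ + d → a m < b m + e
    pointwise {e} {d} 0<d d≤½ Kd<e m root<ξ ξ<x x<0 = ℚ.≤-<-trans
      (value-lower-near (proj₁ (approx-bounds m)) (proj₂ (approx-bounds m))
        (State.pos (state m)) (ℚ.<⇒≤ 0<d) d≤½
        (chain {approx m} {seq ξ m} {seq x m} root<ξ ξ<x) (ℚ.<⇒≤ x<0))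
      (ℚ.+-monoʳ-< (b m) Kd<e)
    choose : ∀ {e} → 0ℚ < e → ∃[ d ] (0ℚ < d × (K + 1ℚ) * d ≡ e) →
      ∃[ N ] (∀ m → N ℕ.≤ m → a m < b m + e)
    -- The maximality of `ξ` is applied to the root found by bisection, giving `r ≤ ξ ≤ x`. Each of
    -- these two inequalities receives half of the tolerance `d`.
    choose {e} 0<e (d₀ , 0<d₀ , eq) = merge (largest r I-root (½ * d) 0<d/2) (ξ≤x (½ * d) 0<d/2) (x≤0 d 0<d)
      where
      d : ℚ
      -- The cap `½` meets the restriction on `d` in `value-lower-near`.
      d = d₀ ℚ.⊓ ½
      0<d : 0ℚ < d
      0<d = positive-⊓ 0<d₀
      0<d/2 : 0ℚ < ½ * d
      0<d/2 = 0<* 0<½ 0<d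
      Kd<e : K * d < e
      Kd<e = subst (K * d <_) eq (*-<-+1 K 0≤K 0<d (ℚ.p⊓q≤p d₀ ½))
      merge : ∃[ N ] (∀ m → N ℕ.≤ m → seq r m < seq ξ m + ½ * d) →
        ∃[ N ] (∀ m → N ℕ.≤ m → seq ξ m < seq x m + ½ * d) →
        ∃[ N ] (∀ m → N ℕ.≤ m → seq x m < 0ℚ + d) →
        ∃[ N ] (∀ m → N ℕ.≤ m → a m < b m + e)
      merge (N₁ , root<ξ) (N₂ , ξ<x) (N₃ , x<0) = N₁ ℕ.⊔ (N₂ ℕ.⊔ N₃) , λ m N≤m →
        let N₂₃≤m = ℕ.≤-trans (ℕ.m≤n⊔m N₁ (N₂ ℕ.⊔ N₃)) N≤m in
        pointwise {e} {d} 0<d (ℚ.p⊓q≤q d₀ ½) Kd<e m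
          (subst (_< seq ξ m + ½ * d) (r≡ m) (root<ξ m (ℕ.≤-trans (ℕ.m≤m⊔n N₁ (N₂ ℕ.⊔ N₃)) N≤m)))
          (ξ<x m (ℕ.≤-trans (ℕ.m≤m⊔n N₂ N₃) N₂₃≤m))
          (x<0 m (ℕ.≤-trans (ℕ.m≤n⊔m N₂ N₃) N₂₃≤m))

  G⪯T : G ⪯ T
  G⪯T = above-root⇒G⪯T root λ _ → refl

-- The comparison with Mₙ

module _ {n : ℕ} {G : Graph n} (D : Decomposition G) where
  open Decomposition D

  private
    k : ℕ
    k = length pairs ℕ.+ r

    T : Graph (3 ℕ.+ k ℕ.* 2)
    T = triangleWithK₂s k

  value-T : ∀ q → value T q ≡ (1ℚ - - q - - q) ^ suc k - - q * (1ℚ - - q) ^ k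
  value-T q = trans (value≡P T q) (TrianglePolynomial.P-triangleWithK₂s k (- q))

  0≤value-T⁻ : ∀ {q} → 0ℚ ≤ value T q → - q * (1ℚ - - q) ^ k ≤ (1ℚ - - q - - q) ^ suc k
  0≤value-T⁻ {q} 0≤ = ≤-by (value T q) 0≤
    (trans (solve 2 (λ a b → b := a :+ (b :- a)) refl (- q * (1ℚ - - q) ^ k) ((1ℚ - - q - - q) ^ suc k))
      (cong (- q * (1ℚ - - q) ^ k +_) (sym (value-T q))))
    where open +-*-Solver

  0≤value-T⁺ : ∀ {q} → - q * (1ℚ - - q) ^ k ≤ (1ℚ - - q - - q) ^ suc k → 0ℚ ≤ value T q
  0≤value-T⁺ {q} le = subst (0ℚ ≤_) (sym (value-T q)) (0≤-- le)

  value-lower : ∀ {q} → - ½ ≤ q → q ≤ 0ℚ → 0ℚ ≤ value T q → value T q ≤ value G q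
  value-lower {q} -½≤q q≤0 0≤ = subst₂ _≤_ (sym (value-T q)) (sym (trans (value≡P G q) (P-cong λ x → sym (all x))))
      (growth-lower C growth admissible)
    where
    t : ℚ
    t = - q
    sign : t * (1ℚ - t) ^ k ≤ (1ℚ - t - t) ^ suc k
    sign = 0≤value-T⁻ 0≤
    open CycleBounds G t (ℚ.neg-antimono-≤ q≤0) (0<1-2t k (ℚ.neg-antimono-≤ -½≤q) sign)
    -- Non-negativity of the polynomial of `T` at `q`, multiplied by `u`.
    admissible : Admissible (suc k)
    admissible = subst (_≤ u * v ^ suc k)
      (solve 3 (λ t u a → u :* (t :* a) := t :* (u :* a)) refl t u (u ^ k)) (*-monoˡ 0≤u sign)
      where open +-*-Solver

  0≤value-T-0 : 0ℚ ≤ value T 0ℚ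
  0≤value-T-0 = 0≤value-T⁺ (ℚ.≤-trans (ℚ.≤-reflexive (ℚ.*-zeroˡ ((1ℚ - - 0ℚ) ^ k))) (0≤^ (suc k) 0≤1))

  -- At `t = ½` the power of `v` vanishes and only the subtracted term remains, which is why `- ½`
  -- is the left end of the bisection.
  value-T-½≤0 : value T (- ½) ≤ 0ℚ
  value-T-½≤0 = subst (_≤ 0ℚ) (sym (value-T (- ½)))
    (subst (λ a → a - ½ * ½ ^ k ≤ 0ℚ) (sym (ℚ.*-zeroˡ (0ℚ ^ k)))
      (subst (_≤ 0ℚ) (sym (ℚ.+-identityˡ _)) (ℚ.neg-antimono-≤ (0≤* (ℚ.<⇒≤ 0<½) (0≤^ k (ℚ.<⇒≤ 0<½))))))

  value-T-upward : ∀ {b q} → - ½ ≤ b → b ≤ q → q ≤ 0ℚ → 0ℚ ≤ value T b → 0ℚ ≤ value T q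
  value-T-upward -½≤b b≤q q≤0 0≤ = 0≤value-T⁺ (sign-monotone k (ℚ.neg-antimono-≤ q≤0) (ℚ.neg-antimono-≤ b≤q)
    (ℚ.neg-antimono-≤ -½≤b) (0≤value-T⁻ 0≤))

  G⪯T : G ⪯ T
  G⪯T = Comparison.G⪯T T G 0≤value-T-0 value-T-½≤0 value-T-upward value-lower

  ⪯-triangleWithK₂s : G ⪯ triangleWithK₂s (length pairs ℕ.+ r)
  ⪯-triangleWithK₂s = subst (G ⪯_) T≡ G⪯T
    where
    T≡ : T ≡ triangleWithK₂s (length pairs ℕ.+ r)
    T≡ = refl

half-dbl : ∀ k → ℕ.⌊ dbl k /2⌋ ≡ k
half-dbl zero    = refl
half-dbl (suc k) = cong suc (half-dbl k)

-- For use with subst: unfolding M inside ⪯ would normalise rational sums.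
triangleWithK₂s≡M : ∀ n → triangleWithK₂s ℕ.⌊ n ℕ.∸ 3 /2⌋ ≡ M n
triangleWithK₂s≡M n = refl

⪯-reindex : ∀ {n j k} (G : Graph n) → j ≡ k → G ⪯ triangleWithK₂s k → G ⪯ triangleWithK₂s j
⪯-reindex G refl G⪯T = G⪯T

module _ {n : ℕ} {G : Graph n} (D : Decomposition G) where
  open Decomposition D

  index : ℕ.⌊ n ℕ.∸ 3 /2⌋ ≡ length pairs ℕ.+ r
  index = trans (cong (λ m → ℕ.⌊ m ℕ.∸ 3 /2⌋) order) (half-dbl (length pairs ℕ.+ r))

  ⪯-M : G ⪯ M n
  ⪯-M = subst (G ⪯_) (triangleWithK₂s≡M n) (⪯-reindex G index (⪯-triangleWithK₂s D))

theorem3p15 : ∀ (n : ℕ) → Odd n → (G : Graph n) →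
    Connected G → WellCovered G → Unicyclic G → G ⪯ M n
theorem3p15 n odd G conn wc unicyclic = ⪯-M (decompose odd G conn wc unicyclic)
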